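{- Let $q\ge 3$ be a prime power and $n\ge 2$. Then each matrix in $M_n(\mathbb F_q)$ is a sum of (a) two invertible cyclic matrices; (b) two invertible semisimple matrices.
   Context: A matrix $A\in M_n(K)$ over a field $K$ is cyclic if its minimal polynomial equals its characteristic polynomial (equivalently, $K^n$ is a cyclic $K[A]$-module). $A$ is semisimple if its minimal polynomial is a product of distinct monic irreducible separable polynomials. -}

module Defs where

open import Level using (0ℓ)
open import Algebra.Bundles using (CommutativeRing)
open import Data.Nat as ℕ using (ℕ; zero; suc)
open import Data.Nat.Primality using (Prime)
open import Data.Fin using (Fin; zero; suc; punchIn)
open import Data.List using (List; []; _∷_; foldr)
open import Data.List.Relation.Unary.All using (All)
open import Data.List.Relation.Unary.AllPairs using (AllPairs)
open import Data.Product using (Σ; ∃; ∃-syntax; _×_; _,_)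
open import Relation.Nullary using (¬_)
open import Relation.Binary.PropositionalEquality using (_≡_)

IsPrimePower : ℕ → Set
IsPrimePower q = ∃[ p ] ∃[ k ] (Prime p × 1 ℕ.≤ k × q ≡ p ℕ.^ k)

module _ (R : CommutativeRing 0ℓ 0ℓ) where
  open CommutativeRing R using (_≈_; _+_; _*_; -_; 0#; 1#) renaming (Carrier to K)

  IsField : Set
  IsField = (¬ (1# ≈ 0#)) × (∀ x → ¬ (x ≈ 0#) → ∃[ y ] (x * y ≈ 1#))

  HasOrder : ℕ → Set
  HasOrder q = Σ (Fin q → K) λ e →
    (∀ i j → e i ≈ e j → i ≡ j) × (∀ x → ∃[ i ] (e i ≈ x))

  -- Polynomials: coefficient lists, lowest degree first
  Poly : Set
  Poly = List K

  infixl 6 _+ₚ_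
  infixl 7 _*ₚ_

  _+ₚ_ : Poly → Poly → Poly
  [] +ₚ q = q
  (a ∷ p) +ₚ [] = a ∷ p
  (a ∷ p) +ₚ (b ∷ q) = (a + b) ∷ (p +ₚ q)

  scaleₚ : K → Poly → Poly
  scaleₚ c [] = []
  scaleₚ c (a ∷ p) = (c * a) ∷ scaleₚ c p

  -ₚ_ : Poly → Poly
  -ₚ p = scaleₚ (- 1#) p

  _*ₚ_ : Poly → Poly → Poly
  [] *ₚ q = []
  (a ∷ p) *ₚ q = scaleₚ a q +ₚ (0# ∷ (p *ₚ q))

  IsZeroₚ : Poly → Set
  IsZeroₚ p = All (_≈ 0#) p

  -- equality of polynomials (ignores trailing zero coefficients)
  _≈ₚ_ : Poly → Poly → Set
  p ≈ₚ q = IsZeroₚ (p +ₚ (-ₚ q))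

  oneₚ : Poly
  oneₚ = 1# ∷ []

  productₚ : List Poly → Poly
  productₚ = foldr _*ₚ_ oneₚ

  Monic : Poly → Set
  Monic [] = 0# ≈ 1#   -- impossible in a field
  Monic (a ∷ []) = a ≈ 1#
  Monic (a ∷ b ∷ p) = Monic (b ∷ p)

  _∣ₚ_ : Poly → Poly → Set
  f ∣ₚ g = ∃[ h ] (g ≈ₚ (f *ₚ h))

  IsConstant : Poly → Set
  IsConstant f = ∃[ c ] (f ≈ₚ (c ∷ []))

  IsUnitₚ : Poly → Set
  IsUnitₚ f = ∃[ c ] ((¬ (c ≈ 0#)) × (f ≈ₚ (c ∷ [])))

  Irreducible : Poly → Set
  Irreducible f = (¬ IsConstant f) ×
    (∀ g h → f ≈ₚ (g *ₚ h) → IsUnitₚ g Data.Sum.⊎ IsUnitₚ h)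
    where import Data.Sum

  natMul : ℕ → K → K
  natMul zero x = 0#
  natMul (suc n) x = x + natMul n x

  derivFrom : ℕ → Poly → Poly
  derivFrom i [] = []
  derivFrom i (a ∷ p) = natMul i a ∷ derivFrom (suc i) p

  deriv : Poly → Poly
  deriv [] = []
  deriv (a ∷ p) = derivFrom 1 p

  Separable : Poly → Set
  Separable f = ∃[ a ] ∃[ b ] (((a *ₚ f) +ₚ (b *ₚ deriv f)) ≈ₚ oneₚ)

  Matrix : ℕ → Set
  Matrix n = Fin n → Fin n → K

  sumFin : ∀ {n} → (Fin n → K) → K
  sumFin {zero} f = 0#
  sumFin {suc n} f = f zero + sumFin (λ i → f (suc i))

  _≈ₘ_ : ∀ {n} → Matrix n → Matrix n → Set
  A ≈ₘ B = ∀ i j → A i j ≈ B i j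

  _+ₘ_ : ∀ {n} → Matrix n → Matrix n → Matrix n
  (A +ₘ B) i j = A i j + B i j

  _*ₘ_ : ∀ {n} → Matrix n → Matrix n → Matrix n
  (A *ₘ B) i j = sumFin (λ k → A i k * B k j)

  δ : ∀ {n} → Fin n → Fin n → K
  δ zero zero = 1#
  δ zero (suc j) = 0#
  δ (suc i) zero = 0#
  δ (suc i) (suc j) = δ i j

  idₘ : ∀ {n} → Matrix n
  idₘ = δ

  zeroₘ : ∀ {n} → Matrix n
  zeroₘ i j = 0#

  scaleₘ : ∀ {n} → K → Matrix n → Matrix n
  scaleₘ c A i j = c * A i j

  Invertible : ∀ {n} → Matrix n → Set
  Invertible A = ∃[ B ] ((A *ₘ B) ≈ₘ idₘ × (B *ₘ A) ≈ₘ idₘ)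

  evalₘ : ∀ {n} → Poly → Matrix n → Matrix n
  evalₘ [] A = zeroₘ
  evalₘ (a ∷ p) A = scaleₘ a idₘ +ₘ (A *ₘ evalₘ p A)

  IsMinPoly : ∀ {n} → Matrix n → Poly → Set
  IsMinPoly A m = Monic m × (evalₘ m A ≈ₘ zeroₘ) ×
    (∀ p → evalₘ p A ≈ₘ zeroₘ → m ∣ₚ p)

  sumFinₚ : ∀ {n} → (Fin n → Poly) → Poly
  sumFinₚ {zero} f = []
  sumFinₚ {suc n} f = f zero +ₚ sumFinₚ (λ i → f (suc i))

  sgn : ∀ {n} → Fin n → K
  sgn zero = 1#
  sgn (suc j) = - sgn j

  detₚ : ∀ {n} → (Fin n → Fin n → Poly) → Poly
  detₚ {zero} M = oneₚ
  detₚ {suc n} M = sumFinₚ (λ j →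
    scaleₚ (sgn j) (M zero j *ₚ detₚ (λ i k → M (suc i) (punchIn j k))))

  charPoly : ∀ {n} → Matrix n → Poly
  charPoly A = detₚ (λ i j → ((- A i j) ∷ []) +ₚ (0# ∷ δ i j ∷ []))

  Cyclic : ∀ {n} → Matrix n → Set
  Cyclic A = ∃[ m ] (IsMinPoly A m × m ≈ₚ charPoly A)

  Semisimple : ∀ {n} → Matrix n → Set
  Semisimple A = ∃[ fs ]
    (All (λ f → Monic f × Irreducible f × Separable f) fs ×
     AllPairs (λ f g → ¬ (f ≈ₚ g)) fs ×
     IsMinPoly A (productₚ fs))

{-# OPTIONS --safe #-}
-- (a) Write M = A + B with A lower and B upper Hessenberg, with ones on the super- respectively subdiagonal;
-- such matrices are cyclic. The diagonal is still free. Going up through the trailing blocks, the determinant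
-- of A vanishes for one value of the new diagonal entry of A, and so does that of B: as q ≥ 3, both can be
-- avoided.
--
-- (b) Being a sum of two invertible semisimple operators is stable under conjugation and direct sums, so it
-- suffices to decompose T = M - 1 into companion operators and to treat one of them, with basis
-- v, T v, …, T^(m-1) v. Write T + 1 = A + B where A is the identity on all basis vectors but the last and has a
-- second eigenvalue μ ∉ {0, 1}. Then B is a companion operator with arbitrary last column, except that μ
-- prescribes its trace, so it may have any characteristic polynomial with that trace. Trinomials
-- X^m - t X^(m-1) + c, or X^m + X + 1, provide separable ones with nonzero constant term.
--
-- For the decomposition, let V = K[T] v ⊕ W with deg v = d and T^d v ∈ K[T] v (otherwise enlarge d). After a
-- shear of W one has T w = x(w) v + Y w for a functional x. If x = 0 then W is invariant; if x(w₀) = 1 then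
-- w₀ generates a cyclic subspace of dimension at least d + 1.
module Submission where

open import Defs
open import Level using (0ℓ)
open import Algebra.Bundles using (CommutativeRing; CommutativeMonoid; RawRing)
open import Algebra.Solver.Ring.AlmostCommutativeRing using (fromCommutativeRing; _-Raw-AlmostCommutative⟶_)
import Algebra.Solver.Ring
import Algebra.Solver.Ring.NaturalCoefficients.Default
import Algebra.Properties.AbelianGroup
import Algebra.Properties.CommutativeSemigroup
import Algebra.Properties.Ring
import Algebra.Properties.Semiring.Mult
import Algebra.Properties.Semiring.Mult.TCOptimised
open import Data.Empty using (⊥; ⊥-elim)
open import Data.Fin as Fin using (Fin; zero; suc; toℕ; punchIn; inject₁)
import Data.Fin.Properties as Fin
open import Data.List using (List; []; _∷_; length; _++_)
open import Data.List.Relation.Unary.All as All using (All; []; _∷_)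
import Data.List.Relation.Unary.All.Properties as All
open import Data.List.Relation.Unary.AllPairs as AllPairs using (AllPairs; []; _∷_)
open import Data.List.Relation.Unary.Any as Any using (Any; here; there)
open import Data.Maybe using (Maybe; just; nothing)
open import Data.Nat as ℕ using (ℕ; zero; suc; _≤_; _<_; z≤n; s≤s)
import Data.Nat.Properties as ℕ
open import Data.Product using (∃; ∃-syntax; _×_; _,_; proj₁; proj₂)
open import Data.Sum as Sum using (_⊎_; inj₁; inj₂)
open import Data.Unit using (⊤; tt)
open import Relation.Binary using (Decidable; IsEquivalence; Setoid)
open import Relation.Binary.PropositionalEquality as ≡ using (_≡_; _≢_)
import Relation.Binary.Reasoning.Setoid
open import Relation.Nullary using (¬_; Dec; yes; no; contradiction)

-- In (b) the trace is the only coupling between the summands of a block of size m ≥ 2: A has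
-- eigenvalues 1 and μ, the former m - 1 times, so the coefficient of X^(m-1) for B is forced. This
-- hurts only if m = 0 in K and the forced trace is 0, when X^m + c is inseparable. A suitable μ
-- usually makes the trace nonzero, but over the field with three elements there may be no choice,
-- whence X^m + X + 1.
--
-- Semisimplicity is carried along as annihilation by a product of distinct separable irreducibles
-- with nonzero constant term. This form passes to direct sums through common multiples, contains
-- invertibility, and postpones the minimal polynomial to the very end, where factors are discarded
-- by testing. The irreducible factors themselves are found by exhaustive search over the finite
-- field.
--
-- In (a) the lower Hessenberg summand is treated through its transpose. Both the invariance of the
-- characteristic polynomial under transposition and the Cayley-Hamilton theorem are established for
-- Hessenberg matrices alone, where a single elimination with pivots -1 yields them.

TwoAvoidable : CommutativeRing 0ℓ 0ℓ → Set
TwoAvoidable F = ∀ a b → ∃[ c ] (¬ (c ≈ a) × ¬ (c ≈ b))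
  where open CommutativeRing F

-- A solver for commutative rings with integer coefficients

module RingSolver (R : CommutativeRing 0ℓ 0ℓ) where

  private
    open CommutativeRing R
    open Algebra.Properties.Semiring.Mult semiring renaming (_×_ to _·_)
    open Algebra.Properties.Semiring.Mult.TCOptimised semiring using (×ᵤ≈×) renaming (_×_ to _·′_)
    open Algebra.Properties.Ring ring
    open Algebra.Properties.AbelianGroup +-abelianGroup
    open Algebra.Solver.Ring.NaturalCoefficients.Default commutativeSemiring using (_:+_; _:*_; _:=_; solve)
    open import Relation.Binary.Reasoning.Setoid setoid

    reduce : ℕ × ℕ → ℕ × ℕ
    reduce (a , b) = a ℕ.∸ b , b ℕ.∸ a

    -- Integer coefficients as reduced formal differences of naturals.
    Diff : RawRing 0ℓ 0ℓ
    Diff = record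
      { Carrier = ℕ × ℕ
      ; _≈_ = _≡_
      ; _+_ = λ (a , b) (c , d) → reduce (a ℕ.+ c , b ℕ.+ d)
      ; _*_ = λ (a , b) (c , d) → reduce (a ℕ.* c ℕ.+ b ℕ.* d , a ℕ.* d ℕ.+ b ℕ.* c)
      ; -_ = λ (a , b) → b , a
      ; 0# = 0 , 0
      ; 1# = 1 , 0
      }

    ⟦_⟧ : ℕ × ℕ → Carrier
    ⟦ a , b ⟧ = a · 1# - b · 1#

    -- Agrees with ⟦_⟧, but sends (0 , 0) and (1 , 0) to 0# and 1# by computation.
    ⟦_⟧′ : ℕ × ℕ → Carrier
    ⟦ a , ℕ.zero ⟧′ = a ·′ 1#
    ⟦ a , ℕ.suc b ⟧′ = ⟦ a , ℕ.suc b ⟧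

    ⟦⟧′≈⟦⟧ : ∀ x → ⟦ x ⟧′ ≈ ⟦ x ⟧
    ⟦⟧′≈⟦⟧ (a , ℕ.zero) = sym (trans (+-cong (×ᵤ≈× a 1#) -0#≈0#) (+-identityʳ _))
    ⟦⟧′≈⟦⟧ (a , ℕ.suc b) = refl

    +-homo : ∀ a b c d → ⟦ a ℕ.+ c , b ℕ.+ d ⟧ ≈ ⟦ a , b ⟧ + ⟦ c , d ⟧
    +-homo a b c d = begin
      (a ℕ.+ c) · 1# - (b ℕ.+ d) · 1#
        ≈⟨ +-cong (×-homo-+ 1# a c) (-‿cong (×-homo-+ 1# b d)) ⟩
      (a · 1# + c · 1#) - (b · 1# + d · 1#)
        ≈⟨ +-congˡ (⁻¹-∙-comm _ _) ⟨
      (a · 1# + c · 1#) + (- (b · 1#) + - (d · 1#))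
        ≈⟨ solve 4 (λ x y z w → (x :+ z) :+ (y :+ w) := (x :+ y) :+ (z :+ w)) refl _ _ _ _ ⟩
      ⟦ a , b ⟧ + ⟦ c , d ⟧ ∎

    *-homo : ∀ a b c d → ⟦ a ℕ.* c ℕ.+ b ℕ.* d , a ℕ.* d ℕ.+ b ℕ.* c ⟧ ≈ ⟦ a , b ⟧ * ⟦ c , d ⟧
    *-homo a b c d = begin
      ⟦ a ℕ.* c ℕ.+ b ℕ.* d , a ℕ.* d ℕ.+ b ℕ.* c ⟧
        ≈⟨ +-homo (a ℕ.* c) (a ℕ.* d) (b ℕ.* d) (b ℕ.* c) ⟩
      ((a ℕ.* c) · 1# - (a ℕ.* d) · 1#) + ((b ℕ.* d) · 1# - (b ℕ.* c) · 1#)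
        ≈⟨ +-cong (+-cong (×1-homo-* a c) (-‿cong (×1-homo-* a d)))
                  (+-cong (×1-homo-* b d) (-‿cong (×1-homo-* b c))) ⟩
      (x * z - x * w) + (y * w - y * z)
        ≈⟨ +-cong (+-congˡ (-‿distribʳ-* _ _)) (+-cong (sym (trans (sym (-‿distribˡ-* _ _))
              (trans (-‿cong (sym (-‿distribʳ-* _ _))) (⁻¹-involutive _)))) (-‿distribˡ-* _ _)) ⟩
      (x * z + x * - w) + (- y * - w + - y * z)
        ≈⟨ solve 4 (λ x z w′ y′ → (x :* z :+ x :* w′) :+ (y′ :* w′ :+ y′ :* z)
                  := (x :+ y′) :* (z :+ w′)) refl x z (- w) (- y) ⟩
      ⟦ a , b ⟧ * ⟦ c , d ⟧ ∎
      where
      x = a · 1#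
      y = b · 1#
      z = c · 1#
      w = d · 1#

    neg-homo : ∀ a b → ⟦ b , a ⟧ ≈ - ⟦ a , b ⟧
    neg-homo a b = sym (trans (sym (⁻¹-∙-comm _ _)) (trans (+-congˡ (⁻¹-involutive _)) (+-comm _ _)))

    -- Soundness both of reducing a formal difference and of comparing two of them comes down to
    -- this.
    cross : ∀ a b c d → a ℕ.+ d ≡ c ℕ.+ b → ⟦ a , b ⟧ ≈ ⟦ c , d ⟧
    cross a b c d eq = begin
      a · 1# - b · 1#
        ≈⟨ +-congʳ (trans (+-congˡ (-‿inverseʳ _)) (+-identityʳ _)) ⟨
      (a · 1# + (d · 1# - d · 1#)) - b · 1#
        ≈⟨ +-congʳ (+-assoc _ _ _) ⟨
      ((a · 1# + d · 1#) - d · 1#) - b · 1#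
        ≈⟨ +-congʳ (+-congʳ (trans (sym (×-homo-+ 1# a d)) (trans (×-congˡ eq) (×-homo-+ 1# c b)))) ⟩
      ((c · 1# + b · 1#) - d · 1#) - b · 1#
        ≈⟨ solve 4 (λ c b d′ b′ → ((c :+ b) :+ d′) :+ b′ := (c :+ d′) :+ (b :+ b′)) refl _ _ _ _ ⟩
      (c · 1# - d · 1#) + (b · 1# - b · 1#)
        ≈⟨ trans (+-congˡ (-‿inverseʳ _)) (+-identityʳ _) ⟩
      c · 1# - d · 1# ∎

    reduce-homo : ∀ x → ⟦ reduce x ⟧ ≈ ⟦ x ⟧
    reduce-homo (a , b) = cross (a ℕ.∸ b) (b ℕ.∸ a) a b (balance a b)
      where
      balance : ∀ a b → a ℕ.∸ b ℕ.+ b ≡ a ℕ.+ (b ℕ.∸ a)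
      balance ℕ.zero ℕ.zero = ≡.refl
      balance ℕ.zero (ℕ.suc b) = ≡.refl
      balance (ℕ.suc a) ℕ.zero = ≡.refl
      balance (ℕ.suc a) (ℕ.suc b) = ≡.trans (ℕ.+-suc (a ℕ.∸ b) b) (≡.cong ℕ.suc (balance a b))

    morphism : Diff -Raw-AlmostCommutative⟶ fromCommutativeRing R
    morphism = record
      { ⟦_⟧ = ⟦_⟧′
      ; +-homo = λ x@(a , b) y@(c , d) → trans (⟦⟧′≈⟦⟧ (reduce (a ℕ.+ c , b ℕ.+ d)))
          (trans (trans (reduce-homo (a ℕ.+ c , b ℕ.+ d)) (+-homo a b c d)) (sym (+-cong (⟦⟧′≈⟦⟧ x) (⟦⟧′≈⟦⟧ y))))
      ; *-homo = λ x@(a , b) y@(c , d) → trans (⟦⟧′≈⟦⟧ (reduce (a ℕ.* c ℕ.+ b ℕ.* d , a ℕ.* d ℕ.+ b ℕ.* c)))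
          (trans (trans (reduce-homo (a ℕ.* c ℕ.+ b ℕ.* d , a ℕ.* d ℕ.+ b ℕ.* c)) (*-homo a b c d)) (sym (*-cong (⟦⟧′≈⟦⟧ x) (⟦⟧′≈⟦⟧ y))))
      ; -‿homo = λ x@(a , b) → trans (⟦⟧′≈⟦⟧ (b , a)) (trans (neg-homo a b) (-‿cong (sym (⟦⟧′≈⟦⟧ x))))
      ; 0-homo = refl
      ; 1-homo = refl
      }

    dec : ∀ x y → Maybe (⟦ x ⟧′ ≈ ⟦ y ⟧′)
    dec x@(a , b) y@(c , d) with a ℕ.+ d ℕ.≟ c ℕ.+ b
    ... | yes eq = just (trans (⟦⟧′≈⟦⟧ x) (trans (cross a b c d eq) (sym (⟦⟧′≈⟦⟧ y))))
    ... | no _ = nothing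

  open Algebra.Solver.Ring Diff (fromCommutativeRing R) morphism dec public

  :0 :1 : ∀ {n} → Polynomial n
  :0 = con (0 , 0)
  :1 = con (1 , 0)

-- Ring identities behind Bezout relations and separability certificates

module RingIdentities (R : CommutativeRing 0ℓ 0ℓ) where

  open CommutativeRing R
  open RingSolver R using (solve; _:+_; _:*_; _:-_; :-_; _:=_; :0; :1)

  x+y≈[z+x]+[y-z] : ∀ x y z → x + y ≈ (z + x) + (y - z)
  x+y≈[z+x]+[y-z] = solve 3 (λ x y z → x :+ y := (z :+ x) :+ (y :- z)) refl

  r≈[x+r]-x : ∀ x r → r ≈ (x + r) - x
  r≈[x+r]-x = solve 2 (λ x r → r := (x :+ r) :- x) refl

  gk-gh≈g[k-h] : ∀ g h k → g * k - g * h ≈ g * (k - h)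
  gk-gh≈g[k-h] = solve 3 (λ g h k → g :* k :- g :* h := g :* (k :- h)) refl

  bezout-step : ∀ a p b r k → a * p + b * r ≈ b * (p * k + r) + (a - b * k) * p
  bezout-step = solve 5 (λ a p b r k → a :* p :+ b :* r := b :* (p :* k :+ r) :+ (a :- b :* k) :* p) refl

  bezout-scale : ∀ u a f b p → (u * a) * f + (u * b) * p ≈ (a * f + b * p) * u
  bezout-scale = solve 5 (λ u a f b p → (u :* a) :* f :+ (u :* b) :* p := (a :* f :+ b :* p) :* u) refl

  [hu]g≈[gh]u : ∀ g h u → (h * u) * g ≈ (g * h) * u
  [hu]g≈[gh]u = solve 3 (λ g h u → (h :* u) :* g := (g :* h) :* u) refl

  -- With `g′` and `h′` the derivatives, the Leibniz rule makes the left side a combination of g h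
  -- and its derivative; the right side is one of g and its own derivative.
  sep-factor : ∀ a b g h g′ h′ →
    a * (g * h) + b * (g′ * h + g * h′) ≈ (a * h + b * h′) * g + (b * h) * g′
  sep-factor = solve 6 (λ a b g h g′ h′ → a :* (g :* h) :+ b :* (g′ :* h :+ g :* h′)
    := (a :* h :+ b :* h′) :* g :+ (b :* h) :* g′) refl

  -- With `g′` and `t` the derivatives of g and g s, every combination of g² s and its derivative is
  -- seen to be a multiple of g.
  sep-square : ∀ a b g s g′ t →
    a * (g * (g * s)) + b * (g′ * (g * s) + g * t) ≈ g * (a * (g * s) + b * (g′ * s + t))
  sep-square = solve 6 (λ a b g s g′ t → a :* (g :* (g :* s)) :+ b :* (g′ :* (g :* s) :+ g :* t)
    := g :* (a :* (g :* s) :+ b :* (g′ :* s :+ t))) refl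

  x+[y+[z+w]]≈[y+z]+[x+w] : ∀ x y z w → x + (y + (z + w)) ≈ (y + z) + (x + w)
  x+[y+[z+w]]≈[y+z]+[x+w] = solve 4 (λ x y z w → x :+ (y :+ (z :+ w)) := (y :+ z) :+ (x :+ w)) refl

  [af+bp]q≈f[aq]+b[pq] : ∀ a f b p q → (a * f + b * p) * q ≈ f * (a * q) + b * (p * q)
  [af+bp]q≈f[aq]+b[pq] = solve 5 (λ a f b p q → (a :* f :+ b :* p) :* q := f :* (a :* q) :+ b :* (p :* q)) refl

  -- X² y - t X y + c has derivative (n+1) X y - n t y when y = X ^ (n-1).
  sep-n+1≈0 : ∀ X y t t⁻¹ c c⁻¹ → t⁻¹ * t ≈ 1# → c⁻¹ * c ≈ 1# →
    c⁻¹ * (X * (X * y) - t * (X * y) + c) + (- (c⁻¹ * (t⁻¹ * (X * (X - t))))) * (t * y) ≈ 1#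
  sep-n+1≈0 X y t t⁻¹ c c⁻¹ et ec = trans
    (solve 6 (λ X y t t′ c c′ → c′ :* (X :* (X :* y) :- t :* (X :* y) :+ c) :+ (:- (c′ :* (t′ :* (X :* (X :- t))))) :* (t :* y)
      := c′ :* c :+ (:1 :- t′ :* t) :* (c′ :* (X :* (X :- t) :* y))) refl X y t t⁻¹ c c⁻¹)
    (trans (+-cong ec (trans (*-congʳ (trans (+-congˡ (-‿cong et)) (-‿inverseʳ 1#))) (zeroˡ _))) (+-identityʳ 1#))

  -- The derivative of f = f₀ + c is y (N X - n t), where N X - n t = N (X - x₀) with x₀ = n t / N.
  -- Since (X - t) X y = f₀ = f - c, combining f with its derivative leaves a unit multiple of X -
  -- x₀. As f = (X - x₀) h + s, this and f together produce the unit s, the value of f at x₀.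
  sep-n+1≉0 : ∀ X y t c c⁻¹ n N⁻¹ h s s⁻¹ →
    let N = 1# + n
        f₀ = X * (X * y) - t * (X * y)
        u = s⁻¹ * (h * (N⁻¹ * c⁻¹)) in
    f₀ + c ≈ (X - N⁻¹ * (n * t)) * h + s → N⁻¹ * N ≈ 1# → c⁻¹ * c ≈ 1# → s⁻¹ * s ≈ 1# →
    (s⁻¹ - u * ((X - t) * N + t)) * (f₀ + c) + u * ((X - t) * X) * (N * (X * y) - t * (n * y)) ≈ 1#
  sep-n+1≉0 X y t c c⁻¹ n N⁻¹ h s s⁻¹ ef eN ec es = begin
    (s⁻¹ - u * ((X - t) * N + t)) * (f₀ + c) + u * ((X - t) * X) * (N * (X * y) - t * (n * y))
      ≈⟨ solve 7 (λ X y t c n s′ u → let N = :1 :+ n ; f = X :* (X :* y) :- t :* (X :* y) :+ c in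
           (s′ :- u :* ((X :- t) :* N :+ t)) :* f :+ u :* ((X :- t) :* X) :* (N :* (X :* y) :- t :* (n :* y))
           := s′ :* f :- u :* (c :* (N :* X :- n :* t))) refl X y t c n s⁻¹ u ⟩
    s⁻¹ * (f₀ + c) - u * (c * (N * X - n * t))
      ≈⟨ +-congˡ (-‿cong (solve 8 (λ X t c c′ n N′ s′ h → let N = :1 :+ n in
           s′ :* (h :* (N′ :* c′)) :* (c :* (N :* X :- n :* t))
           := (s′ :* h) :* ((c′ :* c) :* ((N′ :* N) :* X :- N′ :* (n :* t)))) refl X t c c⁻¹ n N⁻¹ s⁻¹ h)) ⟩
    s⁻¹ * (f₀ + c) - (s⁻¹ * h) * ((c⁻¹ * c) * ((N⁻¹ * N) * X - N⁻¹ * (n * t)))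
      ≈⟨ +-cong (*-congˡ ef) (-‿cong (*-congˡ (*-cong ec (+-congʳ (*-congʳ eN))))) ⟩
    s⁻¹ * ((X - N⁻¹ * (n * t)) * h + s) - (s⁻¹ * h) * (1# * (1# * X - N⁻¹ * (n * t)))
      ≈⟨ solve 5 (λ X x₀ h s s′ → s′ :* ((X :- x₀) :* h :+ s) :- (s′ :* h) :* (:1 :* (:1 :* X :- x₀)) := s′ :* s) refl _ _ _ _ _ ⟩
    s⁻¹ * s ≈⟨ es ⟩
    1# ∎
    where
    open import Relation.Binary.Reasoning.Setoid setoid
    N = 1# + n
    f₀ = X * (X * y) - t * (X * y)
    u = s⁻¹ * (h * (N⁻¹ * c⁻¹))

  sub-add : ∀ x y c → x - (y + - c) ≈ (x - y) + c
  sub-add = solve 3 (λ x y c → x :- (y :+ :- c) := (x :- y) :+ c) refl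

  -- The discriminant identity (p + q)² - 4 p q = e², divided by e². For monic linear p and q the
  -- sum p + q is the derivative of p q.
  sep-pair : ∀ q e e⁻¹ → e⁻¹ * e ≈ 1# → let p = q + e ; i = e⁻¹ * e⁻¹ in
    (- ((1# + 1# + 1# + 1#) * i)) * (p * q) + (i * (p + q)) * (q + p) ≈ 1#
  sep-pair q e e⁻¹ h = trans
    (solve 3 (λ q e e′ → let p = q :+ e ; i = e′ :* e′ in
      (:- ((:1 :+ :1 :+ :1 :+ :1) :* i)) :* (p :* q) :+ (i :* (p :+ q)) :* (q :+ p) := (e′ :* e) :* (e′ :* e)) refl q e e⁻¹)
    (trans (*-cong h h) (*-identityˡ 1#))

  x-[x-y]≈y : ∀ x y → x - (x - y) ≈ y
  x-[x-y]≈y = solve 2 (λ x y → x :- (x :- y) := y) refl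

  [uf]p≈[up]f : ∀ u f p → (u * f) * p ≈ (u * p) * f
  [uf]p≈[up]f = solve 3 (λ u f p → (u :* f) :* p := (u :* p) :* f) refl

  [af+bs][uq]≈a[[uf]q]+b[u[qs]] : ∀ a f b s u q →
    (a * f + b * s) * (u * q) ≈ a * ((u * f) * q) + b * (u * (q * s))
  [af+bs][uq]≈a[[uf]q]+b[u[qs]] = solve 6 (λ a f b s u q →
    (a :* f :+ b :* s) :* (u :* q) := a :* ((u :* f) :* q) :+ b :* (u :* (q :* s))) refl

  -[s[r[-1d]]]≈s[rd] : ∀ s r d → - (s * (r * ((- 1#) * d))) ≈ s * (r * d)
  -[s[r[-1d]]]≈s[rd] = solve 3 (λ s r d → :- (s :* (r :* ((:- :1) :* d))) := s :* (r :* d)) refl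

  -[-1x]≈x : ∀ x → - ((- 1#) * x) ≈ x
  -[-1x]≈x = solve 1 (λ x → :- ((:- :1) :* x) := x) refl

  [xa+b]c+[xd+e]≈x[ac+d]+[bc+e] : ∀ x a b c d e → (x * a + b) * c + (x * d + e) ≈ x * (a * c + d) + (b * c + e)
  [xa+b]c+[xd+e]≈x[ac+d]+[bc+e] = solve 6 (λ x a b c d e →
    (x :* a :+ b) :* c :+ (x :* d :+ e) := x :* (a :* c :+ d) :+ (b :* c :+ e)) refl

-- The ring of polynomials up to trailing zeros

module Polynomials (F : CommutativeRing 0ℓ 0ℓ) where

  open CommutativeRing F renaming (Carrier to K) hiding (zero; semiring)
  open RingSolver F using (solve; _:+_; _:*_; _:-_; :-_; _:=_; :0; :1)

  private
    P = Poly F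

  infixl 6 _⊕_
  infixl 7 _⊛_
  infix 4 _≋_

  -- Opaque copies of the list operations: these do not compute, so unification can read off their arguments.
  opaque
    _⊕_ _⊛_ : P → P → P
    _⊕_ = _+ₚ_ F
    _⊛_ = _*ₚ_ F

    scale : K → P → P
    scale = scaleₚ F

    ⊕-unfold : ∀ p q → p ⊕ q ≡ _+ₚ_ F p q
    ⊕-unfold p q = ≡.refl

    ⊛-unfold : ∀ p q → p ⊛ q ≡ _*ₚ_ F p q
    ⊛-unfold p q = ≡.refl

    scale-unfold : ∀ c p → scale c p ≡ scaleₚ F c p
    scale-unfold c p = ≡.refl

  coef : P → ℕ → K
  coef [] i = 0#
  coef (a ∷ p) zero = a
  coef (a ∷ p) (suc i) = coef p i

  -- Comparing coefficients makes trailing zeros invisible; the record keeps `p` and `q` recoverable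
  -- by unification.
  record _≋_ (p q : P) : Set where
    constructor coefwise
    field at : ∀ i → coef p i ≈ coef q i
  open _≋_ public

  ≋-refl : ∀ {p} → p ≋ p
  ≋-refl = coefwise λ _ → refl

  ≋-sym : ∀ {p q} → p ≋ q → q ≋ p
  ≋-sym e = coefwise λ i → sym (at e i)

  ≋-trans : ∀ {p q r} → p ≋ q → q ≋ r → p ≋ r
  ≋-trans e f = coefwise λ i → trans (at e i) (at f i)

  polySetoid : Setoid 0ℓ 0ℓ
  polySetoid = record { Carrier = P ; _≈_ = _≋_
    ; isEquivalence = record { refl = ≋-refl ; sym = ≋-sym ; trans = ≋-trans } }

  opaque
    unfolding _⊕_

    []-⊕ : ∀ p → [] ⊕ p ≋ p
    []-⊕ p = ≋-refl

    ∷-⊕-∷ : ∀ a p b q → (a ∷ p) ⊕ (b ∷ q) ≋ (a + b) ∷ (p ⊕ q)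
    ∷-⊕-∷ a p b q = ≋-refl

    []-⊛ : ∀ p → [] ⊛ p ≋ []
    []-⊛ p = ≋-refl

    ∷-⊛ : ∀ a p q → (a ∷ p) ⊛ q ≋ scale a q ⊕ (0# ∷ (p ⊛ q))
    ∷-⊛ a p q = ≋-refl

    coef-⊕ : ∀ p q i → coef (p ⊕ q) i ≈ coef p i + coef q i
    coef-⊕ [] q i = sym (+-identityˡ _)
    coef-⊕ (a ∷ p) [] i = sym (+-identityʳ _)
    coef-⊕ (a ∷ p) (b ∷ q) zero = refl
    coef-⊕ (a ∷ p) (b ∷ q) (suc i) = coef-⊕ p q i

    coef-scale : ∀ c p i → coef (scale c p) i ≈ c * coef p i
    coef-scale c [] i = sym (zeroʳ c)
    coef-scale c (a ∷ p) zero = refl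
    coef-scale c (a ∷ p) (suc i) = coef-scale c p i

  ∷-cong : ∀ {a b p q} → a ≈ b → p ≋ q → (a ∷ p) ≋ (b ∷ q)
  ∷-cong e f = coefwise λ { zero → e ; (suc i) → at f i }

  0∷[]≋[] : 0# ∷ [] ≋ []
  0∷[]≋[] = coefwise λ { zero → refl ; (suc i) → refl }

  ∷-injʳ : ∀ {a b p q} → (a ∷ p) ≋ (b ∷ q) → p ≋ q
  ∷-injʳ e = coefwise λ i → at e (suc i)

  ∷≋[]⇒tail : ∀ {a p} → (a ∷ p) ≋ [] → p ≋ []
  ∷≋[]⇒tail e = coefwise λ i → at e (suc i)

  ⊕-cong : ∀ {p p′ q q′} → p ≋ p′ → q ≋ q′ → p ⊕ q ≋ p′ ⊕ q′
  ⊕-cong {p} {p′} {q} {q′} e f = coefwise λ i →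
    trans (coef-⊕ p q i) (trans (+-cong (at e i) (at f i)) (sym (coef-⊕ p′ q′ i)))

  scale-cong : ∀ {c d p q} → c ≈ d → p ≋ q → scale c p ≋ scale d q
  scale-cong {c} {d} {p} {q} e f = coefwise λ i →
    trans (coef-scale c p i) (trans (*-cong e (at f i)) (sym (coef-scale d q i)))

  ⊕-assoc : ∀ p q r → (p ⊕ q) ⊕ r ≋ p ⊕ (q ⊕ r)
  ⊕-assoc p q r = coefwise λ i →
    trans (coef-⊕ (p ⊕ q) r i) (trans (+-congʳ (coef-⊕ p q i)) (trans (+-assoc _ _ _)
    (sym (trans (coef-⊕ p (q ⊕ r) i) (+-congˡ (coef-⊕ q r i))))))

  ⊕-comm : ∀ p q → p ⊕ q ≋ q ⊕ p
  ⊕-comm p q = coefwise λ i → trans (coef-⊕ p q i) (trans (+-comm _ _) (sym (coef-⊕ q p i)))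

  ⊕-identityʳ : ∀ p → p ⊕ [] ≋ p
  ⊕-identityʳ p = ≋-trans (⊕-comm p []) ([]-⊕ p)

  ⊕-inverseʳ : ∀ p → p ⊕ scale (- 1#) p ≋ []
  ⊕-inverseʳ p = coefwise λ i → trans (coef-⊕ p (scale (- 1#) p) i)
    (trans (+-congˡ (coef-scale (- 1#) p i)) (solve 1 (λ x → x :+ :- :1 :* x := :0) refl _))

  scale-distribˡ : ∀ c p q → scale c (p ⊕ q) ≋ scale c p ⊕ scale c q
  scale-distribˡ c p q = coefwise λ i → trans (coef-scale c (p ⊕ q) i)
    (trans (*-congˡ (coef-⊕ p q i)) (trans (distribˡ _ _ _)
    (sym (trans (coef-⊕ (scale c p) (scale c q) i) (+-cong (coef-scale c p i) (coef-scale c q i))))))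

  scale-distribʳ : ∀ c d p → scale (c + d) p ≋ scale c p ⊕ scale d p
  scale-distribʳ c d p = coefwise λ i → trans (coef-scale (c + d) p i) (trans (distribʳ _ _ _)
    (sym (trans (coef-⊕ (scale c p) (scale d p) i) (+-cong (coef-scale c p i) (coef-scale d p i)))))

  scale-scale : ∀ c d p → scale c (scale d p) ≋ scale (c * d) p
  scale-scale c d p = coefwise λ i → trans (coef-scale c (scale d p) i)
    (trans (*-congˡ (coef-scale d p i)) (trans (sym (*-assoc _ _ _)) (sym (coef-scale (c * d) p i))))

  scale-1 : ∀ p → scale 1# p ≋ p
  scale-1 p = coefwise λ i → trans (coef-scale 1# p i) (*-identityˡ _)

  scale-[] : ∀ {c} → scale c [] ≋ []
  scale-[] {c} = coefwise λ i → trans (coef-scale c [] i) (zeroʳ c)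

  scale-0 : ∀ p → scale 0# p ≋ []
  scale-0 p = coefwise λ i → trans (coef-scale 0# p i) (zeroˡ _)

  private
    open import Relation.Binary.Reasoning.Setoid polySetoid

    ⊕-interchange : ∀ p q r s → (p ⊕ q) ⊕ (r ⊕ s) ≋ (p ⊕ r) ⊕ (q ⊕ s)
    ⊕-interchange p q r s = coefwise λ i →
      trans (coef-⊕ (p ⊕ q) (r ⊕ s) i) (trans (+-cong (coef-⊕ p q i) (coef-⊕ r s i))
      (trans (solve 4 (λ p q r s → (p :+ q) :+ (r :+ s) := (p :+ r) :+ (q :+ s)) refl _ _ _ _)
      (sym (trans (coef-⊕ (p ⊕ r) (q ⊕ s) i) (+-cong (coef-⊕ p r i) (coef-⊕ q s i))))))

    0∷-⊕ : ∀ p q → 0# ∷ (p ⊕ q) ≋ (0# ∷ p) ⊕ (0# ∷ q)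
    0∷-⊕ p q = ≋-trans (∷-cong (sym (+-identityˡ _)) ≋-refl) (≋-sym (∷-⊕-∷ _ _ _ _))

  scale-∷ : ∀ c a p → scale c (a ∷ p) ≋ c * a ∷ scale c p
  scale-∷ c a p = coefwise λ { zero → coef-scale c (a ∷ p) zero
    ; (suc i) → trans (coef-scale c (a ∷ p) (suc i)) (sym (coef-scale c p i)) }

  ⊛-zeroʳ : ∀ p → p ⊛ [] ≋ []
  ⊛-zeroʳ [] = []-⊛ []
  ⊛-zeroʳ (a ∷ p) = begin
    (a ∷ p) ⊛ [] ≈⟨ ∷-⊛ a p [] ⟩
    scale a [] ⊕ (0# ∷ p ⊛ []) ≈⟨ ⊕-cong scale-[] (≋-trans (∷-cong refl (⊛-zeroʳ p)) 0∷[]≋[]) ⟩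
    [] ⊕ [] ≈⟨ []-⊕ [] ⟩
    [] ∎

  ⊛-congˡ : ∀ p {q r} → q ≋ r → p ⊛ q ≋ p ⊛ r
  ⊛-congˡ [] {q} {r} e = ≋-trans ([]-⊛ q) (≋-sym ([]-⊛ r))
  ⊛-congˡ (a ∷ p) {q} {r} e = begin
    (a ∷ p) ⊛ q ≈⟨ ∷-⊛ a p q ⟩
    scale a q ⊕ (0# ∷ p ⊛ q) ≈⟨ ⊕-cong (scale-cong refl e) (∷-cong refl (⊛-congˡ p e)) ⟩
    scale a r ⊕ (0# ∷ p ⊛ r) ≈⟨ ∷-⊛ a p r ⟨
    (a ∷ p) ⊛ r ∎

  ⊛-distribˡ : ∀ p q r → p ⊛ (q ⊕ r) ≋ p ⊛ q ⊕ p ⊛ r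
  ⊛-distribˡ [] q r = ≋-trans ([]-⊛ _) (≋-sym (≋-trans (⊕-cong ([]-⊛ q) ([]-⊛ r)) ([]-⊕ [])))
  ⊛-distribˡ (a ∷ p) q r = begin
    (a ∷ p) ⊛ (q ⊕ r) ≈⟨ ∷-⊛ a p (q ⊕ r) ⟩
    scale a (q ⊕ r) ⊕ (0# ∷ p ⊛ (q ⊕ r))
      ≈⟨ ⊕-cong (scale-distribˡ a q r) (≋-trans (∷-cong refl (⊛-distribˡ p q r)) (0∷-⊕ _ _)) ⟩
    (scale a q ⊕ scale a r) ⊕ ((0# ∷ p ⊛ q) ⊕ (0# ∷ p ⊛ r)) ≈⟨ ⊕-interchange _ _ _ _ ⟩
    (scale a q ⊕ (0# ∷ p ⊛ q)) ⊕ (scale a r ⊕ (0# ∷ p ⊛ r)) ≈⟨ ⊕-cong (∷-⊛ a p q) (∷-⊛ a p r) ⟨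
    (a ∷ p) ⊛ q ⊕ (a ∷ p) ⊛ r ∎

  -- The mirror image of the defining recursion, which turns commutativity into a plain induction.
  ⊛-consʳ : ∀ p b q → p ⊛ (b ∷ q) ≋ scale b p ⊕ (0# ∷ p ⊛ q)
  ⊛-consʳ [] b q = begin
    [] ⊛ (b ∷ q) ≈⟨ []-⊛ _ ⟩
    [] ≈⟨ []-⊕ [] ⟨
    [] ⊕ [] ≈⟨ ⊕-cong scale-[] (≋-trans (∷-cong refl ([]-⊛ q)) 0∷[]≋[]) ⟨
    scale b [] ⊕ (0# ∷ [] ⊛ q) ∎
  ⊛-consʳ (a ∷ p) b q = begin
    (a ∷ p) ⊛ (b ∷ q) ≈⟨ ∷-⊛ a p (b ∷ q) ⟩
    scale a (b ∷ q) ⊕ (0# ∷ p ⊛ (b ∷ q)) ≈⟨ ⊕-cong (scale-∷ a b q) (∷-cong refl (⊛-consʳ p b q)) ⟩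
    (a * b ∷ scale a q) ⊕ (0# ∷ (scale b p ⊕ (0# ∷ p ⊛ q))) ≈⟨ ∷-⊕-∷ _ _ _ _ ⟩
    a * b + 0# ∷ (scale a q ⊕ (scale b p ⊕ (0# ∷ p ⊛ q))) ≈⟨ ∷-cong (+-congʳ (*-comm a b)) (begin
      scale a q ⊕ (scale b p ⊕ (0# ∷ p ⊛ q)) ≈⟨ ⊕-assoc _ _ _ ⟨
      (scale a q ⊕ scale b p) ⊕ (0# ∷ p ⊛ q) ≈⟨ ⊕-cong (⊕-comm _ _) ≋-refl ⟩
      (scale b p ⊕ scale a q) ⊕ (0# ∷ p ⊛ q) ≈⟨ ⊕-assoc _ _ _ ⟩
      scale b p ⊕ (scale a q ⊕ (0# ∷ p ⊛ q)) ≈⟨ ⊕-cong ≋-refl (∷-⊛ a p q) ⟨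
      scale b p ⊕ ((a ∷ p) ⊛ q) ∎) ⟩
    b * a + 0# ∷ (scale b p ⊕ ((a ∷ p) ⊛ q)) ≈⟨ ∷-⊕-∷ _ _ _ _ ⟨
    (b * a ∷ scale b p) ⊕ (0# ∷ (a ∷ p) ⊛ q) ≈⟨ ⊕-cong (scale-∷ b a p) ≋-refl ⟨
    scale b (a ∷ p) ⊕ (0# ∷ (a ∷ p) ⊛ q) ∎

  ⊛-comm : ∀ p q → p ⊛ q ≋ q ⊛ p
  ⊛-comm [] q = ≋-trans ([]-⊛ q) (≋-sym (⊛-zeroʳ q))
  ⊛-comm (a ∷ p) q = begin
    (a ∷ p) ⊛ q ≈⟨ ∷-⊛ a p q ⟩
    scale a q ⊕ (0# ∷ p ⊛ q) ≈⟨ ⊕-cong ≋-refl (∷-cong refl (⊛-comm p q)) ⟩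
    scale a q ⊕ (0# ∷ q ⊛ p) ≈⟨ ⊛-consʳ q a p ⟨
    q ⊛ (a ∷ p) ∎

  ⊛-cong : ∀ {p p′ q q′} → p ≋ p′ → q ≋ q′ → p ⊛ q ≋ p′ ⊛ q′
  ⊛-cong {p} {p′} {q} {q′} e f = begin
    p ⊛ q ≈⟨ ⊛-congˡ p f ⟩
    p ⊛ q′ ≈⟨ ⊛-comm p q′ ⟩
    q′ ⊛ p ≈⟨ ⊛-congˡ q′ e ⟩
    q′ ⊛ p′ ≈⟨ ⊛-comm q′ p′ ⟩
    p′ ⊛ q′ ∎

  ⊛-distribʳ : ∀ p q r → (q ⊕ r) ⊛ p ≋ q ⊛ p ⊕ r ⊛ p
  ⊛-distribʳ p q r = ≋-trans (⊛-comm (q ⊕ r) p)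
    (≋-trans (⊛-distribˡ p q r) (⊕-cong (⊛-comm p q) (⊛-comm p r)))

  scale-⊛ : ∀ c p q → scale c p ⊛ q ≋ scale c (p ⊛ q)
  scale-⊛ c [] q = begin
    scale c [] ⊛ q ≈⟨ ⊛-cong scale-[] ≋-refl ⟩
    [] ⊛ q ≈⟨ []-⊛ q ⟩
    [] ≈⟨ scale-[] ⟨
    scale c [] ≈⟨ scale-cong refl ([]-⊛ q) ⟨
    scale c ([] ⊛ q) ∎
  scale-⊛ c (a ∷ p) q = begin
    scale c (a ∷ p) ⊛ q ≈⟨ ⊛-cong (scale-∷ c a p) ≋-refl ⟩
    (c * a ∷ scale c p) ⊛ q ≈⟨ ∷-⊛ _ _ _ ⟩
    scale (c * a) q ⊕ (0# ∷ scale c p ⊛ q)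
      ≈⟨ ⊕-cong (≋-sym (scale-scale c a q))
           (≋-trans (∷-cong (sym (zeroʳ c)) (scale-⊛ c p q)) (≋-sym (scale-∷ c 0# _))) ⟩
    scale c (scale a q) ⊕ scale c (0# ∷ p ⊛ q) ≈⟨ scale-distribˡ c _ _ ⟨
    scale c (scale a q ⊕ (0# ∷ p ⊛ q)) ≈⟨ scale-cong refl (∷-⊛ a p q) ⟨
    scale c ((a ∷ p) ⊛ q) ∎

  0∷-⊛ : ∀ p q → (0# ∷ p) ⊛ q ≋ 0# ∷ (p ⊛ q)
  0∷-⊛ p q = ≋-trans (∷-⊛ 0# p q) (≋-trans (⊕-cong (scale-0 q) ≋-refl) ([]-⊕ _))

  ⊛-assoc : ∀ p q r → (p ⊛ q) ⊛ r ≋ p ⊛ (q ⊛ r)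
  ⊛-assoc [] q r = ≋-trans (⊛-cong ([]-⊛ q) ≋-refl) (≋-trans ([]-⊛ r) (≋-sym ([]-⊛ _)))
  ⊛-assoc (a ∷ p) q r = begin
    ((a ∷ p) ⊛ q) ⊛ r ≈⟨ ⊛-cong (∷-⊛ a p q) ≋-refl ⟩
    (scale a q ⊕ (0# ∷ p ⊛ q)) ⊛ r ≈⟨ ⊛-distribʳ r (scale a q) _ ⟩
    scale a q ⊛ r ⊕ (0# ∷ p ⊛ q) ⊛ r
      ≈⟨ ⊕-cong (scale-⊛ a q r) (≋-trans (0∷-⊛ (p ⊛ q) r) (∷-cong refl (⊛-assoc p q r))) ⟩
    scale a (q ⊛ r) ⊕ (0# ∷ p ⊛ (q ⊛ r)) ≈⟨ ∷-⊛ a p (q ⊛ r) ⟨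
    (a ∷ p) ⊛ (q ⊛ r) ∎

  const-⊛ : ∀ c p → (c ∷ []) ⊛ p ≋ scale c p
  const-⊛ c p = ≋-trans (∷-⊛ c [] p)
    (≋-trans (⊕-cong ≋-refl (≋-trans (∷-cong refl ([]-⊛ p)) 0∷[]≋[])) (⊕-identityʳ _))

  ⊛-identityˡ : ∀ p → oneₚ F ⊛ p ≋ p
  ⊛-identityˡ p = ≋-trans (const-⊛ 1# p) (scale-1 p)

  polyRing : CommutativeRing 0ℓ 0ℓ
  polyRing = record
    { Carrier = P ; _≈_ = _≋_ ; _+_ = _⊕_ ; _*_ = _⊛_ ; -_ = scale (- 1#) ; 0# = [] ; 1# = oneₚ F
    ; isCommutativeRing = record
      { isRing = record
        { +-isAbelianGroup = record
          { isGroup = record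
            { isMonoid = record
              { isSemigroup = record
                { isMagma = record { isEquivalence = Setoid.isEquivalence polySetoid ; ∙-cong = ⊕-cong }
                ; assoc = ⊕-assoc }
              ; identity = []-⊕ , ⊕-identityʳ }
            ; inverse = (λ p → ≋-trans (⊕-comm _ p) (⊕-inverseʳ p)) , ⊕-inverseʳ
            ; ⁻¹-cong = scale-cong refl }
          ; comm = ⊕-comm }
        ; *-cong = ⊛-cong
        ; *-assoc = ⊛-assoc
        ; *-identity = ⊛-identityˡ , λ p → ≋-trans (⊛-comm p _) (⊛-identityˡ p)
        ; distrib = ⊛-distribˡ , ⊛-distribʳ }
      ; *-comm = ⊛-comm } }

  private
    ⊖-unfold : ∀ p q → p ⊕ scale (- 1#) q ≡ _+ₚ_ F p (-ₚ_ F q)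
    ⊖-unfold p q = ≡.trans (⊕-unfold p _) (≡.cong (_+ₚ_ F p) (scale-unfold (- 1#) q))

  ≋⇒≈ₚ : ∀ {p q} → p ≋ q → _≈ₚ_ F p q
  ≋⇒≈ₚ {p} {q} e = ≡.subst (IsZeroₚ F) (⊖-unfold p q)
    (zeros _ (≋-trans (⊕-cong e ≋-refl) (⊕-inverseʳ q)))
    where
    zeros : ∀ r → r ≋ [] → IsZeroₚ F r
    zeros [] e = []
    zeros (a ∷ r) e = at e 0 ∷ zeros r (∷≋[]⇒tail e)

  ≈ₚ⇒≋ : ∀ {p q} → _≈ₚ_ F p q → p ≋ q
  ≈ₚ⇒≋ {p} {q} z = begin
    p ≈⟨ ⊕-identityʳ p ⟨
    p ⊕ [] ≈⟨ ⊕-cong ≋-refl (≋-trans (⊕-comm (scale (- 1#) q) q) (⊕-inverseʳ q)) ⟨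
    p ⊕ (scale (- 1#) q ⊕ q) ≈⟨ ⊕-assoc p _ q ⟨
    (p ⊕ scale (- 1#) q) ⊕ q
      ≈⟨ ⊕-cong (zeros _ (≡.subst (IsZeroₚ F) (≡.sym (⊖-unfold p q)) z)) ≋-refl ⟩
    [] ⊕ q ≈⟨ []-⊕ q ⟩
    q ∎
    where
    zeros : ∀ r → IsZeroₚ F r → r ≋ []
    zeros [] [] = ≋-refl
    zeros (a ∷ r) (e ∷ es) = ≋-trans (∷-cong e (zeros r es)) 0∷[]≋[]

-- Vector spaces, linear maps and polynomials in an operator

module VectorSpaces (F : CommutativeRing 0ℓ 0ℓ) where

  open Polynomials F

  open CommutativeRing F using (0#; 1#; _+_; _*_; -_) renaming (Carrier to K; _≈_ to _≈ₖ_)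
  private module K = CommutativeRing F

  -- Equality belongs to the structure, so a quotient keeps its carrier and only coarsens `_≈_`, as
  -- in `coimage`. No basis or dimension is recorded.
  record Space : Set₁ where
    infix 4 _≈_
    infixl 6 _⊞_
    infixr 7 _·_
    field
      Carrier : Set
      _≈_ : Carrier → Carrier → Set
      _⊞_ : Carrier → Carrier → Carrier
      𝟎 : Carrier
      _·_ : K → Carrier → Carrier
      isEquivalence : IsEquivalence _≈_
      ⊞-cong : ∀ {u u′ v v′} → u ≈ u′ → v ≈ v′ → u ⊞ v ≈ u′ ⊞ v′
      ⊞-assoc : ∀ u v w → (u ⊞ v) ⊞ w ≈ u ⊞ (v ⊞ w)
      ⊞-comm : ∀ u v → u ⊞ v ≈ v ⊞ u
      ⊞-identityˡ : ∀ u → 𝟎 ⊞ u ≈ u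
      ·-cong : ∀ {a b u v} → a ≈ₖ b → u ≈ v → a · u ≈ b · v
      ·-distribˡ : ∀ a u v → a · (u ⊞ v) ≈ a · u ⊞ a · v
      ·-distribʳ : ∀ a b u → (a + b) · u ≈ a · u ⊞ b · u
      ·-assoc : ∀ a b u → (a * b) · u ≈ a · (b · u)
      ·-identity : ∀ u → 1# · u ≈ u
      ·-zeroˡ : ∀ u → 0# · u ≈ 𝟎

    open IsEquivalence isEquivalence public

    setoid : Setoid 0ℓ 0ℓ
    setoid = record { isEquivalence = isEquivalence }

    module Reasoning = Relation.Binary.Reasoning.Setoid setoid

    ⊞-identityʳ : ∀ u → u ⊞ 𝟎 ≈ u
    ⊞-identityʳ u = trans (⊞-comm u 𝟎) (⊞-identityˡ u)

    ⊞-congˡ : ∀ {u v w} → v ≈ w → u ⊞ v ≈ u ⊞ w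
    ⊞-congˡ = ⊞-cong refl

    ⊞-congʳ : ∀ {u v w} → v ≈ w → v ⊞ u ≈ w ⊞ u
    ⊞-congʳ e = ⊞-cong e refl

    ·-congˡ : ∀ {a u v} → u ≈ v → a · u ≈ a · v
    ·-congˡ = ·-cong K.refl

    ·-congʳ : ∀ {a b u} → a ≈ₖ b → a · u ≈ b · u
    ·-congʳ e = ·-cong e refl

    ⊞-commutativeMonoid : CommutativeMonoid 0ℓ 0ℓ
    ⊞-commutativeMonoid = record { isCommutativeMonoid = record
      { isMonoid = record
        { isSemigroup = record
          { isMagma = record { isEquivalence = isEquivalence ; ∙-cong = ⊞-cong } ; assoc = ⊞-assoc }
        ; identity = ⊞-identityˡ , ⊞-identityʳ }
      ; comm = ⊞-comm } }

    open Algebra.Properties.CommutativeSemigroup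
      (CommutativeMonoid.commutativeSemigroup ⊞-commutativeMonoid) public
      using () renaming (interchange to ⊞-interchange; x∙yz≈y∙xz to ⊞-leftComm)

    ·-zeroʳ : ∀ a → a · 𝟎 ≈ 𝟎
    ·-zeroʳ a = trans (·-congˡ (sym (·-zeroˡ 𝟎)))
      (trans (sym (·-assoc a 0# 𝟎)) (trans (·-congʳ (K.zeroʳ a)) (·-zeroˡ 𝟎)))

    infix 8 ⊟_
    ⊟_ : Carrier → Carrier
    ⊟ u = (- 1#) · u

    ⊞-inverseʳ : ∀ u → u ⊞ ⊟ u ≈ 𝟎
    ⊞-inverseʳ u = trans (⊞-congʳ (sym (·-identity u)))
      (trans (sym (·-distribʳ 1# (- 1#) u)) (trans (·-congʳ (K.-‿inverseʳ 1#)) (·-zeroˡ u)))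

    ⊞-inverseˡ : ∀ u → ⊟ u ⊞ u ≈ 𝟎
    ⊞-inverseˡ u = trans (⊞-comm _ _) (⊞-inverseʳ u)

    ⊞-⊟-cancelʳ : ∀ u v → (u ⊞ ⊟ v) ⊞ v ≈ u
    ⊞-⊟-cancelʳ u v = trans (⊞-assoc _ _ _) (trans (⊞-congˡ (⊞-inverseˡ v)) (⊞-identityʳ u))

    ≈⇒⊟≈𝟎 : ∀ {u v} → u ≈ v → u ⊞ ⊟ v ≈ 𝟎
    ≈⇒⊟≈𝟎 {u} {v} e = trans (⊞-congʳ e) (⊞-inverseʳ v)

    ⊟≈𝟎⇒≈ : ∀ {u v} → u ⊞ ⊟ v ≈ 𝟎 → u ≈ v
    ⊟≈𝟎⇒≈ {u} {v} e = trans (sym (⊞-⊟-cancelʳ u v)) (trans (⊞-congʳ e) (⊞-identityˡ v))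

    𝟎-⊞-𝟎 : ∀ {u v} → u ≈ 𝟎 → v ≈ 𝟎 → u ⊞ v ≈ 𝟎
    𝟎-⊞-𝟎 e f = trans (⊞-cong e f) (⊞-identityˡ 𝟎)

  record Linear (V W : Space) : Set where
    private
      module V = Space V
      module W = Space W
    field
      app : V.Carrier → W.Carrier
      cong : ∀ {u v} → u V.≈ v → app u W.≈ app v
      ⊞-homo : ∀ u v → app (u V.⊞ v) W.≈ app u W.⊞ app v
      ·-homo : ∀ a u → app (a V.· u) W.≈ a W.· app u

    𝟎-homo : app V.𝟎 W.≈ W.𝟎
    𝟎-homo = W.trans (cong (V.sym (V.·-zeroˡ V.𝟎))) (W.trans (·-homo 0# V.𝟎) (W.·-zeroˡ _))

    ⊟-homo : ∀ u → app (V.⊟ u) W.≈ W.⊟ app u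
    ⊟-homo u = ·-homo (- 1#) u

    cong-𝟎 : ∀ {u} → u V.≈ V.𝟎 → app u W.≈ W.𝟎
    cong-𝟎 e = W.trans (cong e) 𝟎-homo

  open Linear public using (app)

  Op : Space → Set
  Op V = Linear V V

  _∘ₗ_ : ∀ {U V W} → Linear V W → Linear U V → Linear U W
  _∘ₗ_ {W = W} f g = record
    { app = λ u → app f (app g u)
    ; cong = λ e → f.cong (g.cong e)
    ; ⊞-homo = λ u v → W.trans (f.cong (g.⊞-homo u v)) (f.⊞-homo _ _)
    ; ·-homo = λ a u → W.trans (f.cong (g.·-homo a u)) (f.·-homo _ _) }
    where
    module W = Space W
    module f = Linear f
    module g = Linear g

  _+ₗ_ : ∀ {V W} → Linear V W → Linear V W → Linear V W
  _+ₗ_ {W = W} f g = record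
    { app = λ u → app f u ⊞ app g u
    ; cong = λ e → ⊞-cong (f.cong e) (g.cong e)
    ; ⊞-homo = λ u v → trans (⊞-cong (f.⊞-homo u v) (g.⊞-homo u v)) (⊞-interchange _ _ _ _)
    ; ·-homo = λ a u → trans (⊞-cong (f.·-homo a u) (g.·-homo a u)) (sym (·-distribˡ a _ _)) }
    where
    open Space W
    module f = Linear f
    module g = Linear g

  scalar : ∀ {V} → K → Op V
  scalar {V} c = record
    { app = c ·_
    ; cong = ·-congˡ
    ; ⊞-homo = ·-distribˡ c
    ; ·-homo = λ a u → trans (sym (·-assoc c a u)) (trans (·-congʳ (K.*-comm c a)) (·-assoc a c u)) }
    where open Space V

  kSpace : Space
  kSpace = record
    { Carrier = K ; _≈_ = _≈ₖ_ ; _⊞_ = _+_ ; 𝟎 = 0# ; _·_ = _*_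
    ; isEquivalence = K.isEquivalence ; ⊞-cong = K.+-cong ; ⊞-assoc = K.+-assoc ; ⊞-comm = K.+-comm
    ; ⊞-identityˡ = K.+-identityˡ ; ·-cong = K.*-cong ; ·-distribˡ = K.distribˡ
    ; ·-distribʳ = λ a b u → K.distribʳ u a b ; ·-assoc = K.*-assoc ; ·-identity = K.*-identityˡ
    ; ·-zeroˡ = K.zeroˡ }

  polySpace : Space
  polySpace = record
    { Carrier = Poly F ; _≈_ = _≋_ ; _⊞_ = _⊕_ ; 𝟎 = [] ; _·_ = scale
    ; isEquivalence = Setoid.isEquivalence polySetoid ; ⊞-cong = ⊕-cong ; ⊞-assoc = ⊕-assoc
    ; ⊞-comm = ⊕-comm ; ⊞-identityˡ = []-⊕ ; ·-cong = scale-cong ; ·-distribˡ = scale-distribˡ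
    ; ·-distribʳ = scale-distribʳ ; ·-assoc = λ a b u → ≋-sym (scale-scale a b u)
    ; ·-identity = scale-1 ; ·-zeroˡ = scale-0 }

  coordSpace : ℕ → Space
  coordSpace n = record
    { Carrier = Fin n → K ; _≈_ = λ u v → ∀ i → u i ≈ₖ v i
    ; _⊞_ = λ u v i → u i + v i ; 𝟎 = λ _ → 0# ; _·_ = λ a u i → a * u i
    ; isEquivalence = record
      { refl = λ _ → K.refl ; sym = λ e i → K.sym (e i) ; trans = λ e f i → K.trans (e i) (f i) }
    ; ⊞-cong = λ e f i → K.+-cong (e i) (f i) ; ⊞-assoc = λ u v w i → K.+-assoc _ _ _
    ; ⊞-comm = λ u v i → K.+-comm _ _ ; ⊞-identityˡ = λ u i → K.+-identityˡ _
    ; ·-cong = λ e f i → K.*-cong e (f i) ; ·-distribˡ = λ a u v i → K.distribˡ _ _ _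
    ; ·-distribʳ = λ a b u i → K.distribʳ _ _ _ ; ·-assoc = λ a b u i → K.*-assoc _ _ _
    ; ·-identity = λ u i → K.*-identityˡ _ ; ·-zeroˡ = λ u i → K.zeroˡ _ }

  _⊗_ : Space → Space → Space
  V ⊗ W = record
    { Carrier = V.Carrier × W.Carrier
    ; _≈_ = λ (u , u′) (v , v′) → (u V.≈ v) × (u′ W.≈ v′)
    ; _⊞_ = λ (u , u′) (v , v′) → u V.⊞ v , u′ W.⊞ v′
    ; 𝟎 = V.𝟎 , W.𝟎
    ; _·_ = λ a (u , u′) → a V.· u , a W.· u′
    ; isEquivalence = record
      { refl = V.refl , W.refl
      ; sym = λ (e , f) → V.sym e , W.sym f
      ; trans = λ (e , f) (e′ , f′) → V.trans e e′ , W.trans f f′ }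
    ; ⊞-cong = λ (e , f) (e′ , f′) → V.⊞-cong e e′ , W.⊞-cong f f′
    ; ⊞-assoc = λ _ _ _ → V.⊞-assoc _ _ _ , W.⊞-assoc _ _ _
    ; ⊞-comm = λ _ _ → V.⊞-comm _ _ , W.⊞-comm _ _
    ; ⊞-identityˡ = λ _ → V.⊞-identityˡ _ , W.⊞-identityˡ _
    ; ·-cong = λ e (f , g) → V.·-cong e f , W.·-cong e g
    ; ·-distribˡ = λ _ _ _ → V.·-distribˡ _ _ _ , W.·-distribˡ _ _ _
    ; ·-distribʳ = λ _ _ _ → V.·-distribʳ _ _ _ , W.·-distribʳ _ _ _
    ; ·-assoc = λ _ _ _ → V.·-assoc _ _ _ , W.·-assoc _ _ _
    ; ·-identity = λ _ → V.·-identity _ , W.·-identity _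
    ; ·-zeroˡ = λ _ → V.·-zeroˡ _ , W.·-zeroˡ _ }
    where
    module V = Space V
    module W = Space W

  embed : ∀ n → Linear (coordSpace n) (coordSpace (ℕ.suc n))
  embed n = record
    { app = λ { u zero → 0# ; u (suc i) → u i }
    ; cong = λ { e zero → K.refl ; e (suc i) → e i }
    ; ⊞-homo = λ { u v zero → K.sym (K.+-identityˡ 0#) ; u v (suc i) → K.refl }
    ; ·-homo = λ { a u zero → K.sym (K.zeroʳ a) ; a u (suc i) → K.refl } }

  module _ {V : Space} where
    open Space V

    eval : Poly F → Op V → Carrier → Carrier
    eval [] T v = 𝟎
    eval (a ∷ p) T v = a · v ⊞ app T (eval p T v)

    module _ (T : Op V) where
      private module T = Linear T

      eval-congʳ : ∀ p {u v} → u ≈ v → eval p T u ≈ eval p T v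
      eval-congʳ [] e = refl
      eval-congʳ (a ∷ p) e = ⊞-cong (·-congˡ e) (T.cong (eval-congʳ p e))

      eval-⊞ : ∀ p u v → eval p T (u ⊞ v) ≈ eval p T u ⊞ eval p T v
      eval-⊞ [] u v = sym (⊞-identityˡ 𝟎)
      eval-⊞ (a ∷ p) u v = trans
        (⊞-cong (·-distribˡ a u v) (trans (T.cong (eval-⊞ p u v)) (T.⊞-homo _ _)))
        (⊞-interchange _ _ _ _)

      eval-· : ∀ p c u → eval p T (c · u) ≈ c · eval p T u
      eval-· [] c u = sym (·-zeroʳ c)
      eval-· (a ∷ p) c u = trans
        (⊞-cong (Linear.·-homo (scalar {V} a) c u) (trans (T.cong (eval-· p c u)) (T.·-homo _ _)))
        (sym (·-distribˡ c _ _))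

      evalₗ : Poly F → Op V
      evalₗ p = record { app = eval p T ; cong = eval-congʳ p ; ⊞-homo = eval-⊞ p ; ·-homo = eval-· p }

      eval-≋[] : ∀ {p} → p ≋ [] → ∀ v → eval p T v ≈ 𝟎
      eval-≋[] {[]} e v = refl
      eval-≋[] {a ∷ p} e v = 𝟎-⊞-𝟎 (trans (·-congʳ (at e 0)) (·-zeroˡ v))
        (T.cong-𝟎 (eval-≋[] (∷≋[]⇒tail e) v))

      eval-cong : ∀ {p q} → p ≋ q → ∀ v → eval p T v ≈ eval q T v
      eval-cong {[]} {q} e v = sym (eval-≋[] (≋-sym e) v)
      eval-cong {a ∷ p} {[]} e v = eval-≋[] e v
      eval-cong {a ∷ p} {b ∷ q} e v = ⊞-cong (·-congʳ (at e 0)) (T.cong (eval-cong (∷-injʳ e) v))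

      eval-⊕ : ∀ p q v → eval (p ⊕ q) T v ≈ eval p T v ⊞ eval q T v
      eval-⊕ [] q v = trans (eval-cong ([]-⊕ q) v) (sym (⊞-identityˡ _))
      eval-⊕ (a ∷ p) [] v = trans (eval-cong (⊕-identityʳ (a ∷ p)) v) (sym (⊞-identityʳ _))
      eval-⊕ (a ∷ p) (b ∷ q) v = trans (eval-cong (∷-⊕-∷ a p b q) v) (trans
        (⊞-cong (·-distribʳ a b v) (trans (T.cong (eval-⊕ p q v)) (T.⊞-homo _ _)))
        (⊞-interchange _ _ _ _))

      eval-scale : ∀ c p v → eval (scale c p) T v ≈ c · eval p T v
      eval-scale c [] v = trans (eval-cong (scale-[] {c}) v) (sym (·-zeroʳ c))
      eval-scale c (a ∷ p) v = trans (eval-cong (scale-∷ c a p) v) (trans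
        (⊞-cong (·-assoc c a v) (trans (T.cong (eval-scale c p v)) (T.·-homo _ _)))
        (sym (·-distribˡ c _ _)))

      evalAt : Carrier → Linear polySpace V
      evalAt v = record { app = λ p → eval p T v ; cong = λ e → eval-cong e v
        ; ⊞-homo = λ p q → eval-⊕ p q v ; ·-homo = λ a p → eval-scale a p v }

      eval-0∷ : ∀ p v → eval (0# ∷ p) T v ≈ app T (eval p T v)
      eval-0∷ p v = trans (⊞-congʳ (·-zeroˡ v)) (⊞-identityˡ _)

      eval-const : ∀ c v → eval (c ∷ []) T v ≈ c · v
      eval-const c v = trans (⊞-congˡ T.𝟎-homo) (⊞-identityʳ _)

      eval-one : ∀ v → eval (oneₚ F) T v ≈ v
      eval-one v = trans (eval-const 1# v) (·-identity v)

      eval-⊛ : ∀ p q v → eval (p ⊛ q) T v ≈ eval p T (eval q T v)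
      eval-⊛ [] q v = eval-cong ([]-⊛ q) v
      eval-⊛ (a ∷ p) q v = begin
        eval ((a ∷ p) ⊛ q) T v ≈⟨ eval-cong (∷-⊛ a p q) v ⟩
        eval (scale a q ⊕ (0# ∷ p ⊛ q)) T v ≈⟨ eval-⊕ (scale a q) _ v ⟩
        eval (scale a q) T v ⊞ eval (0# ∷ p ⊛ q) T v
          ≈⟨ ⊞-cong (eval-scale a q v) (trans (eval-0∷ (p ⊛ q) v) (T.cong (eval-⊛ p q v))) ⟩
        eval (a ∷ p) T (eval q T v) ∎
        where open Reasoning

      eval-comm : ∀ p q v → eval p T (eval q T v) ≈ eval q T (eval p T v)
      eval-comm p q v = trans (sym (eval-⊛ p q v)) (trans (eval-cong (⊛-comm p q) v) (eval-⊛ q p v))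

      eval-∘ : ∀ p v → eval p T (app T v) ≈ app T (eval p T v)
      eval-∘ [] v = sym T.𝟎-homo
      eval-∘ (a ∷ p) v = trans (⊞-cong (sym (T.·-homo a v)) (T.cong (eval-∘ p v))) (sym (T.⊞-homo _ _))

  eval-congˡ : ∀ {V} (S T : Op V) → let open Space V in (∀ v → app S v ≈ app T v) →
    ∀ p v → eval p S v ≈ eval p T v
  eval-congˡ {V} S T e [] v = Space.refl V
  eval-congˡ {V} S T e (a ∷ p) v = ⊞-congˡ (trans (e _) (Linear.cong T (eval-congˡ S T e p v)))
    where open Space V

  eval-intertwine : ∀ {U V} (S : Op U) (T : Op V) (φ : Linear U V) → let open Space V in
    (∀ u → app φ (app S u) ≈ app T (app φ u)) →
    ∀ p u → eval p T (app φ u) ≈ app φ (eval p S u)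
  eval-intertwine {U} {V} S T φ comm = go
    where
    open Space V
    module T = Linear T
    module φ = Linear φ
    go : ∀ p u → eval p T (app φ u) ≈ app φ (eval p S u)
    go [] u = sym φ.𝟎-homo
    go (a ∷ p) u = trans (⊞-cong (sym (φ.·-homo a u)) (trans (T.cong (go p u)) (sym (comm _))))
      (sym (φ.⊞-homo _ _))

-- Degrees, division with remainder and Bezout relations

module PolynomialDivision (F : CommutativeRing 0ℓ 0ℓ) (isField : IsField F) (_≟_ : Decidable (CommutativeRing._≈_ F)) where

  open Polynomials F

  open CommutativeRing F renaming (Carrier to K) hiding (zero; semiring)
  open RingSolver F using (solve; _:+_; _:*_; _:-_; :-_; _:=_; :0; :1) public
  open RingIdentities polyRing
  open import Relation.Binary.Reasoning.Setoid polySetoid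

  1≉0 : ¬ (1# ≈ 0#)
  1≉0 = proj₁ isField

  inv : ∀ {x} → ¬ (x ≈ 0#) → K
  inv x≉0 = proj₁ (proj₂ isField _ x≉0)

  inv-inverse : ∀ {x} (x≉0 : ¬ (x ≈ 0#)) → inv x≉0 * x ≈ 1#
  inv-inverse x≉0 = trans (*-comm _ _) (proj₂ (proj₂ isField _ x≉0))

  *-nonzero : ∀ {x y} → ¬ (x ≈ 0#) → ¬ (y ≈ 0#) → ¬ (x * y ≈ 0#)
  *-nonzero {x} {y} x≉0 y≉0 xy≈0 = y≉0 (trans (sym (*-identityˡ y)) (trans (*-congʳ (sym (inv-inverse x≉0)))
    (trans (*-assoc _ _ _) (trans (*-congˡ xy≈0) (zeroʳ _)))))

  inv-nonzero : ∀ {x} (x≉0 : ¬ (x ≈ 0#)) → ¬ (inv x≉0 ≈ 0#)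
  inv-nonzero x≉0 e = 1≉0 (trans (sym (inv-inverse x≉0)) (trans (*-congʳ e) (zeroˡ _)))

  infix 4 _deg<_
  -- A strict upper bound instead of a degree function, so that the zero polynomial needs no special
  -- value: it is below every bound, including 0.
  record _deg<_ (p : Poly F) (n : ℕ) : Set where
    constructor vanishing
    field vanish : ∀ i → n ≤ i → coef p i ≈ 0#
  open _deg<_ public

  deg<-resp-≋ : ∀ {p q n} → p ≋ q → p deg< n → q deg< n
  deg<-resp-≋ e d = vanishing λ i n≤i → trans (sym (at e i)) (vanish d i n≤i)

  deg<-mono : ∀ {p m n} → m ≤ n → p deg< m → p deg< n
  deg<-mono m≤n d = vanishing λ i n≤i → vanish d i (ℕ.≤-trans m≤n n≤i)

  deg<-⊕ : ∀ {p q n} → p deg< n → q deg< n → (p ⊕ q) deg< n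
  deg<-⊕ {p} {q} d e = vanishing λ i n≤i →
    trans (coef-⊕ p q i) (trans (+-cong (vanish d i n≤i) (vanish e i n≤i)) (+-identityˡ 0#))

  deg<-scale : ∀ {p n} c → p deg< n → scale c p deg< n
  deg<-scale {p} c d = vanishing λ i n≤i →
    trans (coef-scale c p i) (trans (*-congˡ (vanish d i n≤i)) (zeroʳ c))

  deg<-[] : ∀ {n} → [] deg< n
  deg<-[] = vanishing λ _ _ → refl

  deg<-∷ : ∀ {a p n} → p deg< n → (a ∷ p) deg< suc n
  deg<-∷ d = vanishing λ { (suc i) (s≤s n≤i) → vanish d i n≤i }

  deg<-tail : ∀ {a p n} → (a ∷ p) deg< suc n → p deg< n
  deg<-tail d = vanishing λ i n≤i → vanish d (suc i) (s≤s n≤i)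

  deg<0⇒≋[] : ∀ {p} → p deg< 0 → p ≋ []
  deg<0⇒≋[] d = coefwise λ i → vanish d i z≤n

  ≋[]⇒deg< : ∀ {p n} → p ≋ [] → p deg< n
  ≋[]⇒deg< e = vanishing λ i _ → at e i

  deg<1⇒const : ∀ {p} → p deg< 1 → p ≋ coef p 0 ∷ []
  deg<1⇒const d = coefwise λ { zero → refl ; (suc i) → vanish d (suc i) (s≤s z≤n) }

  -- Shifting the bound of one factor only avoids subtraction and still covers q = 0, where n may be
  -- 0.
  deg<-⊛ : ∀ p {q m n} → p deg< suc m → q deg< n → (p ⊛ q) deg< m ℕ.+ n
  deg<-⊛ [] {q} d e = ≋[]⇒deg< ([]-⊛ q)
  deg<-⊛ (a ∷ p) {q} {m} {n} d e = deg<-resp-≋ (≋-sym (∷-⊛ a p q))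
    (deg<-⊕ (deg<-mono (ℕ.m≤n+m n m) (deg<-scale a e)) (shifted m (deg<-tail d)))
    where
    shifted : ∀ m → p deg< m → (0# ∷ p ⊛ q) deg< m ℕ.+ n
    shifted zero d = ≋[]⇒deg<
      (≋-trans (∷-cong refl (≋-trans (⊛-cong (deg<0⇒≋[] d) ≋-refl) ([]-⊛ q))) 0∷[]≋[])
    shifted (suc m) d = deg<-∷ (deg<-⊛ p d e)

  coef-⊛-top : ∀ p q m n → p deg< suc m → q deg< suc n → coef (p ⊛ q) (m ℕ.+ n) ≈ coef p m * coef q n
  coef-⊛-top [] q m n d e = trans (at ([]-⊛ q) (m ℕ.+ n)) (sym (zeroˡ _))
  coef-⊛-top (a ∷ p) q m n d e = trans (at (∷-⊛ a p q) (m ℕ.+ n)) (trans (coef-⊕ _ _ (m ℕ.+ n))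
    (trans (+-congʳ (coef-scale a q (m ℕ.+ n))) (go m (deg<-tail d))))
    where
    go : ∀ m → p deg< m → a * coef q (m ℕ.+ n) + coef (0# ∷ p ⊛ q) (m ℕ.+ n) ≈ coef (a ∷ p) m * coef q n
    go zero d = trans (+-congˡ (at (≋-trans
      (∷-cong refl (≋-trans (⊛-cong (deg<0⇒≋[] d) ≋-refl) ([]-⊛ q))) 0∷[]≋[]) n)) (+-identityʳ _)
    go (suc m) d = trans (+-cong (trans (*-congˡ (vanish e _ (s≤s (ℕ.m≤n+m n m)))) (zeroʳ a))
      (coef-⊛-top p q m n d e)) (+-identityˡ _)

  record HasDegree (p : Poly F) (d : ℕ) : Set where
    constructor hasDegree
    field
      lead≉0 : ¬ (coef p d ≈ 0#)
      bound : p deg< suc d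
  open HasDegree public

  record MonicOfDegree (p : Poly F) (d : ℕ) : Set where
    constructor monicOfDegree
    field
      lead≈1 : coef p d ≈ 1#
      monic-bound : p deg< suc d
  open MonicOfDegree public

  monic⇒degree : ∀ {p d} → MonicOfDegree p d → HasDegree p d
  monic⇒degree m = hasDegree (λ e → 1≉0 (trans (sym (lead≈1 m)) e)) (monic-bound m)

  monic-resp-≋ : ∀ {p q d} → p ≋ q → MonicOfDegree p d → MonicOfDegree q d
  monic-resp-≋ {d = d} e m = monicOfDegree (trans (sym (at e d)) (lead≈1 m)) (deg<-resp-≋ e (monic-bound m))

  monic-⊛ : ∀ {p q m n} → MonicOfDegree p m → MonicOfDegree q n → MonicOfDegree (p ⊛ q) (m ℕ.+ n)
  monic-⊛ {p} {q} {m} {n} a b = monicOfDegree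
    (trans (coef-⊛-top p q m n (monic-bound a) (monic-bound b))
      (trans (*-cong (lead≈1 a) (lead≈1 b)) (*-identityˡ 1#)))
    (≡.subst ((p ⊛ q) deg<_) (ℕ.+-suc m n) (deg<-⊛ p (monic-bound a) (monic-bound b)))

  degree? : ∀ p → p ≋ [] ⊎ ∃ (HasDegree p)
  degree? [] = inj₁ ≋-refl
  degree? (a ∷ p) with degree? p
  ... | inj₂ (d , h) = inj₂ (suc d , hasDegree (lead≉0 h) (deg<-∷ (bound h)))
  ... | inj₁ p≋[] with a ≟ 0#
  ...   | yes a≈0 = inj₁ (≋-trans (∷-cong a≈0 p≋[]) 0∷[]≋[])
  ...   | no a≉0 = inj₂ (0 , hasDegree a≉0 (deg<-∷ (≋[]⇒deg< p≋[])))

  ≋[]? : ∀ p → Dec (p ≋ [])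
  ≋[]? p with degree? p
  ... | inj₁ e = yes e
  ... | inj₂ (d , h) = no λ e → lead≉0 h (at e d)

  degree-resp-≋ : ∀ {p q d} → p ≋ q → HasDegree p d → HasDegree q d
  degree-resp-≋ {d = d} e h = hasDegree (λ f → lead≉0 h (trans (at e d) f)) (deg<-resp-≋ e (bound h))

  degree-< : ∀ {p d n} → HasDegree p d → p deg< n → d < n
  degree-< {p} {d} {n} h b with d ℕ.<? n
  ... | yes d<n = d<n
  ... | no d≮n = contradiction (vanish b d (ℕ.≮⇒≥ d≮n)) (lead≉0 h)

  degree-unique : ∀ {p d e} → HasDegree p d → HasDegree p e → d ≡ e
  degree-unique h k = ℕ.≤-antisym (ℕ.s≤s⁻¹ (degree-< h (bound k))) (ℕ.s≤s⁻¹ (degree-< k (bound h)))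

  degree-⊛ : ∀ {p q m n} → HasDegree p m → HasDegree q n → HasDegree (p ⊛ q) (m ℕ.+ n)
  degree-⊛ {p} {q} {m} {n} h k = hasDegree
    (λ e → *-nonzero (lead≉0 h) (lead≉0 k) (trans (sym (coef-⊛-top p q m n (bound h) (bound k))) e))
    (≡.subst ((p ⊛ q) deg<_) (ℕ.+-suc m n) (deg<-⊛ p (bound h) (bound k)))

  degree-factors : ∀ {f g h d} → HasDegree f d → f ≋ g ⊛ h →
    ∃[ m ] ∃[ n ] (HasDegree g m × HasDegree h n × m ℕ.+ n ≡ d)
  degree-factors {f} {g} {h} {d} df e with degree? g | degree? h
  ... | inj₁ g≋[] | _ = contradiction
    (at (≋-trans e (≋-trans (⊛-cong g≋[] ≋-refl) ([]-⊛ h))) d) (lead≉0 df)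
  ... | inj₂ _ | inj₁ h≋[] = contradiction
    (at (≋-trans e (≋-trans (⊛-cong (≋-refl {g}) h≋[]) (⊛-zeroʳ g))) d) (lead≉0 df)
  ... | inj₂ (m , dg) | inj₂ (n , dh) =
    m , n , dg , dh , degree-unique (degree-⊛ dg dh) (degree-resp-≋ e df)

  normalise : ∀ {p d} → HasDegree p d → ∃[ c ] (¬ (c ≈ 0#) × MonicOfDegree (scale c p) d)
  normalise {p} {d} h = inv (lead≉0 h) , inv-nonzero (lead≉0 h) ,
    monicOfDegree (trans (coef-scale _ p d) (inv-inverse (lead≉0 h))) (deg<-scale _ (bound h))

  -- Recursion in the style of Horner: from p = g h + r follows a + X p = g (X h) + (a + X r), and a
  -- + X r has degree at most d, so subtracting one scalar multiple of g suffices.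
  divMod : ∀ {g d} → MonicOfDegree g d → ∀ p → ∃[ h ] ∃[ r ] (p ≋ g ⊛ h ⊕ r × r deg< d)
  divMod {g} {d} mg [] = [] , [] , ≋-sym (≋-trans (⊕-identityʳ _) (⊛-zeroʳ g)) , deg<-[]
  divMod {g} {d} mg (a ∷ p) with divMod mg p
  ... | h , r , e , deg = h′ , r′ , eq , vanishing small
    where
    s = coef (a ∷ r) d
    h′ = s ∷ h
    r′ = (a ∷ r) ⊕ scale (- 1#) (scale s g)
    eq : a ∷ p ≋ g ⊛ h′ ⊕ r′
    eq = begin
      a ∷ p ≈⟨ ∷-cong (sym (+-identityˡ a)) e ⟩
      0# + a ∷ (g ⊛ h ⊕ r) ≈⟨ ∷-⊕-∷ _ _ _ _ ⟨
      (0# ∷ g ⊛ h) ⊕ (a ∷ r)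
        ≈⟨ x+y≈[z+x]+[y-z] _ _ _ ⟩
      (scale s g ⊕ (0# ∷ g ⊛ h)) ⊕ r′ ≈⟨ ⊕-cong (≋-sym (⊛-consʳ g s h)) ≋-refl ⟩
      g ⊛ h′ ⊕ r′ ∎
    coef-r′ : ∀ i → coef r′ i ≈ coef (a ∷ r) i + - 1# * (s * coef g i)
    coef-r′ i = trans (coef-⊕ (a ∷ r) _ i)
      (+-congˡ (trans (coef-scale _ (scale s g) i) (*-congˡ (coef-scale s g i))))
    small : ∀ i → d ≤ i → coef r′ i ≈ 0#
    small i d≤i with d ℕ.≟ i
    ... | yes ≡.refl = trans (coef-r′ d) (trans (+-congˡ (*-congˡ (*-congˡ (lead≈1 mg))))
      (solve 1 (λ x → x :+ :- :1 :* (x :* :1) := :0) refl s))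
    ... | no d≢i = trans (coef-r′ i) (trans
      (+-cong (vanish (deg<-∷ deg) i (ℕ.≤∧≢⇒< d≤i d≢i))
        (*-congˡ (*-congˡ (vanish (monic-bound mg) i (ℕ.≤∧≢⇒< d≤i d≢i)))))
      (solve 1 (λ x → :0 :+ :- :1 :* (x :* :0) := :0) refl s))

  infix 4 _∣_
  _∣_ : Poly F → Poly F → Set
  p ∣ q = ∃[ h ] (q ≋ p ⊛ h)

  ∣-refl : ∀ {p} → p ∣ p
  ∣-refl {p} = oneₚ F , ≋-trans (≋-sym (⊛-identityˡ p)) (⊛-comm _ p)

  ∣-trans : ∀ {p q r} → p ∣ q → q ∣ r → p ∣ r
  ∣-trans {p} (h , e) (k , f) = h ⊛ k , ≋-trans f (≋-trans (⊛-cong e ≋-refl) (⊛-assoc p h k))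

  ∣-⊕ : ∀ {p q r} → p ∣ q → p ∣ r → p ∣ q ⊕ r
  ∣-⊕ {p} (h , e) (k , f) = h ⊕ k , ≋-trans (⊕-cong e f) (≋-sym (⊛-distribˡ p h k))

  ∣-⊛ʳ : ∀ {p q} r → p ∣ q → p ∣ q ⊛ r
  ∣-⊛ʳ {p} r (h , e) = h ⊛ r , ≋-trans (⊛-cong e ≋-refl) (⊛-assoc p h r)

  ∣-⊛ˡ : ∀ {p q} r → p ∣ q → p ∣ r ⊛ q
  ∣-⊛ˡ {p} {q} r d with ∣-⊛ʳ r d
  ... | h , e = h , ≋-trans (⊛-comm r q) e

  ∣-resp-≋ : ∀ {p q r} → q ≋ r → p ∣ q → p ∣ r
  ∣-resp-≋ e (h , f) = h , ≋-trans (≋-sym e) f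

  -- The remainder decides: if g divides p it also divides the remainder, which has smaller degree
  -- and must vanish.
  monic∣? : ∀ {g d} → MonicOfDegree g d → ∀ p → Dec (g ∣ p)
  monic∣? {g} {d} mg p with divMod mg p
  ... | h , r , e , deg with degree? r
  ...   | inj₁ r≋[] = yes (h , ≋-trans e (≋-trans (⊕-cong ≋-refl r≋[]) (⊕-identityʳ _)))
  ...   | inj₂ (n , dr) = no λ (k , f) → absurd (degree-factors dr (r≋ k f))
    where
    r≋ : ∀ k → p ≋ g ⊛ k → r ≋ g ⊛ (k ⊕ scale (- 1#) h)
    r≋ k f = begin
      r ≈⟨ r≈[x+r]-x (g ⊛ h) r ⟩
      (g ⊛ h ⊕ r) ⊕ scale (- 1#) (g ⊛ h) ≈⟨ ⊕-cong (≋-trans (≋-sym e) f) ≋-refl ⟩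
      g ⊛ k ⊕ scale (- 1#) (g ⊛ h) ≈⟨ gk-gh≈g[k-h] g h k ⟩
      g ⊛ (k ⊕ scale (- 1#) h) ∎
    absurd : ∀ {q} → ∃[ m ] ∃[ l ] (HasDegree g m × HasDegree q l × m ℕ.+ l ≡ n) → ⊥
    absurd (m , l , dg , _ , m+l≡n) with degree-unique dg (monic⇒degree mg)
    ... | ≡.refl = ℕ.<⇒≱ (degree-< dr deg) (≡.subst (d ≤_) m+l≡n (ℕ.m≤m+n d l))

  -- Euclid's algorithm. The bound `n` decreases because the remainder of `f` modulo the normalised
  -- `p` has degree below that of `p`.
  bezout : ∀ n p f → p deg< n → ∃[ g ] (g ∣ f × g ∣ p × ∃[ a ] ∃[ b ] (g ≋ a ⊛ f ⊕ b ⊛ p))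
  bezout n p f deg with degree? p
  ... | inj₁ p≋[] = f , ∣-refl , ([] , ≋-trans p≋[] (≋-sym (⊛-zeroʳ f))) , oneₚ F , [] ,
    ≋-sym (≋-trans (⊕-cong (⊛-identityˡ f) ([]-⊛ p)) (⊕-identityʳ f))
  bezout zero p f deg | inj₂ (d , dp) = contradiction (vanish deg d z≤n) (lead≉0 dp)
  bezout (suc n) p f deg | inj₂ (d , dp) with normalise dp
  ... | c , _ , mp with divMod mp f
  ... | h , r , e , deg-r with bezout n r p (deg<-mono (ℕ.s≤s⁻¹ (degree-< dp deg)) deg-r)
  ... | g , g∣p , g∣r , a , b , eq = g , g∣f , g∣p , b , a ⊕ scale (- 1#) (b ⊛ k) , eq′
    where
    k = scale c h
    pk : scale c p ⊛ h ≋ p ⊛ k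
    pk = ≋-trans (scale-⊛ c p h) (≋-sym (≋-trans (⊛-comm p k) (≋-trans (scale-⊛ c h p) (scale-cong refl (⊛-comm h p)))))
    f≋ : f ≋ p ⊛ k ⊕ r
    f≋ = ≋-trans e (⊕-cong pk ≋-refl)
    g∣f : g ∣ f
    g∣f = ∣-resp-≋ (≋-sym f≋) (∣-⊕ (∣-⊛ʳ k g∣p) g∣r)
    eq′ : g ≋ b ⊛ f ⊕ (a ⊕ scale (- 1#) (b ⊛ k)) ⊛ p
    eq′ = begin
      g ≈⟨ eq ⟩
      a ⊛ p ⊕ b ⊛ r
        ≈⟨ bezout-step a p b r k ⟩
      b ⊛ (p ⊛ k ⊕ r) ⊕ (a ⊕ scale (- 1#) (b ⊛ k)) ⊛ p ≈⟨ ⊕-cong (⊛-cong ≋-refl (≋-sym f≋)) ≋-refl ⟩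
      b ⊛ f ⊕ (a ⊕ scale (- 1#) (b ⊛ k)) ⊛ p ∎

  IsUnit : Poly F → Set
  IsUnit f = ∃[ c ] (¬ (c ≈ 0#) × f ≋ c ∷ [])

  record Irred (f : Poly F) : Set where
    field
      nonconstant : ∀ {c} → ¬ (f ≋ c ∷ [])
      factors : ∀ g h → f ≋ g ⊛ h → IsUnit g ⊎ IsUnit h
  open Irred public

  unit-inverse : ∀ {g} → IsUnit g → ∃[ g⁻¹ ] (g ⊛ g⁻¹ ≋ oneₚ F)
  unit-inverse {g} (c , c≉0 , e) = (inv c≉0 ∷ []) , (begin
    g ⊛ (inv c≉0 ∷ []) ≈⟨ ⊛-cong e ≋-refl ⟩
    (c ∷ []) ⊛ (inv c≉0 ∷ []) ≈⟨ const-⊛ c _ ⟩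
    scale c (inv c≉0 ∷ []) ≈⟨ scale-∷ c _ [] ⟩
    c * inv c≉0 ∷ scale c [] ≈⟨ ∷-cong (trans (*-comm _ _) (inv-inverse c≉0)) scale-[] ⟩
    oneₚ F ∎)

  -- The greatest common divisor g of f and p is a factor of f. If g is a unit, the Bezout relation
  -- rescales to 1; if its cofactor is a unit, f is associated to g and so divides p.
  irreducible⇒∣⊎coprime : ∀ {f} → Irred f → ∀ p → f ∣ p ⊎ ∃[ a ] ∃[ b ] (a ⊛ f ⊕ b ⊛ p ≋ oneₚ F)
  irreducible⇒∣⊎coprime {f} irr p with degree? p
  ... | inj₁ p≋[] = inj₁ ([] , ≋-trans p≋[] (≋-sym (⊛-zeroʳ f)))
  ... | inj₂ (d , dp) with bezout (suc d) p f (bound dp)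
  ... | g , (h , f≋gh) , g∣p , a , b , eq with factors irr g h f≋gh
  ...   | inj₁ unit-g with unit-inverse unit-g
  ...     | u , gu≋1 = inj₂ (u ⊛ a , u ⊛ b , (begin
    (u ⊛ a) ⊛ f ⊕ (u ⊛ b) ⊛ p
      ≈⟨ bezout-scale u a f b p ⟩
    (a ⊛ f ⊕ b ⊛ p) ⊛ u ≈⟨ ⊛-cong (≋-sym eq) ≋-refl ⟩
    g ⊛ u ≈⟨ gu≋1 ⟩
    oneₚ F ∎))
  irreducible⇒∣⊎coprime {f} irr p | inj₂ (d , dp) | g , (h , f≋gh) , g∣p , a , b , eq | inj₂ unit-h
    with unit-inverse unit-h
  ...     | u , hu≋1 = inj₁ (∣-trans (u , (begin
    g ≈⟨ ⊛-identityˡ g ⟨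
    oneₚ F ⊛ g ≈⟨ ⊛-cong hu≋1 ≋-refl ⟨
    (h ⊛ u) ⊛ g ≈⟨ [hu]g≈[gh]u g h u ⟩
    (g ⊛ h) ⊛ u ≈⟨ ⊛-cong f≋gh ≋-refl ⟨
    f ⊛ u ∎)) g∣p)

-- Derivatives, separability and factorisation over a finite field

module Factorisation (F : CommutativeRing 0ℓ 0ℓ) (isField : IsField F) (_≟_ : Decidable (CommutativeRing._≈_ F))
    {order : ℕ} (hasOrder : HasOrder F order) where

  open Polynomials F
  open PolynomialDivision F isField _≟_
  open RingIdentities polyRing

  open CommutativeRing F renaming (Carrier to K) hiding (zero; semiring)
  open import Relation.Binary.Reasoning.Setoid polySetoid

  private
    P = Poly F

    enum : Fin order → K
    enum = proj₁ hasOrder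

    index : ∀ x → ∃[ i ] (enum i ≈ x)
    index = proj₂ (proj₂ hasOrder)

  natMul-cong : ∀ n {x y} → x ≈ y → natMul F n x ≈ natMul F n y
  natMul-cong zero e = refl
  natMul-cong (suc n) e = +-cong e (natMul-cong n e)

  natMul-0 : ∀ n → natMul F n 0# ≈ 0#
  natMul-0 zero = refl
  natMul-0 (suc n) = trans (+-identityˡ _) (natMul-0 n)

  natMul-+ : ∀ n x y → natMul F n (x + y) ≈ natMul F n x + natMul F n y
  natMul-+ zero x y = sym (+-identityˡ 0#)
  natMul-+ (suc n) x y = trans (+-congˡ (natMul-+ n x y))
    (solve 4 (λ x y a b → (x :+ y) :+ (a :+ b) := (x :+ a) :+ (y :+ b)) refl _ _ _ _)

  natMul-* : ∀ n c x → natMul F n (c * x) ≈ c * natMul F n x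
  natMul-* zero c x = sym (zeroʳ c)
  natMul-* (suc n) c x = trans (+-congˡ (natMul-* n c x)) (sym (distribˡ c _ _))

  D : P → P
  D = deriv F

  coef-derivFrom : ∀ n p i → coef (derivFrom F n p) i ≈ natMul F (i ℕ.+ n) (coef p i)
  coef-derivFrom n [] i = sym (natMul-0 (i ℕ.+ n))
  coef-derivFrom n (a ∷ p) zero = refl
  coef-derivFrom n (a ∷ p) (suc i) = trans (coef-derivFrom (suc n) p i)
    (reflexive (≡.cong (λ k → natMul F k (coef p i)) (ℕ.+-suc i n)))

  coef-D : ∀ p i → coef (D p) i ≈ natMul F (suc i) (coef p (suc i))
  coef-D [] i = sym (natMul-0 (suc i))
  coef-D (a ∷ p) i = trans (coef-derivFrom 1 p i)
    (reflexive (≡.cong (λ k → natMul F k (coef p i)) (ℕ.+-comm i 1)))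

  D-cong : ∀ {p q} → p ≋ q → D p ≋ D q
  D-cong {p} {q} e = coefwise λ i →
    trans (coef-D p i) (trans (natMul-cong (suc i) (at e (suc i))) (sym (coef-D q i)))

  D-⊕ : ∀ p q → D (p ⊕ q) ≋ D p ⊕ D q
  D-⊕ p q = coefwise λ i → trans (coef-D (p ⊕ q) i)
    (trans (natMul-cong (suc i) (coef-⊕ p q (suc i))) (trans (natMul-+ (suc i) _ _)
    (sym (trans (coef-⊕ (D p) (D q) i) (+-cong (coef-D p i) (coef-D q i))))))

  D-scale : ∀ c p → D (scale c p) ≋ scale c (D p)
  D-scale c p = coefwise λ i → trans (coef-D (scale c p) i)
    (trans (natMul-cong (suc i) (coef-scale c p (suc i))) (trans (natMul-* (suc i) c _)
    (sym (trans (coef-scale c (D p) i) (*-congˡ (coef-D p i))))))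

  D-∷ : ∀ a p → D (a ∷ p) ≋ p ⊕ (0# ∷ D p)
  D-∷ a p = coefwise λ i → trans (coef-D (a ∷ p) i)
    (sym (trans (coef-⊕ p (0# ∷ D p) i) (+-congˡ (lower i))))
    where
    lower : ∀ i → coef (0# ∷ D p) i ≈ natMul F i (coef p i)
    lower zero = refl
    lower (suc i) = coef-D p i

  D-⊛ : ∀ p q → D (p ⊛ q) ≋ D p ⊛ q ⊕ p ⊛ D q
  D-⊛ [] q = begin
    D ([] ⊛ q) ≈⟨ D-cong ([]-⊛ q) ⟩
    [] ≈⟨ []-⊕ [] ⟨
    [] ⊕ [] ≈⟨ ⊕-cong ([]-⊛ q) ([]-⊛ (D q)) ⟨
    [] ⊛ q ⊕ [] ⊛ D q ∎
  D-⊛ (a ∷ p) q = begin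
    D ((a ∷ p) ⊛ q) ≈⟨ D-cong (∷-⊛ a p q) ⟩
    D (scale a q ⊕ (0# ∷ p ⊛ q)) ≈⟨ D-⊕ (scale a q) _ ⟩
    D (scale a q) ⊕ D (0# ∷ p ⊛ q) ≈⟨ ⊕-cong (D-scale a q) (D-∷ 0# (p ⊛ q)) ⟩
    scale a (D q) ⊕ (p ⊛ q ⊕ (0# ∷ D (p ⊛ q)))
      ≈⟨ ⊕-cong ≋-refl (⊕-cong ≋-refl (≋-trans (∷-cong (sym (+-identityˡ 0#)) (D-⊛ p q)) (≋-sym (∷-⊕-∷ _ _ _ _)))) ⟩
    scale a (D q) ⊕ (p ⊛ q ⊕ ((0# ∷ D p ⊛ q) ⊕ (0# ∷ p ⊛ D q)))
      ≈⟨ x+[y+[z+w]]≈[y+z]+[x+w] _ _ _ _ ⟩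
    (p ⊛ q ⊕ (0# ∷ D p ⊛ q)) ⊕ (scale a (D q) ⊕ (0# ∷ p ⊛ D q))
      ≈⟨ ⊕-cong (⊕-cong ≋-refl (≋-sym (0∷-⊛ (D p) q))) (≋-sym (∷-⊛ a p (D q))) ⟩
    (p ⊛ q ⊕ (0# ∷ D p) ⊛ q) ⊕ (a ∷ p) ⊛ D q
      ≈⟨ ⊕-cong (≋-sym (⊛-distribʳ q p _)) ≋-refl ⟩
    (p ⊕ (0# ∷ D p)) ⊛ q ⊕ (a ∷ p) ⊛ D q ≈⟨ ⊕-cong (⊛-cong (D-∷ a p) ≋-refl) ≋-refl ⟨
    D (a ∷ p) ⊛ q ⊕ (a ∷ p) ⊛ D q ∎

  Sep : P → Set
  Sep f = ∃[ a ] ∃[ b ] (a ⊛ f ⊕ b ⊛ D f ≋ oneₚ F)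

  sep-resp-≋ : ∀ {f g} → f ≋ g → Sep f → Sep g
  sep-resp-≋ e (a , b , s) =
    a , b , ≋-trans (⊕-cong (⊛-cong ≋-refl (≋-sym e)) (⊛-cong ≋-refl (D-cong (≋-sym e)))) s

  sep-∣ : ∀ {f g} → Sep f → g ∣ f → Sep g
  sep-∣ {f} {g} s (h , e) with sep-resp-≋ e s
  ... | a , b , s′ = a ⊛ h ⊕ b ⊛ D h , b ⊛ h , (begin
    (a ⊛ h ⊕ b ⊛ D h) ⊛ g ⊕ (b ⊛ h) ⊛ D g ≈⟨ sep-factor a b g h (D g) (D h) ⟨
    a ⊛ (g ⊛ h) ⊕ b ⊛ (D g ⊛ h ⊕ g ⊛ D h) ≈⟨ ⊕-cong ≋-refl (⊛-cong ≋-refl (D-⊛ g h)) ⟨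
    a ⊛ (g ⊛ h) ⊕ b ⊛ D (g ⊛ h) ≈⟨ s′ ⟩
    oneₚ F ∎)

  -- A repeated factor divides both f and its derivative, hence their combination 1.
  square∣sep⇒unit : ∀ {f g s} → Sep f → f ≋ g ⊛ (g ⊛ s) → g ∣ oneₚ F
  square∣sep⇒unit {f} {g} {s} sep e with sep-resp-≋ e sep
  ... | a , b , s′ = _ , (begin
    oneₚ F ≈⟨ s′ ⟨
    a ⊛ (g ⊛ (g ⊛ s)) ⊕ b ⊛ D (g ⊛ (g ⊛ s)) ≈⟨ ⊕-cong ≋-refl (⊛-cong ≋-refl (D-⊛ g (g ⊛ s))) ⟩
    a ⊛ (g ⊛ (g ⊛ s)) ⊕ b ⊛ (D g ⊛ (g ⊛ s) ⊕ g ⊛ D (g ⊛ s)) ≈⟨ sep-square a b g s (D g) _ ⟩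
    g ⊛ (a ⊛ (g ⊛ s) ⊕ b ⊛ (D g ⊛ s ⊕ D (g ⊛ s))) ∎)

  irreducible∤1 : ∀ {f} → Irred f → ¬ (f ∣ oneₚ F)
  irreducible∤1 irr (h , e) with degree-factors {d = 0} (hasDegree 1≉0 (deg<-∷ deg<-[])) e
  ... | zero , _ , df , _ , _ = nonconstant irr (deg<1⇒const (bound df))

  coef₀-⊛ : ∀ p q → coef (p ⊛ q) 0 ≈ coef p 0 * coef q 0
  coef₀-⊛ [] q = trans (at ([]-⊛ q) 0) (sym (zeroˡ _))
  coef₀-⊛ (a ∷ p) q = trans (at (∷-⊛ a p q) 0) (trans (coef-⊕ _ _ 0)
    (trans (+-congʳ (coef-scale a q 0)) (+-identityʳ _)))

  prime : ∀ {f} → Irred f → ∀ p q → f ∣ p ⊛ q → f ∣ p ⊎ f ∣ q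
  prime {f} irr p q f∣pq with irreducible⇒∣⊎coprime irr p
  ... | inj₁ f∣p = inj₁ f∣p
  ... | inj₂ (a , b , e) = inj₂ (∣-resp-≋ (begin
    f ⊛ (a ⊛ q) ⊕ b ⊛ (p ⊛ q) ≈⟨ [af+bp]q≈f[aq]+b[pq] a f b p q ⟨
    (a ⊛ f ⊕ b ⊛ p) ⊛ q ≈⟨ ⊛-cong e ≋-refl ⟩
    oneₚ F ⊛ q ≈⟨ ⊛-identityˡ q ⟩
    q ∎) (∣-⊕ (∣-⊛ʳ (a ⊛ q) ∣-refl) (∣-⊛ˡ b f∣pq)))

  Monic⇒monicOfDegree : ∀ {p} → Monic F p → ∃ (MonicOfDegree p)
  Monic⇒monicOfDegree {[]} e = contradiction (sym e) 1≉0
  Monic⇒monicOfDegree {a ∷ []} e = 0 , monicOfDegree e (deg<-∷ deg<-[])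
  Monic⇒monicOfDegree {a ∷ b ∷ p} e with Monic⇒monicOfDegree {b ∷ p} e
  ... | d , m = suc d , monicOfDegree (lead≈1 m) (deg<-∷ (monic-bound m))

  -- `Monic` inspects the last entry of the list, so a representative of exact length is required; a
  -- list that is too short is padded with zeros.
  truncate : ℕ → P → P
  truncate zero p = []
  truncate (suc n) [] = 0# ∷ truncate n []
  truncate (suc n) (a ∷ p) = a ∷ truncate n p

  truncate-≋ : ∀ n p → p deg< n → truncate n p ≋ p
  truncate-≋ zero p d = ≋-sym (deg<0⇒≋[] d)
  truncate-≋ (suc n) [] d = ≋-trans (∷-cong refl (truncate-≋ n [] deg<-[])) 0∷[]≋[]
  truncate-≋ (suc n) (a ∷ p) d = ∷-cong refl (truncate-≋ n p (deg<-tail d))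

  truncate-Monic : ∀ {p} d → coef p d ≈ 1# → Monic F (truncate (suc d) p)
  truncate-Monic {[]} d e = contradiction (sym e) 1≉0
  truncate-Monic {a ∷ p} zero e = e
  truncate-Monic {a ∷ []} (suc d) e = contradiction (sym e) 1≉0
  truncate-Monic {a ∷ b ∷ p} (suc d) e = truncate-Monic {b ∷ p} d e

  private
    Monic-∷ : ∀ a {p} → Monic F p → Monic F (a ∷ p)
    Monic-∷ a {[]} e = contradiction (sym e) 1≉0
    Monic-∷ a {b ∷ p} e = e

    Monic-+ₚ : ∀ p a q → length p ≤ length q → Monic F q → Monic F (_+ₚ_ F p (a ∷ q))
    Monic-+ₚ [] a q le m = Monic-∷ a {q} m
    Monic-+ₚ (b ∷ []) a (c ∷ q) le m = m
    Monic-+ₚ (b ∷ b′ ∷ p) a (c ∷ c′ ∷ q) (s≤s le) m = Monic-∷ (b + a) {_+ₚ_ F (b′ ∷ p) (c ∷ c′ ∷ q)} (Monic-+ₚ (b′ ∷ p) c (c′ ∷ q) le m)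

    length-scaleₚ : ∀ c p → length (scaleₚ F c p) ≡ length p
    length-scaleₚ c [] = ≡.refl
    length-scaleₚ c (a ∷ p) = ≡.cong suc (length-scaleₚ c p)

    length-+ₚ : ∀ p q → length p ≤ length (_+ₚ_ F p q)
    length-+ₚ [] q = z≤n
    length-+ₚ (a ∷ p) [] = ℕ.≤-refl
    length-+ₚ (a ∷ p) (b ∷ q) = s≤s (length-+ₚ p q)

    Monic-scaleₚ : ∀ {c} → c ≈ 1# → ∀ p → Monic F p → Monic F (scaleₚ F c p)
    Monic-scaleₚ e [] m = m
    Monic-scaleₚ e (a ∷ []) m = trans (*-cong e m) (*-identityˡ 1#)
    Monic-scaleₚ e (a ∷ b ∷ p) m = Monic-scaleₚ e (b ∷ p) m

  Monic-*ₚ : ∀ p q → Monic F p → Monic F q → Monic F (_*ₚ_ F p q)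
  Monic-*ₚ [] q mp mq = contradiction (sym mp) 1≉0
  Monic-*ₚ (a ∷ []) [] mp mq = contradiction (sym mq) 1≉0
  Monic-*ₚ (a ∷ []) (b ∷ []) mp mq = trans (+-identityʳ _) (trans (*-cong mp mq) (*-identityˡ 1#))
  Monic-*ₚ (a ∷ []) (b ∷ c ∷ q) mp mq = Monic-scaleₚ mp (c ∷ q) mq
  Monic-*ₚ (a ∷ b ∷ p) q mp mq = Monic-+ₚ (scaleₚ F a q) 0# _
    (ℕ.≤-trans (ℕ.≤-reflexive (≡.trans (length-scaleₚ a q) (≡.sym (length-scaleₚ b q))))
      (length-+ₚ (scaleₚ F b q) _))
    (Monic-*ₚ (b ∷ p) q mp mq)

  ∏ : List P → P
  ∏ = productₚ F

  ∏-∷ : ∀ f fs → ∏ (f ∷ fs) ≋ f ⊛ ∏ fs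
  ∏-∷ f fs = ≡.subst (_≋ f ⊛ ∏ fs) (⊛-unfold f (∏ fs)) ≋-refl

  ∏-Monic : ∀ {fs} → All (Monic F) fs → Monic F (∏ fs)
  ∏-Monic [] = refl
  ∏-Monic {f ∷ fs} (m ∷ ms) = Monic-*ₚ f (∏ fs) m (∏-Monic ms)

  ∣∏ : ∀ fs → All (_∣ ∏ fs) fs
  ∣∏ [] = []
  ∣∏ (f ∷ fs) = (∏ fs , ∏-∷ f fs) ∷
    All.map (λ d → ∣-resp-≋ (≋-sym (∏-∷ f fs)) (∣-⊛ˡ f d)) (∣∏ fs)

  prime-∏ : ∀ {f} → Irred f → ∀ fs → f ∣ ∏ fs → Any (f ∣_) fs
  prime-∏ irr [] d = contradiction d (irreducible∤1 irr)
  prime-∏ irr (g ∷ fs) d with prime irr g (∏ fs) (∣-resp-≋ (∏-∷ g fs) d)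
  ... | inj₁ f∣g = here f∣g
  ... | inj₂ f∣fs = there (prime-∏ irr fs f∣fs)

  irreducible-∣ : ∀ {f g} → Monic F f → Irred f → Monic F g → Irred g → f ∣ g → f ≋ g
  irreducible-∣ {f} {g} mf if mg ig (h , e) with factors ig f h e
  ... | inj₁ (c , _ , f≋c) = contradiction f≋c (nonconstant if)
  ... | inj₂ (c , c≉0 , h≋c) with Monic⇒monicOfDegree mf | Monic⇒monicOfDegree mg
  ...   | m , mf′ | n , mg′ = ≋-sym (≋-trans g≋cf (≋-trans (scale-cong c≈1 ≋-refl) (scale-1 f)))
    where
    g≋cf : g ≋ scale c f
    g≋cf = ≋-trans e (≋-trans (⊛-cong ≋-refl h≋c) (≋-trans (⊛-comm f _) (const-⊛ c f)))
    n≡m : n ≡ m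
    n≡m = degree-unique (monic⇒degree mg′) (degree-resp-≋ (≋-sym g≋cf)
      (hasDegree (λ z → *-nonzero c≉0 (lead≉0 (monic⇒degree mf′)) (trans (sym (coef-scale c f m)) z))
        (deg<-scale c (monic-bound mf′))))
    c≈1 : c ≈ 1#
    c≈1 = trans (sym (*-identityʳ c)) (trans (*-congˡ (sym (lead≈1 mf′))) (trans (sym (coef-scale c f m))
      (trans (sym (at g≋cf m)) (≡.subst (λ k → coef g k ≈ 1#) n≡m (lead≈1 mg′)))))

  Distinct : List P → Set
  Distinct = AllPairs (λ f g → ¬ (f ≋ g))

  -- Write p = ∏ fs · s. The prime f cannot divide ∏ fs, as it would then divide, and hence equal, a
  -- member of `fs`; so it divides s.
  distinct-∏∣ : ∀ {fs p} → All (λ f → Monic F f × Irred f) fs → Distinct fs → All (_∣ p) fs → ∏ fs ∣ p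
  distinct-∏∣ {[]} {p} [] [] [] = p , ≋-sym (⊛-identityˡ p)
  distinct-∏∣ {f ∷ fs} {p} ((mf , if) ∷ ok) (f# ∷ distinct) (f∣p ∷ fs∣p) with distinct-∏∣ ok distinct fs∣p
  ... | s , e with prime if (∏ fs) s (∣-resp-≋ e f∣p)
  ...   | inj₁ f∣∏ = ⊥-elim (absurd ok f# (prime-∏ if fs f∣∏))
    where
    absurd : ∀ {gs} → All (λ f → Monic F f × Irred f) gs → All (λ g → ¬ (f ≋ g)) gs → Any (f ∣_) gs → ⊥
    absurd ((mg , ig) ∷ _) (f≉g ∷ _) (here f∣g) = f≉g (irreducible-∣ mf if mg ig f∣g)
    absurd (_ ∷ ok) (_ ∷ f#) (there any) = absurd ok f# any
  ...   | inj₂ (t , s≋ft) = t , (begin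
    p ≈⟨ e ⟩
    ∏ fs ⊛ s ≈⟨ ⊛-cong ≋-refl s≋ft ⟩
    ∏ fs ⊛ (f ⊛ t) ≈⟨ ⊛-assoc (∏ fs) f t ⟨
    (∏ fs ⊛ f) ⊛ t ≈⟨ ⊛-cong (⊛-comm (∏ fs) f) ≋-refl ⟩
    (f ⊛ ∏ fs) ⊛ t ≈⟨ ⊛-cong (∏-∷ f fs) ≋-refl ⟨
    ∏ (f ∷ fs) ⊛ t ∎)

  monomial : ℕ → P
  monomial zero = oneₚ F
  monomial (suc n) = 0# ∷ monomial n

  monomial-monic : ∀ n → MonicOfDegree (monomial n) n
  monomial-monic zero = monicOfDegree refl (deg<-∷ deg<-[])
  monomial-monic (suc n) = monicOfDegree (lead≈1 m) (deg<-∷ (monic-bound m))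
    where m = monomial-monic n

  ⊕-monomial-monic : ∀ {p n} → p deg< n → MonicOfDegree (p ⊕ monomial n) n
  ⊕-monomial-monic {p} {n} d = monicOfDegree
    (trans (coef-⊕ p _ n) (trans (+-cong (vanish d n ℕ.≤-refl) (lead≈1 (monomial-monic n))) (+-identityˡ 1#)))
    (deg<-⊕ (deg<-mono (ℕ.n≤1+n n) d) (monic-bound (monomial-monic n)))

  lead-split : ∀ {p n} → p deg< suc n → ∃[ r ] (r deg< n × p ≋ r ⊕ scale (coef p n) (monomial n))
  lead-split {p} {n} d = p ⊕ scale (- 1#) q , vanishing small ,
    ≋-sym (≋-trans (⊕-assoc p _ _) (≋-trans (⊕-cong ≋-refl (≋-trans (⊕-comm _ _) (⊕-inverseʳ _))) (⊕-identityʳ p)))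
    where
    q = scale (coef p n) (monomial n)
    small : ∀ i → n ≤ i → coef (p ⊕ scale (- 1#) q) i ≈ 0#
    small i n≤i with n ℕ.≟ i
    ... | yes ≡.refl = trans (coef-⊕ p _ n) (trans (+-congˡ (trans (coef-scale _ q n)
      (*-congˡ (trans (coef-scale _ (monomial n) n) (*-congˡ (lead≈1 (monomial-monic n)))))))
      (solve 1 (λ x → x :+ :- :1 :* (x :* :1) := :0) refl _))
    ... | no n≢i = vanish (deg<-⊕ d (deg<-scale (- 1#) (deg<-scale (coef p n) (monic-bound (monomial-monic n)))))
      i (ℕ.≤∧≢⇒< n≤i n≢i)

  monic-split : ∀ {p n} → MonicOfDegree p n → ∃[ r ] (r deg< n × p ≋ r ⊕ monomial n)
  monic-split m with lead-split (monic-bound m)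
  ... | r , d , e = r , d , ≋-trans e (⊕-cong ≋-refl (≋-trans (scale-cong (lead≈1 m) ≋-refl) (scale-1 _)))

  -- The finitely many lists of n enumerated coefficients represent every polynomial of degree below
  -- n, but only up to `_≋_`; this is why `Q` has to respect it.
  search : ∀ n {Q : P → Set} → (∀ {p q} → p ≋ q → Q p → Q q) → (∀ p → p deg< n → Dec (Q p)) → Dec (∃[ p ] (p deg< n × Q p))
  search zero resp Q? with Q? [] deg<-[]
  ... | yes Q[] = yes ([] , deg<-[] , Q[])
  ... | no ¬Q[] = no λ (p , d , Qp) → ¬Q[] (resp (deg<0⇒≋[] d) Qp)
  search (suc n) resp Q? with Fin.any? (λ i → search n (λ e → resp (∷-cong (refl {enum i}) e)) (λ p d → Q? (enum i ∷ p) (deg<-∷ d)))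
  ... | yes (i , p , d , Qp) = yes (enum i ∷ p , deg<-∷ d , Qp)
  ... | no none = no absurd
    where
    absurd : ¬ _
    absurd ([] , d , Qp) = none (proj₁ (index 0#) , [] , deg<-[] ,
      resp (≋-trans (≋-sym 0∷[]≋[]) (∷-cong (sym (proj₂ (index 0#))) ≋-refl)) Qp)
    absurd (a ∷ p , d , Qp) = none (proj₁ (index a) , p , deg<-tail d ,
      resp (∷-cong (sym (proj₂ (index a))) ≋-refl) Qp)

  -- The factor has degree k + 1, so that the indices k in `Fin d` run exactly through the degrees 1
  -- to d of nontrivial factors of a polynomial of degree d + 1.
  ProperFactor : P → ℕ → Set
  ProperFactor f k = ∃[ r ] (r deg< suc k × (r ⊕ monomial (suc k)) ∣ f)

  properFactor? : ∀ f d → Dec (∃[ i ] ProperFactor f (toℕ {d} i))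
  properFactor? f d = Fin.any? λ i → search (suc (toℕ i))
    (λ e (h , k) → h , ≋-trans k (⊛-cong (⊕-cong e ≋-refl) ≋-refl))
    (λ p d → monic∣? (⊕-monomial-monic d) f)

  -- In a factorisation g h without units both degrees are positive, and g divided by its leading
  -- coefficient is one of the factors already excluded.
  noFactor⇒irreducible : ∀ {f d} → MonicOfDegree f (suc d) → ¬ (∃[ i ] ProperFactor f (toℕ {d} i)) → Irred f
  noFactor⇒irreducible {f} {d} mf none = record { nonconstant = nc ; factors = λ g h e → go e (degree-factors (monic⇒degree mf) e) }
    where
    nc : ∀ {c} → ¬ (f ≋ c ∷ [])
    nc e = 1≉0 (trans (sym (lead≈1 mf)) (at e (suc d)))
    unit : ∀ {g} → HasDegree g 0 → IsUnit g
    unit {g} dg = coef g 0 , lead≉0 dg , deg<1⇒const (bound dg)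
    go : ∀ {g h} → f ≋ g ⊛ h → ∃[ m ] ∃[ n ] (HasDegree g m × HasDegree h n × m ℕ.+ n ≡ suc d) → IsUnit g ⊎ IsUnit h
    go e (zero , n , dg , dh , eq) = inj₁ (unit dg)
    go e (suc m , zero , dg , dh , eq) = inj₂ (unit dh)
    go {g} {h} e (suc m , suc n , dg , dh , eq) with normalise dg
    ... | c , c≉0 , mcg with monic-split mcg
    ...   | r , dr , cg≋ = ⊥-elim (none (Fin.fromℕ< m<d , r , dr′ , factor))
      where
      m<d : m < d
      m<d = ≡.subst (m <_) (ℕ.suc-injective eq) (ℕ.m<m+n m (s≤s z≤n))
      toℕ≡m : toℕ (Fin.fromℕ< m<d) ≡ m
      toℕ≡m = Fin.toℕ-fromℕ< m<d
      dr′ : r deg< suc (toℕ (Fin.fromℕ< m<d))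
      dr′ = ≡.subst (λ k → r deg< suc k) (≡.sym toℕ≡m) dr
      cg∣f : scale c g ∣ f
      cg∣f = scale (inv c≉0) h , ≋-trans e (≋-sym (begin
        scale c g ⊛ scale (inv c≉0) h ≈⟨ scale-⊛ c g _ ⟩
        scale c (g ⊛ scale (inv c≉0) h) ≈⟨ scale-cong refl (≋-trans (⊛-comm g _) (scale-⊛ _ h g)) ⟩
        scale c (scale (inv c≉0) (h ⊛ g)) ≈⟨ scale-scale c _ _ ⟩
        scale (c * inv c≉0) (h ⊛ g) ≈⟨ scale-cong (trans (*-comm _ _) (inv-inverse c≉0)) (⊛-comm h g) ⟩
        scale 1# (g ⊛ h) ≈⟨ scale-1 _ ⟩
        g ⊛ h ∎))
      factor : (r ⊕ monomial (suc (toℕ (Fin.fromℕ< m<d)))) ∣ f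
      factor = ≡.subst (λ k → (r ⊕ monomial (suc k)) ∣ f) (≡.sym toℕ≡m)
        (∣-trans (oneₚ F , ≋-trans cg≋ (≋-trans (≋-sym (⊛-identityˡ _)) (⊛-comm _ _))) cg∣f)

  cofactor-monic : ∀ {f g h m n} → MonicOfDegree f m → MonicOfDegree g n → f ≋ g ⊛ h →
    ∃[ k ] (MonicOfDegree h k × n ℕ.+ k ≡ m)
  cofactor-monic {f} {g} {h} {m} {n} mf mg e with degree-factors (monic⇒degree mf) e
  ... | n′ , k , dg , dh , eq with degree-unique dg (monic⇒degree mg)
  ...   | ≡.refl = k , monicOfDegree lead (bound dh) , eq
    where
    lead : coef h k ≈ 1#
    lead = trans (sym (*-identityˡ _)) (trans (*-congʳ (sym (lead≈1 mg)))
      (trans (sym (coef-⊛-top g h n k (bound dg) (bound dh)))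
      (trans (sym (at e (n ℕ.+ k))) (≡.subst (λ j → coef f j ≈ 1#) (≡.sym eq) (lead≈1 mf)))))

  ∏-++ : ∀ fs gs → ∏ (fs ++ gs) ≋ ∏ fs ⊛ ∏ gs
  ∏-++ [] gs = ≋-sym (⊛-identityˡ _)
  ∏-++ (f ∷ fs) gs = begin
    ∏ (f ∷ fs ++ gs) ≈⟨ ∏-∷ f (fs ++ gs) ⟩
    f ⊛ ∏ (fs ++ gs) ≈⟨ ⊛-cong ≋-refl (∏-++ fs gs) ⟩
    f ⊛ (∏ fs ⊛ ∏ gs) ≈⟨ ⊛-assoc f _ _ ⟨
    (f ⊛ ∏ fs) ⊛ ∏ gs ≈⟨ ⊛-cong (∏-∷ f fs) ≋-refl ⟨
    ∏ (f ∷ fs) ⊛ ∏ gs ∎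

  irred-resp-≋ : ∀ {f g} → f ≋ g → Irred f → Irred g
  irred-resp-≋ e irr = record
    { nonconstant = λ k → nonconstant irr (≋-trans e k)
    ; factors = λ g h k → factors irr g h (≋-trans e k) }

  -- Strong induction on the degree, with `n` as its bound: a proper factor and its cofactor both
  -- have smaller degree.
  factorise : ∀ n {f d} → d ≤ n → MonicOfDegree f d →
    ∃[ fs ] (All (λ f → Monic F f × Irred f) fs × f ≋ ∏ fs)
  factorise n {f} {zero} d≤n mf = [] , [] ,
    ≋-trans (deg<1⇒const (monic-bound mf)) (∷-cong (lead≈1 mf) ≋-refl)
  factorise (suc n) {f} {suc d} (s≤s d≤n) mf with properFactor? f d
  ... | no none = f′ ∷ [] , (truncate-Monic {f} (suc d) (lead≈1 mf) , irred-resp-≋ (≋-sym f′≋f) (noFactor⇒irreducible mf none)) ∷ [] ,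
    ≋-sym (≋-trans (∏-∷ f′ []) (≋-trans (⊛-comm f′ _) (≋-trans (⊛-identityˡ f′) f′≋f)))
    where
    f′ = truncate (suc (suc d)) f
    f′≋f : f′ ≋ f
    f′≋f = truncate-≋ _ f (monic-bound mf)
  ... | yes (i , r , dr , h , e) with cofactor-monic mf (⊕-monomial-monic dr) e
  ...   | k , mh , eq with factorise n (ℕ.≤-trans (Fin.toℕ<n i) d≤n) (⊕-monomial-monic dr)
                         | factorise n (ℕ.≤-trans (ℕ.≤-trans (ℕ.m≤n+m k (toℕ i)) (ℕ.≤-reflexive (ℕ.suc-injective eq))) d≤n) mh
  ...     | fs , okf , ef | gs , okg , eg = fs ++ gs , All.++⁺ okf okg ,
    ≋-trans e (≋-trans (⊛-cong ef eg) (≋-sym (∏-++ fs gs)))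

  -- The nonzero constant term is there for invertibility: an operator killed by a polynomial with
  -- nonzero constant term has a polynomial in itself as inverse.
  record Factor (f : P) : Set where
    field
      monic : Monic F f
      irreducible : Irred f
      separable : Sep f
      coef₀≉0 : ¬ (coef f 0 ≈ 0#)
  open Factor public

  -- If f occurred again later in the list, its square would divide the separable product, and f
  -- would divide 1.
  separable-factors : ∀ fs → All (λ f → Monic F f × Irred f) fs → Sep (∏ fs) → ¬ (coef (∏ fs) 0 ≈ 0#) →
    All Factor fs × Distinct fs
  separable-factors [] [] sep c≉0 = [] , []
  separable-factors (f ∷ fs) ((mf , if) ∷ ok) sep c≉0 =
    record { monic = mf ; irreducible = if ; separable = sep-∣ sep′ (∏ fs , ≋-refl)
           ; coef₀≉0 = λ z → c≉0 (trans c₀ (trans (*-congʳ z) (zeroˡ _))) } ∷ proj₁ rec ,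
    All.map (λ (s , e) f≋g → irreducible∤1 if (square∣sep⇒unit sep′
      (⊛-cong ≋-refl (≋-trans e (⊛-cong (≋-sym f≋g) ≋-refl))))) (∣∏ fs) ∷ proj₂ rec
    where
    sep′ : Sep (f ⊛ ∏ fs)
    sep′ = sep-resp-≋ (∏-∷ f fs) sep
    c₀ : coef (∏ (f ∷ fs)) 0 ≈ coef f 0 * coef (∏ fs) 0
    c₀ = trans (at (∏-∷ f fs) 0) (coef₀-⊛ f (∏ fs))
    rec = separable-factors fs ok (sep-∣ sep′ (f , ⊛-comm f (∏ fs)))
      λ z → c≉0 (trans c₀ (trans (*-congˡ z) (zeroʳ _)))

  factorise-separable : ∀ {f d} → MonicOfDegree f d → Sep f → ¬ (coef f 0 ≈ 0#) →
    ∃[ fs ] (All Factor fs × Distinct fs × f ≋ ∏ fs)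
  factorise-separable {f} {d} mf sep c≉0 with factorise d ℕ.≤-refl mf
  ... | fs , ok , e with separable-factors fs ok (sep-resp-≋ e sep) (λ z → c≉0 (trans (at e 0) z))
  ...   | ok′ , distinct = fs , ok′ , distinct , e

-- Semisimple operators under direct sums and conjugation

module SemisimpleOperators (F : CommutativeRing 0ℓ 0ℓ) (isField : IsField F) (_≟_ : Decidable (CommutativeRing._≈_ F))
    {order : ℕ} (hasOrder : HasOrder F order) where

  open Polynomials F
  open PolynomialDivision F isField _≟_
  open Factorisation F isField _≟_ hasOrder
  open VectorSpaces F
  open CommutativeRing F using (-_; 1#)

  -- Only `to` is required to be linear: with trivial kernel, its section `from` is forced to be
  -- linear too (`fromₗ`).
  record Iso (U V : Space) : Set where
    private
      module U = Space U
      module V = Space V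
    field
      to : Linear U V
      from : V.Carrier → U.Carrier
      to-from : ∀ v → app to (from v) V.≈ v
      to-kernel : ∀ u → app to u V.≈ V.𝟎 → u U.≈ U.𝟎

    private module to = Linear to

    to-injective : ∀ {u v} → app to u V.≈ app to v → u U.≈ v
    to-injective {u} {v} e = U.⊟≈𝟎⇒≈ (to-kernel _
      (V.trans (to.⊞-homo _ _) (V.trans (V.⊞-congˡ (to.⊟-homo v)) (V.≈⇒⊟≈𝟎 e))))

    from-to : ∀ u → from (app to u) U.≈ u
    from-to u = to-injective (to-from _)

    fromₗ : Linear V U
    fromₗ = record
      { app = from
      ; cong = λ e → to-injective (V.trans (to-from _) (V.trans e (V.sym (to-from _))))
      ; ⊞-homo = λ u v → to-injective (V.trans (to-from _)
          (V.sym (V.trans (to.⊞-homo _ _) (V.⊞-cong (to-from u) (to-from v)))))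
      ; ·-homo = λ a u → to-injective (V.trans (to-from _)
          (V.sym (V.trans (to.·-homo _ _) (V.·-congˡ (to-from u))))) }

  Annihilates : ∀ {V} → Poly F → Op V → Set
  Annihilates {V} p T = ∀ v → Space._≈_ V (eval p T v) (Space.𝟎 V)

  annihilates-∣ : ∀ {V p q} {T : Op V} → p ∣ q → Annihilates p T → Annihilates q T
  annihilates-∣ {V} {p} {q} {T} (h , e) ann v =
    V.trans (eval-cong T e v) (V.trans (eval-⊛ T p h v) (ann _))
    where module V = Space V

  -- The product only has to annihilate, not to be minimal, since enlarging it must remain possible
  -- when two operators are put side by side. `minimise` recovers the minimal polynomial for
  -- matrices.
  SemisimpleOp : ∀ {V} → Op V → Set
  SemisimpleOp T = ∃[ fs ] (All Factor fs × Distinct fs × Annihilates (∏ fs) T)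

  separable⇒semisimpleOp : ∀ {V f d} {T : Op V} → MonicOfDegree f d → Sep f →
    ¬ (CommutativeRing._≈_ F (coef f 0) (CommutativeRing.0# F)) → Annihilates f T → SemisimpleOp T
  separable⇒semisimpleOp {V} {T = T} m s c ann with factorise-separable m s c
  ... | fs , ok , distinct , e = fs , ok , distinct ,
    λ v → Space.trans V (eval-cong T (≋-sym e) v) (ann v)

  ≋? : ∀ p q → Dec (p ≋ q)
  ≋? p q with ≋[]? (p ⊕ scale (- 1#) q)
  ... | yes z = yes (Space.⊟≈𝟎⇒≈ polySpace z)
  ... | no ¬z = no λ e → ¬z (Space.≈⇒⊟≈𝟎 polySpace e)

  -- A common multiple of all listed factors that stays squarefree, because a factor already present
  -- is not added again.
  union : ∀ fs gs → All Factor fs → All Factor gs → Distinct gs →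
    ∃[ us ] (All Factor us × Distinct us × All (_∣ ∏ us) fs × All (_∣ ∏ us) gs)
  union [] gs okf okg dg = gs , okg , dg , [] , ∣∏ gs
  union (f ∷ fs) gs (of ∷ okf) okg dg with union fs gs okf okg dg
  ... | us , oku , du , fs∣ , gs∣ with Any.any? (≋? f) us
  ...   | yes f∈us = us , oku , du , f∣ us f∈us ∷ fs∣ , gs∣
    where
    f∣ : ∀ us → Any (f ≋_) us → f ∣ ∏ us
    f∣ (u ∷ us) (here f≋u) = ∏ us , ≋-trans (∏-∷ u us) (⊛-cong (≋-sym f≋u) ≋-refl)
    f∣ (u ∷ us) (there a) = ∣-resp-≋ (≋-sym (∏-∷ u us)) (∣-⊛ˡ u (f∣ us a))
  ...   | no f∉us = f ∷ us , of ∷ oku , All.¬Any⇒All¬ us f∉us ∷ du ,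
    (∏ us , ∏-∷ f us) ∷ All.map weaken fs∣ , All.map weaken gs∣
    where
    weaken : ∀ {g} → g ∣ ∏ us → g ∣ ∏ (f ∷ us)
    weaken d = ∣-resp-≋ (≋-sym (∏-∷ f us)) (∣-⊛ˡ f d)

  ∏∣ : ∀ {fs p} → All Factor fs → Distinct fs → All (_∣ p) fs → ∏ fs ∣ p
  ∏∣ ok = distinct-∏∣ (All.map (λ o → monic o , irreducible o) ok)

  _⊗ₗ_ : ∀ {V W} → Op V → Op W → Op (V ⊗ W)
  S ⊗ₗ T = record
    { app = λ (v , w) → app S v , app T w
    ; cong = λ (e , f) → S.cong e , T.cong f
    ; ⊞-homo = λ _ _ → S.⊞-homo _ _ , T.⊞-homo _ _
    ; ·-homo = λ _ _ → S.·-homo _ _ , T.·-homo _ _ }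
    where
    module S = Linear S
    module T = Linear T

  annihilates-⊗ : ∀ {V W p} {S : Op V} {T : Op W} → Annihilates p S → Annihilates p T → Annihilates p (S ⊗ₗ T)
  annihilates-⊗ {V} {W} {p} {S} {T} a b (v , w) =
    V.trans (proj₁ (eval-pair p)) (a v) , W.trans (proj₂ (eval-pair p)) (b w)
    where
    module V = Space V
    module W = Space W
    eval-pair : ∀ p → Space._≈_ (V ⊗ W) (eval p (S ⊗ₗ T) (v , w)) (eval p S v , eval p T w)
    eval-pair [] = V.refl , W.refl
    eval-pair (a ∷ p) = V.⊞-congˡ (Linear.cong S (proj₁ (eval-pair p))) ,
      W.⊞-congˡ (Linear.cong T (proj₂ (eval-pair p)))

  semisimpleOp-⊗ : ∀ {V W} {S : Op V} {T : Op W} → SemisimpleOp S → SemisimpleOp T → SemisimpleOp (S ⊗ₗ T)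
  semisimpleOp-⊗ {S = S} {T} (fs , okf , df , af) (gs , okg , dg , ag) with union fs gs okf okg dg
  ... | us , oku , du , fs∣ , gs∣ = us , oku , du ,
    annihilates-⊗ {p = ∏ us} {S} {T} (annihilates-∣ {T = S} (∏∣ okf df fs∣) af) (annihilates-∣ {T = T} (∏∣ okg dg gs∣) ag)

  conjugate : ∀ {U V} → Iso U V → Op U → Op V
  conjugate i S = to ∘ₗ (S ∘ₗ fromₗ)
    where open Iso i

  semisimpleOp-conjugate : ∀ {U V} (i : Iso U V) {S : Op U} → SemisimpleOp S → SemisimpleOp (conjugate i S)
  semisimpleOp-conjugate {U} {V} i {S} (fs , ok , d , ann) = fs , ok , d , λ v → begin
    eval (∏ fs) (conjugate i S) v ≈⟨ eval-congʳ (conjugate i S) (∏ fs) (to-from v) ⟨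
    eval (∏ fs) (conjugate i S) (app to (from v))
      ≈⟨ eval-intertwine S (conjugate i S) to (λ u → to.cong (Linear.cong S (U.sym (from-to u)))) (∏ fs) (from v) ⟩
    app to (eval (∏ fs) S (from v)) ≈⟨ to.cong-𝟎 (ann _) ⟩
    𝟎 ∎
    where
    open Iso i
    open Space V
    open Reasoning
    module to = Linear to
    module U = Space U

  -- Shifted by the identity: M is treated through T = M - 1, so that 1 can be an eigenvalue of the left summand.
  record Good {V : Space} (T : Op V) : Set where
    open Space V
    field
      left right : Op V
      sum : ∀ v → app T v ⊞ v ≈ app left v ⊞ app right v
      left-semisimple : SemisimpleOp left
      right-semisimple : SemisimpleOp right

  good-⊗ : ∀ {V W} {S : Op V} {T : Op W} → Good S → Good T → Good (S ⊗ₗ T)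
  good-⊗ g h = record
    { left = g.left ⊗ₗ h.left
    ; right = g.right ⊗ₗ h.right
    ; sum = λ (v , w) → g.sum v , h.sum w
    ; left-semisimple = semisimpleOp-⊗ {S = g.left} {h.left} g.left-semisimple h.left-semisimple
    ; right-semisimple = semisimpleOp-⊗ {S = g.right} {h.right} g.right-semisimple h.right-semisimple }
    where
    module g = Good g
    module h = Good h

  good-iso : ∀ {U V} {S : Op U} {T : Op V} (i : Iso U V) → let open Space V in
    (∀ u → app (Iso.to i) (app S u) ≈ app T (app (Iso.to i) u)) → Good S → Good T
  good-iso {U} {V} {S} {T} i comm g = record
    { left = conjugate i g.left
    ; right = conjugate i g.right
    ; sum = λ v → begin
        app T v ⊞ v ≈⟨ ⊞-cong (Linear.cong T (to-from v)) (to-from v) ⟨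
        app T (app to (from v)) ⊞ app to (from v) ≈⟨ ⊞-congʳ (comm (from v)) ⟨
        app to (app S (from v)) ⊞ app to (from v) ≈⟨ to.⊞-homo _ _ ⟨
        app to (app S (from v) U.⊞ from v) ≈⟨ to.cong (g.sum (from v)) ⟩
        app to (app g.left (from v) U.⊞ app g.right (from v)) ≈⟨ to.⊞-homo _ _ ⟩
        app (conjugate i g.left) v ⊞ app (conjugate i g.right) v ∎
    ; left-semisimple = semisimpleOp-conjugate i g.left-semisimple
    ; right-semisimple = semisimpleOp-conjugate i g.right-semisimple }
    where
    open Iso i
    open Space V
    open Reasoning
    module U = Space U
    module g = Good g
    module to = Linear to

-- Complements of a vector and coordinates along a Krylov chain

module KrylovChains (F : CommutativeRing 0ℓ 0ℓ) (isField : IsField F) (_≟_ : Decidable (CommutativeRing._≈_ F)) where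

  open Polynomials F
  open PolynomialDivision F isField _≟_
  open VectorSpaces F
  open CommutativeRing F using (0#; 1#; _+_; _*_; -_) renaming (Carrier to K; _≈_ to _≈ₖ_)
  private module K = CommutativeRing F

  -- W = K z ⊕ κ(W′).
  record Complement {W : Space} (z : Space.Carrier W) (W′ : Space) : Set where
    open Space W
    field
      κ : Linear W′ W
      cover : ∀ w → ∃[ s ] ∃[ w′ ] (w ≈ s · z ⊞ app κ w′)
      indep : ∀ s w′ → s · z ⊞ app κ w′ ≈ 𝟎 → (s ≈ₖ 0#) × (Space._≈_ W′ w′ (Space.𝟎 W′))

  private
    Kⁿ = coordSpace

    cons : ∀ {n} → K → (Fin n → K) → Fin (suc n) → K
    cons a u zero = a
    cons a u (suc i) = u i

  -- The hyperplane of vectors with first coordinate 0 is complementary to any line not contained in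
  -- it.
  complement-pivot : ∀ {n} (z : Fin (suc n) → K) → ¬ (z zero ≈ₖ 0#) → Complement {Kⁿ (suc n)} z (Kⁿ n)
  complement-pivot {n} z z₀≉0 = record
    { κ = embed n
    ; cover = λ w → let s = w zero * inv z₀≉0 in s , (λ i → w (suc i) + - (s * z (suc i))) , λ
      { zero → K.sym (K.trans (K.+-identityʳ _) (K.trans (K.*-assoc _ _ _)
          (K.trans (K.*-congˡ (inv-inverse z₀≉0)) (K.*-identityʳ _))))
      ; (suc i) → solve 2 (λ x y → x := y :+ (x :- y)) K.refl _ _ }
    ; indep = λ s w e →
        let s≈0 = *-cancel s (K.trans (K.sym (K.+-identityʳ _)) (e zero)) in
        s≈0 , λ i → K.trans (K.sym (K.+-identityˡ _))
          (K.trans (K.+-congʳ (K.sym (K.trans (K.*-congʳ s≈0) (K.zeroˡ _)))) (e (suc i))) }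
    where
    *-cancel : ∀ s → s * z zero ≈ₖ 0# → s ≈ₖ 0#
    *-cancel s e with s ≟ 0#
    ... | yes s≈0 = s≈0
    ... | no s≉0 with () ← *-nonzero s≉0 z₀≉0 e

  -- Here the line lies in the remaining coordinates; it is split off there, and the first
  -- coordinate joins the complement.
  complement-cons : ∀ {n} (z : Fin (suc (suc n)) → K) → z zero ≈ₖ 0# →
    Complement {Kⁿ (suc n)} (λ i → z (suc i)) (Kⁿ n) → Complement {Kⁿ (suc (suc n))} z (Kⁿ (suc n))
  complement-cons {n} z z₀≈0 c = record
    { κ = record
      { app = λ u → cons (u zero) (app κ (λ i → u (suc i)))
      ; cong = λ { e zero → e zero ; e (suc i) → κ.cong (λ j → e (suc j)) i }
      ; ⊞-homo = λ { u v zero → K.refl ; u v (suc i) → κ.⊞-homo _ _ i }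
      ; ·-homo = λ { a u zero → K.refl ; a u (suc i) → κ.·-homo a _ i } }
    ; cover = λ w → let (s , w′ , e) = cover (λ i → w (suc i)) in s , cons (w zero) w′ , λ
      { zero → K.sym (K.trans (K.+-congʳ (s·z₀≈0 s)) (K.+-identityˡ _))
      ; (suc i) → e i }
    ; indep = λ s w e →
        let (s≈0 , w′≈0) = indep s (λ i → w (suc i)) (λ i → e (suc i)) in
        s≈0 , λ { zero → K.trans (K.sym (K.trans (K.+-congʳ (s·z₀≈0 s)) (K.+-identityˡ _))) (e zero)
                ; (suc i) → w′≈0 i } }
    where
    open Complement c
    module κ = Linear κ
    s·z₀≈0 : ∀ s → s * z zero ≈ₖ 0#
    s·z₀≈0 s = K.trans (K.*-congˡ z₀≈0) (K.zeroʳ s)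

  vector-complement : ∀ n (z : Fin (suc n) → K) → (∀ i → z i ≈ₖ 0#) ⊎ Complement {Kⁿ (suc n)} z (Kⁿ n)
  vector-complement n z with z zero ≟ 0#
  vector-complement n z | no z₀≉0 = inj₂ (complement-pivot z z₀≉0)
  vector-complement zero z | yes z₀≈0 = inj₁ λ { zero → z₀≈0 }
  vector-complement (suc n) z | yes z₀≈0 with vector-complement n (λ i → z (suc i))
  ... | inj₁ e = inj₁ λ { zero → z₀≈0 ; (suc i) → e i }
  ... | inj₂ c = inj₂ (complement-cons z z₀≈0 c)

  -- Together the fields say that W = K w₀ ⊕ ker x, with the kernel parametrised by `W′`.
  record FunctionalSplit {W : Space} (x : Linear W kSpace) (W′ : Space) : Set where
    field
      w₀ : Space.Carrier W
      complement : Complement {W} w₀ W′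
      at-w₀ : app x w₀ ≈ₖ 1#
      at-κ : ∀ w′ → app x (app (Complement.κ complement) w′) ≈ₖ 0#

  functional-split : ∀ n (x : Linear (Kⁿ (suc n)) kSpace) → (∀ w → app x w ≈ₖ 0#) ⊎ FunctionalSplit x (Kⁿ n)
  functional-split n x = go n x (app x e₀ ≟ 0#)
    where
    e₀ : ∀ {n} → Fin (suc n) → K
    e₀ = cons 1# (λ _ → 0#)

    expand : ∀ {n} (x : Linear (Kⁿ (suc n)) kSpace) w →
      app x w ≈ₖ w zero * app x e₀ + app x (app (embed n) (λ i → w (suc i)))
    expand {n} x w = K.trans (Linear.cong x {v = λ i → w zero * e₀ i + app (embed n) (λ i → w (suc i)) i} λ
        { zero → K.sym (K.trans (K.+-identityʳ _) (K.*-identityʳ _))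
        ; (suc i) → K.sym (K.trans (K.+-congʳ (K.zeroʳ _)) (K.+-identityˡ _)) })
      (K.trans (Linear.⊞-homo x _ _) (K.+-congʳ (Linear.·-homo x _ _)))

    go : ∀ n (x : Linear (Kⁿ (suc n)) kSpace) → Dec (app x e₀ ≈ₖ 0#) →
      (∀ w → app x w ≈ₖ 0#) ⊎ FunctionalSplit x (Kⁿ n)
    go n x (no x₀≉0) = inj₂ record
      { w₀ = w₀
      ; complement = record
        { κ = record
          -- The first coordinate is the solution of x = 0 for given other coordinates.
          { app = λ u → cons (- x̄ * app x′ u) u
          ; cong = λ { e zero → K.*-congˡ (x′.cong e) ; e (suc i) → e i }
          ; ⊞-homo = λ { u v zero → K.trans (K.*-congˡ (x′.⊞-homo u v)) (K.distribˡ _ _ _) ; u v (suc i) → K.refl }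
          ; ·-homo = λ { a u zero → K.trans (K.*-congˡ (x′.·-homo a u))
                (solve 3 (λ n a y → n :* (a :* y) := a :* (n :* y)) K.refl _ _ _)
              ; a u (suc i) → K.refl } }
        ; cover = λ w → app x w , (λ i → w (suc i)) , λ
          { zero → K.sym (K.trans (K.+-congʳ (K.*-cong (expand x w) (K.*-identityʳ _)))
              (K.trans (solve 4 (λ a b c d → (a :* b :+ c) :* d :+ (:- d) :* c
                := a :* (d :* b)) K.refl _ _ _ _)
              (K.trans (K.*-congˡ (inv-inverse x₀≉0)) (K.*-identityʳ _))))
          ; (suc i) → K.sym (K.trans (K.+-congʳ (K.trans (K.*-congˡ (K.zeroʳ _)) (K.zeroʳ _))) (K.+-identityˡ _)) }
        ; indep = λ s w e →
            let w≈0 = λ i → K.trans (K.sym (K.trans (K.+-congʳ (K.trans (K.*-congˡ (K.zeroʳ _)) (K.zeroʳ _)))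
                    (K.+-identityˡ _))) (e (suc i))
                sx̄≈0 = K.trans (K.sym (K.trans (K.+-cong (K.*-congˡ (K.*-identityʳ _))
                    (K.trans (K.*-congˡ (x′.cong-𝟎 w≈0)) (K.zeroʳ _))) (K.+-identityʳ _))) (e zero)
            in K.trans (K.sym (K.*-identityʳ s)) (K.trans (K.*-congˡ (K.sym (inv-inverse x₀≉0)))
                 (K.trans (K.sym (K.*-assoc _ _ _)) (K.trans (K.*-congʳ sx̄≈0) (K.zeroˡ _)))) , w≈0 }
      ; at-w₀ = K.trans (Linear.·-homo x x̄ e₀) (inv-inverse x₀≉0)
      ; at-κ = λ w → K.trans (expand x _) (K.trans
          (solve 3 (λ d c b → (:- d :* c) :* b :+ c := c :* (:1 :- d :* b)) K.refl _ _ _)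
          (K.trans (K.*-congˡ (K.trans (K.+-congˡ (K.-‿cong (inv-inverse x₀≉0))) (K.-‿inverseʳ 1#))) (K.zeroʳ _))) }
      where
      x̄ = inv x₀≉0
      w₀ : Fin (suc n) → K
      w₀ i = x̄ * e₀ i
      x′ = x ∘ₗ embed n
      module x′ = Linear x′
    go zero x (yes x₀≈0) = inj₁ λ w → K.trans (expand x w)
      (K.trans (K.+-cong (K.trans (K.*-congˡ x₀≈0) (K.zeroʳ _))
        (Linear.cong-𝟎 x {app (embed zero) (λ i → w (suc i))} λ { zero → K.refl })) (K.+-identityˡ 0#))
    go (suc n) x (yes x₀≈0) with go n (x ∘ₗ embed (suc n)) (app x (app (embed (suc n)) e₀) ≟ 0#)
    ... | inj₁ zero′ = inj₁ λ w → K.trans (expand x w)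
      (K.trans (K.+-cong (K.trans (K.*-congˡ x₀≈0) (K.zeroʳ _)) (zero′ _)) (K.+-identityˡ 0#))
    ... | inj₂ s = inj₂ record
      { w₀ = app (embed (suc n)) w₀
      ; complement = complement-cons (app (embed (suc n)) w₀) K.refl complement
      ; at-w₀ = at-w₀
      ; at-κ = λ w → K.trans (expand x _)
          (K.trans (K.+-cong (K.trans (K.*-congˡ x₀≈0) (K.zeroʳ _)) (at-κ _)) (K.+-identityˡ 0#)) }
      where open FunctionalSplit s

  -- Every vector is uniquely p(T) v + ι w with deg p < d.
  record Chain {V : Space} (T : Op V) (d : ℕ) (W : Space) : Set where
    open Space V
    private module W = Space W
    field
      v : Carrier
      ι : Linear W V
      cover : ∀ u → ∃[ p ] ∃[ w ] (p deg< d × u ≈ eval p T v ⊞ app ι w)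
      indep : ∀ p w → p deg< d → eval p T v ⊞ app ι w ≈ 𝟎 → (p ≋ []) × (w W.≈ W.𝟎)

    private module ι = Linear ι

    unique : ∀ {p q w w′} → p deg< d → q deg< d →
      eval p T v ⊞ app ι w ≈ eval q T v ⊞ app ι w′ → (p ≋ q) × (w W.≈ w′)
    unique {p} {q} {w} {w′} dp dq e =
      let (a , b) = indep (p ⊕ scale (- 1#) q) (w W.⊞ W.⊟ w′) (deg<-⊕ dp (deg<-scale _ dq)) (begin
            eval (p ⊕ scale (- 1#) q) T v ⊞ app ι (w W.⊞ W.⊟ w′)
              ≈⟨ ⊞-cong (trans (eval-⊕ T p _ v) (⊞-congˡ (eval-scale T (- 1#) q v)))
                        (trans (ι.⊞-homo _ _) (⊞-congˡ (ι.⊟-homo w′))) ⟩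
            (eval p T v ⊞ ⊟ eval q T v) ⊞ (app ι w ⊞ ⊟ app ι w′) ≈⟨ ⊞-interchange _ _ _ _ ⟩
            (eval p T v ⊞ app ι w) ⊞ (⊟ eval q T v ⊞ ⊟ app ι w′) ≈⟨ ⊞-congˡ (·-distribˡ _ _ _) ⟨
            (eval p T v ⊞ app ι w) ⊞ ⊟ (eval q T v ⊞ app ι w′) ≈⟨ ≈⇒⊟≈𝟎 e ⟩
            𝟎 ∎)
      in Space.⊟≈𝟎⇒≈ polySpace a , W.⊟≈𝟎⇒≈ b
      where open Reasoning

    poly : Carrier → Poly F
    poly u = proj₁ (cover u)

    rest : Carrier → W.Carrier
    rest u = proj₁ (proj₂ (cover u))

    poly-deg : ∀ u → poly u deg< d
    poly-deg u = proj₁ (proj₂ (proj₂ (cover u)))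

    decompose : ∀ u → u ≈ eval (poly u) T v ⊞ app ι (rest u)
    decompose u = proj₂ (proj₂ (proj₂ (cover u)))

    coords-unique : ∀ {u p w} → p deg< d → u ≈ eval p T v ⊞ app ι w → (poly u ≋ p) × (rest u W.≈ w)
    coords-unique {u} dp e = unique (poly-deg u) dp (trans (sym (decompose u)) e)

    private
      ⊞-coords : ∀ u u′ → (poly (u ⊞ u′) ≋ poly u ⊕ poly u′) × (rest (u ⊞ u′) W.≈ rest u W.⊞ rest u′)
      ⊞-coords u u′ = coords-unique (deg<-⊕ (poly-deg u) (poly-deg u′))
        (trans (⊞-cong (decompose u) (decompose u′)) (trans (⊞-interchange _ _ _ _)
          (⊞-cong (sym (eval-⊕ T (poly u) _ v)) (sym (ι.⊞-homo _ _)))))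

      ·-coords : ∀ a u → (poly (a · u) ≋ scale a (poly u)) × (rest (a · u) W.≈ a W.· rest u)
      ·-coords a u = coords-unique (deg<-scale a (poly-deg u))
        (trans (·-congˡ (decompose u)) (trans (·-distribˡ _ _ _)
          (⊞-cong (sym (eval-scale T a (poly u) v)) (sym (ι.·-homo _ _)))))

      cong-coords : ∀ {u u′} → u ≈ u′ → (poly u ≋ poly u′) × (rest u W.≈ rest u′)
      cong-coords {u} {u′} e = coords-unique (poly-deg u′) (trans e (decompose u′))

    polyₗ : Linear V polySpace
    polyₗ = record { app = poly ; cong = λ e → proj₁ (cong-coords e)
      ; ⊞-homo = λ u u′ → proj₁ (⊞-coords u u′) ; ·-homo = λ a u → proj₁ (·-coords a u) }

    restₗ : Linear V W
    restₗ = record { app = rest ; cong = λ e → proj₂ (cong-coords e)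
      ; ⊞-homo = λ u u′ → proj₂ (⊞-coords u u′) ; ·-homo = λ a u → proj₂ (·-coords a u) }

-- Lengthening and shearing a Krylov chain

module Decomposition (F : CommutativeRing 0ℓ 0ℓ) (isField : IsField F) (_≟_ : Decidable (CommutativeRing._≈_ F))
    {order : ℕ} (hasOrder : HasOrder F order) where

  open Polynomials F
  open PolynomialDivision F isField _≟_
  open Factorisation F isField _≟_ hasOrder
  open VectorSpaces F
  open SemisimpleOperators F isField _≟_ hasOrder
  open KrylovChains F isField _≟_
  open CommutativeRing F using (0#; 1#; _+_; _*_; -_) renaming (Carrier to K; _≈_ to _≈ₖ_)
  private module K = CommutativeRing F

  tip : ∀ {V T d W} → Chain {V} T d W → Space.Carrier V
  tip {V} {T} {d} c = eval (monomial d) T (Chain.v c)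

  -- An exchange step: T^d v has the component z in W, so it can replace z in the direct sum, and
  -- what remains of W is a complement of z.
  extend : ∀ {V} {T : Op V} {d W W′} (c : Chain T d W) →
    Complement {W} (Chain.rest c (tip c)) W′ → Chain T (suc d) W′
  extend {V} {T} {d} {W} {W′} c comp = record { v = v ; ι = ι ∘ₗ κ ; cover = cover′ ; indep = indep′ }
    where
    open Chain c
    open Complement comp using (κ) renaming (cover to coverᶻ; indep to indepᶻ)
    open Space V
    open Reasoning
    module ι = Linear ι
    module W = Space W
    x^d = monomial d
    a = poly (tip c)
    z = rest (tip c)
    tip≈ : eval x^d T v ≈ eval a T v ⊞ app ι z
    tip≈ = decompose (tip c)

    ιz≈ : app ι z ≈ eval (x^d ⊕ scale (- 1#) a) T v
    ιz≈ = begin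
      app ι z ≈⟨ ⊞-⊟-cancelʳ _ _ ⟨
      (app ι z ⊞ ⊟ eval a T v) ⊞ eval a T v ≈⟨ ⊞-assoc _ _ _ ⟩
      app ι z ⊞ (⊟ eval a T v ⊞ eval a T v) ≈⟨ ⊞-congˡ (⊞-comm _ _) ⟩
      app ι z ⊞ (eval a T v ⊞ ⊟ eval a T v) ≈⟨ ⊞-assoc _ _ _ ⟨
      (app ι z ⊞ eval a T v) ⊞ ⊟ eval a T v ≈⟨ ⊞-congʳ (trans tip≈ (⊞-comm _ _)) ⟨
      eval x^d T v ⊞ ⊟ eval a T v ≈⟨ ⊞-congˡ (eval-scale T (- 1#) a v) ⟨
      eval x^d T v ⊞ eval (scale (- 1#) a) T v ≈⟨ eval-⊕ T x^d _ v ⟨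
      eval (x^d ⊕ scale (- 1#) a) T v ∎

    cover′ : ∀ u → ∃[ p ] ∃[ w′ ] (p deg< suc d × u ≈ eval p T v ⊞ app ι (app κ w′))
    cover′ u with coverᶻ (rest u)
    ... | s , w′ , e = poly u ⊕ q , w′ ,
      deg<-⊕ (deg<-mono (ℕ.n≤1+n d) (poly-deg u)) (deg<-scale s
        (deg<-⊕ (monic-bound (monomial-monic d)) (deg<-scale _ (deg<-mono (ℕ.n≤1+n d) (poly-deg (tip c)))))) , (begin
      u ≈⟨ decompose u ⟩
      eval (poly u) T v ⊞ app ι (rest u) ≈⟨ ⊞-congˡ (trans (ι.cong e) (ι.⊞-homo _ _)) ⟩
      eval (poly u) T v ⊞ (app ι (s W.· z) ⊞ app ι (app κ w′)) ≈⟨ ⊞-assoc _ _ _ ⟨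
      (eval (poly u) T v ⊞ app ι (s W.· z)) ⊞ app ι (app κ w′)
        ≈⟨ ⊞-congʳ (⊞-congˡ (trans (ι.·-homo s z) (trans (·-congˡ ιz≈) (sym (eval-scale T s _ v))))) ⟩
      (eval (poly u) T v ⊞ eval q T v) ⊞ app ι (app κ w′) ≈⟨ ⊞-congʳ (eval-⊕ T (poly u) q v) ⟨
      eval (poly u ⊕ q) T v ⊞ app ι (app κ w′) ∎)
      where q = scale s (x^d ⊕ scale (- 1#) a)

    indep′ : ∀ p w′ → p deg< suc d → eval p T v ⊞ app ι (app κ w′) ≈ 𝟎 →
      (p ≋ []) × (Space._≈_ W′ w′ (Space.𝟎 W′))
    indep′ p w′ dp e with lead-split dp
    ... | r , dr , p≋ = p≋[] , proj₂ sw
      where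
      s = coef p d
      -- The relation is rewritten in the old coordinates: its leading term s T^d v contributes s a
      -- to the polynomial and s z to the rest.
      both = indep (r ⊕ scale s a) (s W.· z W.⊞ app κ w′) (deg<-⊕ dr (deg<-scale s (poly-deg (tip c)))) (begin
        eval (r ⊕ scale s a) T v ⊞ app ι (s W.· z W.⊞ app κ w′)
          ≈⟨ ⊞-cong (trans (eval-⊕ T r _ v) (⊞-congˡ (eval-scale T s a v)))
                    (trans (ι.⊞-homo _ _) (⊞-congʳ (ι.·-homo s z))) ⟩
        (eval r T v ⊞ s · eval a T v) ⊞ (s · app ι z ⊞ app ι (app κ w′)) ≈⟨ ⊞-assoc _ _ _ ⟩
        eval r T v ⊞ (s · eval a T v ⊞ (s · app ι z ⊞ app ι (app κ w′))) ≈⟨ ⊞-congˡ (⊞-assoc _ _ _) ⟨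
        eval r T v ⊞ ((s · eval a T v ⊞ s · app ι z) ⊞ app ι (app κ w′)) ≈⟨ ⊞-assoc _ _ _ ⟨
        (eval r T v ⊞ (s · eval a T v ⊞ s · app ι z)) ⊞ app ι (app κ w′)
          ≈⟨ ⊞-congʳ (⊞-congˡ (trans (sym (·-distribˡ s _ _)) (·-congˡ (sym tip≈)))) ⟩
        (eval r T v ⊞ s · eval x^d T v) ⊞ app ι (app κ w′)
          ≈⟨ ⊞-congʳ (trans (eval-cong T p≋ v) (trans (eval-⊕ T r _ v) (⊞-congˡ (eval-scale T s x^d v)))) ⟨
        eval p T v ⊞ app ι (app κ w′) ≈⟨ e ⟩
        𝟎 ∎)
      sw = indepᶻ s w′ (proj₂ both)
      s≈0 = proj₁ sw
      r≋[] : r ≋ []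
      r≋[] = ≋-trans (≋-sym (≋-trans (⊕-cong ≋-refl (≋-trans (scale-cong s≈0 ≋-refl) (scale-0 a))) (⊕-identityʳ r))) (proj₁ both)
      p≋[] : p ≋ []
      p≋[] = ≋-trans p≋ (≋-trans (⊕-cong r≋[] (≋-trans (scale-cong s≈0 ≋-refl) (scale-0 x^d))) ([]-⊕ []))

  tail : Poly F → Poly F
  tail [] = []
  tail (a ∷ p) = p

  coef-tail : ∀ p i → coef (tail p) i ≈ₖ coef p (suc i)
  coef-tail [] i = K.refl
  coef-tail (a ∷ p) i = K.refl

  tailₗ : Linear polySpace polySpace
  tailₗ = record
    { app = tail
    ; cong = λ {p} {q} e → coefwise λ i → K.trans (coef-tail p i) (K.trans (at e (suc i)) (K.sym (coef-tail q i)))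
    ; ⊞-homo = λ p q → coefwise λ i → K.trans (coef-tail (p ⊕ q) i) (K.trans (coef-⊕ p q (suc i))
        (K.sym (K.trans (coef-⊕ (tail p) (tail q) i) (K.+-cong (coef-tail p i) (coef-tail q i)))))
    ; ·-homo = λ a p → coefwise λ i → K.trans (coef-tail (scale a p) i) (K.trans (coef-scale a p (suc i))
        (K.sym (K.trans (coef-scale a (tail p) i) (K.*-congˡ (coef-tail p i))))) }

  coefₗ : ℕ → Linear polySpace kSpace
  coefₗ i = record { app = λ p → coef p i ; cong = λ e → at e i
    ; ⊞-homo = λ p q → coef-⊕ p q i ; ·-homo = λ a p → coef-scale a p i }

  _∷ₗ_ : ∀ {W} → Linear W kSpace → Linear W polySpace → Linear W polySpace
  x ∷ₗ S = record
    { app = λ w → app x w ∷ app S w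
    ; cong = λ e → ∷-cong (Linear.cong x e) (Linear.cong S e)
    ; ⊞-homo = λ u v → ≋-trans (∷-cong (Linear.⊞-homo x u v) (Linear.⊞-homo S u v)) (≋-sym (∷-⊕-∷ _ _ _ _))
    ; ·-homo = λ a u → ≋-trans (∷-cong (Linear.·-homo x a u) (Linear.·-homo S a u)) (≋-sym (scale-∷ a _ _)) }

  zeroₗ : ∀ {V W} → Linear V W
  zeroₗ {W = W} = record { app = λ _ → 𝟎 ; cong = λ _ → refl
    ; ⊞-homo = λ _ _ → sym (⊞-identityˡ 𝟎) ; ·-homo = λ a _ → sym (·-zeroʳ a) }
    where open Space W

  -- Re-embedding W by w ↦ ι w + (S w)(T) v removes all of X except a constant term x;
  -- the coefficients of S are found from the top down.
  sylvester : ∀ {W} k (Y : Op W) (X : Linear W polySpace) → (∀ w → app X w deg< k) →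
    ∃[ S ] ∃[ x ] ((∀ w → app {W} {polySpace} S w deg< k) ×
      (∀ w → app X w ⊕ (0# ∷ app S w) ≋ (app {W} {kSpace} x w ∷ []) ⊕ app S (app Y w)))
  sylvester zero Y X dX = zeroₗ , zeroₗ , (λ w → deg<-[]) , 
    λ w → ≋-trans (⊕-cong (deg<0⇒≋[] (dX w)) ≋-refl) (⊕-comm _ _)
  sylvester {W} (suc k) Y X dX 
    with sylvester k Y (tailₗ ∘ₗ X) (λ w → vanishing λ i k≤i →
      K.trans (coef-tail (app X w) i) (vanish (dX w) (suc i) (s≤s k≤i)))
  ... | S′ , x′ , dS′ , eq′ = S , x , (λ w → deg<-∷ (dS′ w)) , λ w → coefwise (eq w)
    where
    -- The constant x′ left by the recursive call sits in degree one here; a new lowest coefficient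
    -- - x′ of `S` cancels it and moves x′(Y w) into degree zero.
    S : Linear W polySpace
    S = (scalar {kSpace} (- 1#) ∘ₗ x′) ∷ₗ S′
    x : Linear W kSpace
    x = (coefₗ 0 ∘ₗ X) +ₗ (x′ ∘ₗ Y)
    eq″ : ∀ w i → coef (app X w) (suc i) + coef (0# ∷ app S′ w) i ≈ₖ coef (app x′ w ∷ []) i + coef (app S′ (app Y w)) i
    eq″ w i = K.trans (K.+-congʳ (K.sym (coef-tail (app X w) i))) (K.trans (K.sym (coef-⊕ (tail (app X w)) _ i))
      (K.trans (at (eq′ w) i) (coef-⊕ (app x′ w ∷ []) _ i)))
    eq : ∀ w i → coef (app X w ⊕ (0# ∷ app S w)) i ≈ₖ coef ((app x w ∷ []) ⊕ app S (app Y w)) i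
    eq w i = K.trans (coef-⊕ (app X w) _ i) (K.trans (lemma i) (K.sym (coef-⊕ (app x w ∷ []) _ i)))
      where
      lemma : ∀ i → coef (app X w) i + coef (0# ∷ app S w) i ≈ₖ coef (app x w ∷ []) i + coef (app S (app Y w)) i
      lemma zero = solve 2 (λ a b → a :+ :0 := (a :+ b) :+ :- :1 :* b) K.refl _ _
      lemma (suc zero) = K.trans (K.+-congʳ (K.trans (K.sym (K.+-identityʳ _)) (eq″ w 0)))
        (solve 2 (λ a b → (a :+ b) :+ :- :1 :* a := :0 :+ b) K.refl _ _)
      lemma (suc (suc i)) = eq″ w (suc i)

  -- The functional `x` is the sole remaining obstruction to invariance of the complement: either it
  -- vanishes, or a vector outside its kernel starts a longer chain.
  record Sheared {V} {T : Op V} {d W} (c : Chain T d W) : Set where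
    open Space V
    field
      sheared : Chain T d W
      v-same : Chain.v sheared ≈ Chain.v c
      x : Linear W kSpace
      Y : Op W
      law : ∀ w → app T (app (Chain.ι sheared) w) ≈ app x w · Chain.v sheared ⊞ app (Chain.ι sheared) (app Y w)

  shear : ∀ {V} {T : Op V} {d W} (c : Chain T d W) → Sheared c
  shear {V} {T} {d} {W} c
    with sylvester {W} d (Chain.restₗ c ∘ₗ (T ∘ₗ Chain.ι c)) (Chain.polyₗ c ∘ₗ (T ∘ₗ Chain.ι c))
      (λ w → Chain.poly-deg c _)
  ... | S , x , dS , eq = record
    { sheared = record { v = v ; ι = ι′ ; cover = cover′ ; indep = indep′ }
    ; v-same = refl ; x = x ; Y = Y ; law = law }
    where
    open Chain c
    open Space V
    open Reasoning
    module ι = Linear ι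
    module T = Linear T
    module W = Space W
    module S = Linear S
    Y = restₗ ∘ₗ (T ∘ₗ ι)
    X = polyₗ ∘ₗ (T ∘ₗ ι)
    ι′ = ι +ₗ (evalAt T v ∘ₗ S)

    ι′≈ : ∀ p w → eval p T v ⊞ app ι′ w ≈ eval (p ⊕ app S w) T v ⊞ app ι w
    ι′≈ p w = trans (⊞-congˡ (⊞-comm _ _)) (trans (sym (⊞-assoc _ _ _)) (⊞-congʳ (sym (eval-⊕ T p _ v))))

    cover′ : ∀ u → ∃[ p ] ∃[ w ] (p deg< d × u ≈ eval p T v ⊞ app ι′ w)
    cover′ u = poly u ⊕ scale (- 1#) (app S (rest u)) , rest u , deg<-⊕ (poly-deg u) (deg<-scale _ (dS _)) ,
      trans (decompose u) (sym (trans (ι′≈ _ (rest u)) (⊞-congʳ (eval-cong T (Space.⊞-⊟-cancelʳ polySpace _ _) v))))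

    indep′ : ∀ p w → p deg< d → eval p T v ⊞ app ι′ w ≈ 𝟎 → (p ≋ []) × (w W.≈ W.𝟎)
    indep′ p w dp e = ≋-trans (≋-sym (≋-trans (⊕-cong ≋-refl (S.cong-𝟎 w≈0)) (⊕-identityʳ p))) (proj₁ both) , w≈0
      where
      both = indep (p ⊕ app S w) w (deg<-⊕ dp (dS w)) (trans (sym (ι′≈ p w)) e)
      w≈0 = proj₂ both

    law : ∀ w → app T (app ι′ w) ≈ app x w · v ⊞ app ι′ (app Y w)
    law w = begin
      app T (app ι w ⊞ eval (app S w) T v) ≈⟨ T.⊞-homo _ _ ⟩
      app T (app ι w) ⊞ app T (eval (app S w) T v)
        ≈⟨ ⊞-cong (trans (decompose _) (⊞-comm _ _)) (sym (eval-0∷ T (app S w) v)) ⟩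
      (app ι (app Y w) ⊞ eval (app X w) T v) ⊞ eval (0# ∷ app S w) T v ≈⟨ ⊞-assoc _ _ _ ⟩
      app ι (app Y w) ⊞ (eval (app X w) T v ⊞ eval (0# ∷ app S w) T v) ≈⟨ ⊞-congˡ (eval-⊕ T (app X w) _ v) ⟨
      app ι (app Y w) ⊞ eval (app X w ⊕ (0# ∷ app S w)) T v ≈⟨ ⊞-congˡ (eval-cong T (eq w) v) ⟩
      app ι (app Y w) ⊞ eval ((app x w ∷ []) ⊕ app S (app Y w)) T v
        ≈⟨ ⊞-congˡ (trans (eval-⊕ T (app x w ∷ []) _ v) (⊞-congʳ (eval-const T _ v))) ⟩
      app ι (app Y w) ⊞ (app x w · v ⊞ eval (app S (app Y w)) T v) ≈⟨ ⊞-leftComm _ _ _ ⟩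
      app x w · v ⊞ app ι′ (app Y w) ∎

  -- The chain starting from ι w₀ is longer by one than the chain from v.
  reroot : ∀ {V} {T : Op V} {d W W′} (c : Chain T d W) → let open Space V in
    (x : Linear W kSpace) (Y : Op W) →
    (∀ w → app T (app (Chain.ι c) w) ≈ app x w · Chain.v c ⊞ app (Chain.ι c) (app Y w)) →
    FunctionalSplit x W′ → Chain T (suc d) W′
  reroot {V} {T} {d} {W} {W′} c x Y law split = record { v = v′ ; ι = ι ∘ₗ κ ; cover = cover′ ; indep = indep′ }
    where
    open Chain c
    open FunctionalSplit split
    open Complement complement using (κ) renaming (cover to coverʷ; indep to indepʷ)
    open Space V
    open Reasoning
    module ι = Linear ι
    module T = Linear T
    module W = Space W
    module x = Linear x
    v′ = app ι w₀

    -- `Q p` collects the components along `v` that `law` splits off when `p` is evaluated at ι w₀.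
    -- Because x(w₀) = 1, it lowers degrees by exactly one and has the constants as kernel; these
    -- constants are the gained dimension.
    Q : Poly F → Poly F
    Q [] = []
    Q (a ∷ p) = app x (eval p Y w₀) ∷ Q p

    eval-v′ : ∀ p → eval p T v′ ≈ eval (Q p) T v ⊞ app ι (eval p Y w₀)
    eval-v′ [] = sym (trans (⊞-identityˡ _) ι.𝟎-homo)
    eval-v′ (a ∷ p) = begin
      a · v′ ⊞ app T (eval p T v′) ≈⟨ ⊞-congˡ (trans (T.cong (eval-v′ p)) (T.⊞-homo _ _)) ⟩
      a · v′ ⊞ (app T (eval (Q p) T v) ⊞ app T (app ι (eval p Y w₀))) ≈⟨ ⊞-congˡ (⊞-congˡ (law _)) ⟩
      a · v′ ⊞ (app T (eval (Q p) T v) ⊞ (app x (eval p Y w₀) · v ⊞ app ι (app Y (eval p Y w₀))))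
        ≈⟨ ⊞-congˡ (trans (sym (⊞-assoc _ _ _)) (⊞-congʳ (⊞-comm _ _))) ⟩
      a · v′ ⊞ (eval (Q (a ∷ p)) T v ⊞ app ι (app Y (eval p Y w₀))) ≈⟨ ⊞-leftComm _ _ _ ⟩
      eval (Q (a ∷ p)) T v ⊞ (a · v′ ⊞ app ι (app Y (eval p Y w₀)))
        ≈⟨ ⊞-congˡ (trans (⊞-congʳ (sym (ι.·-homo a w₀))) (sym (ι.⊞-homo _ _))) ⟩
      eval (Q (a ∷ p)) T v ⊞ app ι (eval (a ∷ p) Y w₀) ∎

    Q-≋[] : ∀ p → p ≋ [] → Q p ≋ []
    Q-≋[] [] e = ≋-refl
    Q-≋[] (a ∷ p) e = ≋-trans (∷-cong (x.cong-𝟎 (eval-≋[] Y p≋[] w₀)) (Q-≋[] p p≋[])) 0∷[]≋[]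
      where p≋[] = ∷≋[]⇒tail e

    Q-deg : ∀ k p → p deg< suc k → Q p deg< k
    Q-deg k [] dp = deg<-[]
    Q-deg zero (a ∷ p) dp = ≋[]⇒deg< (≋-trans
      (∷-cong (x.cong-𝟎 (eval-≋[] Y p≋[] w₀)) (Q-≋[] p p≋[])) 0∷[]≋[])
      where p≋[] = deg<0⇒≋[] (deg<-tail dp)
    Q-deg (suc k) (a ∷ p) dp = deg<-∷ (Q-deg k p (deg<-tail dp))

    Q-cong : ∀ {p q} → p ≋ q → Q p ≋ Q q
    Q-cong {[]} {q} e = ≋-sym (Q-≋[] q (≋-sym e))
    Q-cong {a ∷ p} {[]} e = Q-≋[] (a ∷ p) e
    Q-cong {a ∷ p} {b ∷ q} e = ∷-cong (x.cong (eval-cong Y (∷-injʳ e) w₀)) (Q-cong (∷-injʳ e))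

    Q-⊕const : ∀ p s → Q (p ⊕ (s ∷ [])) ≋ Q p
    Q-⊕const [] s = ≋-trans (Q-cong ([]-⊕ (s ∷ []))) (≋-trans (∷-cong x.𝟎-homo ≋-refl) 0∷[]≋[])
    Q-⊕const (a ∷ p) s = Q-cong (≋-trans (∷-⊕-∷ a p s []) (∷-cong K.refl (⊕-identityʳ p)))

    eval-⊕const : ∀ p s → eval (p ⊕ (s ∷ [])) Y w₀ W.≈ eval p Y w₀ W.⊞ s W.· w₀
    eval-⊕const p s = W.trans (eval-⊕ Y p _ w₀) (W.⊞-congˡ (eval-const Y s w₀))

    Q-surjective : ∀ k b → b deg< k → ∃[ p ] (p deg< suc k × Q p ≋ b)
    Q-surjective zero b db = [] , deg<-[] , ≋-sym (deg<0⇒≋[] db)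
    Q-surjective (suc k) [] db = [] , deg<-[] , ≋-refl
    Q-surjective (suc k) (b₀ ∷ b) db with Q-surjective k b (deg<-tail db)
    ... | p , dp , e = 0# ∷ (p ⊕ (s ∷ [])) , deg<-∷ (deg<-⊕ dp (deg<-mono (s≤s z≤n) (deg<-∷ deg<-[]))) ,
      ∷-cong (K.trans (x.cong (eval-⊕const p s)) (K.trans (x.⊞-homo _ _)
        (K.trans (K.+-congˡ (K.trans (x.·-homo s w₀) (K.trans (K.*-congˡ at-w₀) (K.*-identityʳ s))))
        (solve 2 (λ y b → y :+ (b :- y) := b) K.refl _ _))))
        (≋-trans (Q-⊕const p s) e)
      -- As x(w₀) = 1, a constant s added to p shifts x(p(Y) w₀) by s, while `Q p` stays the same;
      -- so the lowest coefficient can be corrected last.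
      where s = b₀ + - app x (eval p Y w₀)

    Q-kernel : ∀ p → Q p ≋ [] → p deg< 1
    Q-kernel [] e = deg<-[]
    Q-kernel (a ∷ p) e = deg<-∷ (≋[]⇒deg< (≋-trans p≋c (≋-trans (∷-cong c≈0 ≋-refl) 0∷[]≋[])))
      where
      p≋c = deg<1⇒const (Q-kernel p (∷≋[]⇒tail e))
      c≈0 : coef p 0 ≈ₖ 0#
      c≈0 = K.trans (K.sym (K.trans (K.*-congˡ at-w₀) (K.*-identityʳ _))) (K.trans (K.sym (x.·-homo _ w₀))
        (K.trans (x.cong (W.sym (W.trans (eval-cong Y p≋c w₀) (eval-const Y _ w₀)))) (at e 0)))

    cover′ : ∀ u → ∃[ p ] ∃[ w′ ] (p deg< suc d × u ≈ eval p T v′ ⊞ app ι (app κ w′))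
    cover′ u with Q-surjective d (poly u) (poly-deg u)
    ... | p , dp , e with coverʷ (rest u W.⊞ W.⊟ eval p Y w₀)
    ...   | s , w′ , f = p ⊕ (s ∷ []) , w′ , deg<-⊕ dp (deg<-mono (s≤s z≤n) (deg<-∷ deg<-[])) , (begin
      u ≈⟨ decompose u ⟩
      eval (poly u) T v ⊞ app ι (rest u)
        ≈⟨ ⊞-cong (eval-cong T (≋-trans (≋-sym e) (≋-sym (Q-⊕const p s))) v) (ι.cong rest≈) ⟩
      eval (Q (p ⊕ (s ∷ []))) T v ⊞ app ι (eval (p ⊕ (s ∷ [])) Y w₀ W.⊞ app κ w′)
        ≈⟨ ⊞-congˡ (ι.⊞-homo _ _) ⟩
      eval (Q (p ⊕ (s ∷ []))) T v ⊞ (app ι (eval (p ⊕ (s ∷ [])) Y w₀) ⊞ app ι (app κ w′)) ≈⟨ ⊞-assoc _ _ _ ⟨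
      (eval (Q (p ⊕ (s ∷ []))) T v ⊞ app ι (eval (p ⊕ (s ∷ [])) Y w₀)) ⊞ app ι (app κ w′)
        ≈⟨ ⊞-congʳ (eval-v′ (p ⊕ (s ∷ []))) ⟨
      eval (p ⊕ (s ∷ [])) T v′ ⊞ app ι (app κ w′) ∎)
      where
      rest≈ : rest u W.≈ eval (p ⊕ (s ∷ [])) Y w₀ W.⊞ app κ w′
      rest≈ = W.trans (W.sym (W.⊞-⊟-cancelʳ _ (eval p Y w₀))) (W.trans (W.⊞-congʳ f) (W.trans (W.⊞-comm _ _)
        (W.trans (W.sym (W.⊞-assoc _ _ _)) (W.⊞-congʳ (W.sym (eval-⊕const p s))))))

    indep′ : ∀ p w′ → p deg< suc d → eval p T v′ ⊞ app ι (app κ w′) ≈ 𝟎 →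
      (p ≋ []) × (Space._≈_ W′ w′ (Space.𝟎 W′))
    indep′ p w′ dp e = ≋-trans p≋c (≋-trans (∷-cong (proj₁ cw) ≋-refl) 0∷[]≋[]) , proj₂ cw
      where
      both = indep (Q p) (eval p Y w₀ W.⊞ app κ w′) (Q-deg d p dp) (begin
        eval (Q p) T v ⊞ app ι (eval p Y w₀ W.⊞ app κ w′) ≈⟨ ⊞-congˡ (ι.⊞-homo _ _) ⟩
        eval (Q p) T v ⊞ (app ι (eval p Y w₀) ⊞ app ι (app κ w′)) ≈⟨ ⊞-assoc _ _ _ ⟨
        (eval (Q p) T v ⊞ app ι (eval p Y w₀)) ⊞ app ι (app κ w′) ≈⟨ ⊞-congʳ (eval-v′ p) ⟨
        eval p T v′ ⊞ app ι (app κ w′) ≈⟨ e ⟩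
        𝟎 ∎)
      p≋c = deg<1⇒const (Q-kernel p (proj₁ both))
      cw = indepʷ (coef p 0) w′ (W.trans (W.⊞-congʳ (W.sym (W.trans (eval-cong Y p≋c w₀) (eval-const Y _ w₀)))) (proj₂ both))

-- Separable polynomials with prescribed trace and nonzero constant term

module SeparableTargets (F : CommutativeRing 0ℓ 0ℓ) (isField : IsField F) (_≟_ : Decidable (CommutativeRing._≈_ F))
    {order : ℕ} (hasOrder : HasOrder F order)
    (avoid : TwoAvoidable F) where

  open Polynomials F
  open PolynomialDivision F isField _≟_
  open Factorisation F isField _≟_ hasOrder
  open RingIdentities polyRing
  open CommutativeRing F renaming (Carrier to K) hiding (zero; semiring)
  open import Relation.Binary.Reasoning.Setoid polySetoid

  private
    P = Poly F

    X : P
    X = 0# ∷ 1# ∷ []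

    C : K → P
    C a = a ∷ []

    X⊛ : ∀ p → X ⊛ p ≋ 0# ∷ p
    X⊛ p = ≋-trans (0∷-⊛ (oneₚ F) p) (∷-cong refl (⊛-identityˡ p))

    C-⊛ : ∀ a b → C a ⊛ C b ≋ C (a * b)
    C-⊛ a b = ≋-trans (const-⊛ a (C b)) (≋-trans (scale-∷ a b []) (∷-cong refl scale-[]))

    C-inverse : ∀ {a b} → a * b ≈ 1# → C a ⊛ C b ≋ oneₚ F
    C-inverse {a} {b} e = ≋-trans (C-⊛ a b) (∷-cong e ≋-refl)

    ν : ℕ → K
    ν n = natMul F n 1#

  D-monomial : ∀ n → D (monomial (suc n)) ≋ scale (ν (suc n)) (monomial n)
  D-monomial zero = begin
    D (0# ∷ oneₚ F) ≈⟨ D-∷ 0# (oneₚ F) ⟩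
    oneₚ F ⊕ (0# ∷ []) ≈⟨ ⊕-cong ≋-refl 0∷[]≋[] ⟩
    oneₚ F ⊕ [] ≈⟨ ⊕-identityʳ _ ⟩
    oneₚ F ≈⟨ scale-1 _ ⟨
    scale 1# (oneₚ F) ≈⟨ scale-cong (sym (+-identityʳ 1#)) ≋-refl ⟩
    scale (ν 1) (oneₚ F) ∎
  D-monomial (suc n) = begin
    D (0# ∷ monomial (suc n)) ≈⟨ D-∷ 0# _ ⟩
    monomial (suc n) ⊕ (0# ∷ D (monomial (suc n)))
      ≈⟨ ⊕-cong (≋-sym (scale-1 _)) (≋-trans (∷-cong (sym (zeroʳ _)) (D-monomial n)) (≋-sym (scale-∷ _ 0# (monomial n)))) ⟩
    scale 1# (monomial (suc n)) ⊕ scale (ν (suc n)) (monomial (suc n)) ≈⟨ scale-distribʳ _ _ _ ⟨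
    scale (ν (suc (suc n))) (monomial (suc n)) ∎

  -- X^(m+1) - b becomes the characteristic polynomial of the right summand of a companion matrix whose
  -- last column ends in z; the left summand has the eigenvalues 1 and μ, which fixes the trace of b.
  record Target (m : ℕ) (z : K) : Set where
    field
      μ : K
      b : P
      μ≉0 : ¬ (μ ≈ 0#)
      μ≉1 : ¬ (μ ≈ 1#)
      b-deg : b deg< suc m
      b-trace : coef b m ≈ (z + 1#) - μ
      b-sep : Sep (monomial (suc m) ⊕ scale (- 1#) b)
      b-coef₀ : ¬ (coef (monomial (suc m) ⊕ scale (- 1#) b) 0 ≈ 0#)

  module _ (k : ℕ) where
    private
      m = suc k
      n = ν m
      N = ν (suc m)
      y = monomial k

      tail-poly : K → K → P
      tail-poly t c = scale t (monomial m) ⊕ C (- c)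

      trinomial : K → K → P
      trinomial t c = monomial (suc m) ⊕ scale (- 1#) (tail-poly t c)

      Xy : ∀ {j} → X ⊛ monomial j ≋ monomial (suc j)
      Xy = X⊛ _

      X²y-tXy : K → P
      X²y-tXy t = X ⊛ (X ⊛ y) ⊕ scale (- 1#) (C t ⊛ (X ⊛ y))

      trinomial≋ : ∀ t c → trinomial t c ≋ X²y-tXy t ⊕ C c
      trinomial≋ t c = begin
        monomial (suc m) ⊕ scale (- 1#) (scale t (monomial m) ⊕ C (- c))
          ≈⟨ ⊕-cong ≋-refl (scale-cong refl (⊕-cong ≋-refl
               (≋-trans (∷-cong (solve 1 (λ c → :- c := :- :1 :* c) refl c) (≋-sym scale-[])) (≋-sym (scale-∷ _ c []))))) ⟩
        monomial (suc m) ⊕ scale (- 1#) (scale t (monomial m) ⊕ scale (- 1#) (C c)) ≈⟨ sub-add _ _ _ ⟩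
        (monomial (suc m) ⊕ scale (- 1#) (scale t (monomial m))) ⊕ C c
          ≈⟨ ⊕-cong (⊕-cong (≋-trans (⊛-cong ≋-refl Xy) (Xy {m})) (scale-cong refl (≋-trans (const-⊛ t _) (scale-cong refl Xy)))) ≋-refl ⟨
        X²y-tXy t ⊕ C c ∎

      D-trinomial : ∀ t c → D (trinomial t c) ≋ C N ⊛ (X ⊛ y) ⊕ scale (- 1#) (C t ⊛ (C n ⊛ y))
      D-trinomial t c = begin
        D (monomial (suc m) ⊕ scale (- 1#) (tail-poly t c)) ≈⟨ D-⊕ _ _ ⟩
        D (monomial (suc m)) ⊕ D (scale (- 1#) (tail-poly t c)) ≈⟨ ⊕-cong (D-monomial m) (D-scale _ _) ⟩
        scale N (monomial m) ⊕ scale (- 1#) (D (scale t (monomial m) ⊕ C (- c)))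
          ≈⟨ ⊕-cong (≋-sym (≋-trans (const-⊛ N _) (scale-cong refl Xy))) (scale-cong refl (begin
               D (scale t (monomial m) ⊕ C (- c)) ≈⟨ D-⊕ _ _ ⟩
               D (scale t (monomial m)) ⊕ [] ≈⟨ ⊕-identityʳ _ ⟩
               D (scale t (monomial m)) ≈⟨ D-scale t _ ⟩
               scale t (D (monomial m)) ≈⟨ scale-cong refl (≋-trans (D-monomial k) (≋-sym (const-⊛ n y))) ⟩
               scale t (C n ⊛ y) ≈⟨ const-⊛ t _ ⟨
               C t ⊛ (C n ⊛ y) ∎)) ⟩
        C N ⊛ (X ⊛ y) ⊕ scale (- 1#) (C t ⊛ (C n ⊛ y)) ∎

      sep-intro : ∀ {f g h a b} → f ≋ g → D f ≋ h → a ⊛ g ⊕ b ⊛ h ≋ oneₚ F → Sep f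
      sep-intro e d s = _ , _ , ≋-trans (⊕-cong (⊛-cong ≋-refl e) (⊛-cong ≋-refl d)) s

      -- The derivative collapses to t X^k, which can only vanish at 0, where the trinomial has the
      -- value c.
      sep-zero : ∀ {t c} → N ≈ 0# → ¬ (t ≈ 0#) → ¬ (c ≈ 0#) → Sep (trinomial t c)
      sep-zero {t} {c} N≈0 t≉0 c≉0 = sep-intro (trinomial≋ t c) D≋
        (sep-n+1≈0 X y (C t) (C (inv t≉0)) (C c) (C (inv c≉0)) (C-inverse (inv-inverse t≉0)) (C-inverse (inv-inverse c≉0)))
        where
        -- From N = 1 + n = 0 follows n = -1.
        -tn≈t : - 1# * (t * n) ≈ t
        -tn≈t = trans (solve 2 (λ t n → :- :1 :* (t :* n) := t :- t :* (:1 :+ n)) refl t n)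
          (trans (+-congˡ (-‿cong (trans (*-congˡ N≈0) (zeroʳ t)))) (solve 1 (λ t → t :- :0 := t) refl t))
        D≋ : D (trinomial t c) ≋ C t ⊛ y
        D≋ = begin
          D (trinomial t c) ≈⟨ D-trinomial t c ⟩
          C N ⊛ (X ⊛ y) ⊕ scale (- 1#) (C t ⊛ (C n ⊛ y))
            ≈⟨ ⊕-cong (≋-trans (const-⊛ N _) (≋-trans (scale-cong N≈0 ≋-refl) (scale-0 _)))
                 (scale-cong refl (≋-trans (≋-sym (⊛-assoc (C t) (C n) y)) (≋-trans (⊛-cong (C-⊛ t n) ≋-refl) (const-⊛ _ y)))) ⟩
          [] ⊕ scale (- 1#) (scale (t * n) y) ≈⟨ []-⊕ _ ⟩
          scale (- 1#) (scale (t * n) y) ≈⟨ scale-scale _ _ y ⟩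
          scale (- 1# * (t * n)) y ≈⟨ scale-cong -tn≈t ≋-refl ⟩
          scale t y ≈⟨ const-⊛ t y ⟨
          C t ⊛ y ∎

      -- Apart from 0, only x₀ = n t / N can be a root of the derivative. The trinomial takes there
      -- the value s₀ + c, with s₀ the remainder of X^(m+1) - t X^m modulo X - x₀; hence the
      -- exception c₀ = - s₀.
      sep-nonzero : ∀ t → ¬ (N ≈ 0#) → ∃[ c₀ ] (∀ {c} → ¬ (c ≈ 0#) → ¬ (c ≈ c₀) → Sep (trinomial t c))
      sep-nonzero t N≉0 = - s₀ , λ {c} c≉0 c≉-s₀ → let s≉0 = λ z → c≉-s₀ (c≈ z) in
        sep-intro (trinomial≋ t c)
          (≋-trans (D-trinomial t c) (⊕-cong (⊛-cong (≋-sym 1+n≋N) ≋-refl) ≋-refl))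
          (sep-n+1≉0 X y (C t) (C c) (C (inv c≉0)) (C n) (C (inv N≉0)) h (C (s₀ + c)) (C (inv s≉0))
            (begin
              X²y-tXy t ⊕ C c ≈⟨ ⊕-cong (proj₁ (proj₂ (proj₂ dm))) ≋-refl ⟩
              (root ⊛ h ⊕ r) ⊕ C c ≈⟨ ⊕-assoc _ _ _ ⟩
              root ⊛ h ⊕ (r ⊕ C c)
                ≈⟨ ⊕-cong (⊛-cong root≋ ≋-refl) (≋-trans (⊕-cong (deg<1⇒const (proj₂ (proj₂ (proj₂ dm)))) ≋-refl)
                     (≋-trans (∷-⊕-∷ _ _ _ _) (∷-cong refl ([]-⊕ [])))) ⟩
              (X ⊕ scale (- 1#) (C (inv N≉0) ⊛ (C n ⊛ C t))) ⊛ h ⊕ C (s₀ + c) ∎)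
            (≋-trans (⊛-cong ≋-refl 1+n≋N) (C-inverse (inv-inverse N≉0)))
            (C-inverse (inv-inverse c≉0))
            (C-inverse (inv-inverse s≉0)))
        where
        1+n≋N : oneₚ F ⊕ C n ≋ C N
        1+n≋N = ≋-trans (∷-⊕-∷ 1# [] n []) (∷-cong refl ([]-⊕ []))
        x₀ = inv N≉0 * (n * t)
        root : P
        root = - 1# * x₀ ∷ 1# ∷ []
        root≋ : root ≋ X ⊕ scale (- 1#) (C (inv N≉0) ⊛ (C n ⊛ C t))
        root≋ = begin
          root ≈⟨ ∷-cong (sym (+-identityˡ _)) (≋-sym (⊕-identityʳ _)) ⟩
          0# + - 1# * x₀ ∷ (oneₚ F ⊕ []) ≈⟨ ∷-⊕-∷ _ _ _ _ ⟨
          X ⊕ C (- 1# * x₀) ≈⟨ ⊕-cong ≋-refl (≋-trans (scale-∷ _ x₀ []) (∷-cong refl scale-[])) ⟨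
          X ⊕ scale (- 1#) (C x₀)
            ≈⟨ ⊕-cong ≋-refl (scale-cong refl (≋-trans (⊛-cong ≋-refl (C-⊛ n t)) (C-⊛ _ _))) ⟨
          X ⊕ scale (- 1#) (C (inv N≉0) ⊛ (C n ⊛ C t)) ∎
        dm = divMod {root} {1} (monicOfDegree refl (deg<-∷ (deg<-∷ deg<-[]))) (X²y-tXy t)
        h = proj₁ dm
        r = proj₁ (proj₂ dm)
        s₀ = coef r 0
        c≈ : ∀ {c} → s₀ + c ≈ 0# → c ≈ - s₀
        c≈ {c} e = trans (solve 2 (λ s c → c := (s :+ c) :- s) refl s₀ c) (trans (+-congʳ e) (+-identityˡ _))

      trinomial-target : ∀ {z μ t c} → ¬ (μ ≈ 0#) → ¬ (μ ≈ 1#) → t ≈ (z + 1#) - μ → ¬ (c ≈ 0#) →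
        Sep (trinomial t c) → Target m z
      trinomial-target {z} {μ} {t} {c} μ≉0 μ≉1 t≈ c≉0 sep = record
        { μ = μ ; b = tail-poly t c ; μ≉0 = μ≉0 ; μ≉1 = μ≉1
        ; b-deg = deg<-⊕ (deg<-scale t (monic-bound (monomial-monic m))) (deg<-mono (s≤s z≤n) (deg<-∷ deg<-[]))
        ; b-trace = trans (coef-⊕ (scale t (monomial m)) _ m) (trans (+-identityʳ _)
            (trans (coef-scale t (monomial m) m) (trans (*-congˡ (lead≈1 (monomial-monic m))) (trans (*-identityʳ t) t≈))))
        ; b-sep = sep
        ; b-coef₀ = λ e → c≉0 (trans (sym coef₀) e) }
        where
        coef₀ : coef (trinomial t c) 0 ≈ c
        coef₀ = trans (coef-⊕ (monomial (suc m)) _ 0) (trans (+-identityˡ _) (trans (coef-scale _ (tail-poly t c) 0)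
          (trans (*-congˡ (trans (coef-⊕ (scale t (monomial m)) _ 0) (+-congʳ (trans (coef-scale t (monomial m) 0) (zeroʳ t)))))
          (solve 1 (λ c → :- :1 :* (:0 :+ :- c) := c) refl c))))

    target-zero : N ≈ 0# → ∀ {z μ} → ¬ (μ ≈ 0#) → ¬ (μ ≈ 1#) → ¬ ((z + 1#) - μ ≈ 0#) → Target m z
    target-zero N≈0 μ≉0 μ≉1 t≉0 = trinomial-target μ≉0 μ≉1 refl 1≉0 (sep-zero N≈0 t≉0 1≉0)

    target-nonzero : ¬ (N ≈ 0#) → ∀ {z} → Target m z
    target-nonzero N≉0 {z} =
      let (μ , μ≉0 , μ≉1) = avoid 0# 1#
          (c₀ , sep) = sep-nonzero ((z + 1#) - μ) N≉0
          (c , c≉0 , c≉c₀) = avoid 0# c₀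
      in trinomial-target μ≉0 μ≉1 refl c≉0 (sep c≉0 c≉c₀)

    -- z = 1 and μ = 2 force b to have trace 0, and then X^(k+2) + X + 1 is separable as its derivative is 1.
    target-special : N ≈ 0# → ¬ (1# + 1# ≈ 0#) → ∀ {z} → z ≈ 1# → Target m z
    target-special N≈0 2≉0 {z} z≈1 = record
      { μ = 1# + 1# ; b = b ; μ≉0 = 2≉0
      ; μ≉1 = λ e → 1≉0 (trans (solve 0 (:1 := (:1 :+ :1) :- :1) refl) (trans (+-congʳ e) (-‿inverseʳ 1#)))
      ; b-deg = deg<-∷ (deg<-mono (s≤s z≤n) (deg<-∷ deg<-[]))
      ; b-trace = trans (coef-b k N≈0) (sym (trans (+-congʳ (+-congʳ z≈1)) (-‿inverseʳ _)))
      ; b-sep = [] , oneₚ F , (begin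
          [] ⊛ g ⊕ oneₚ F ⊛ D g ≈⟨ ≋-trans (⊕-cong ([]-⊛ g) (⊛-identityˡ _)) ([]-⊕ _) ⟩
          D g ≈⟨ D-⊕ _ _ ⟩
          D (monomial (suc m)) ⊕ D (scale (- 1#) b) ≈⟨ ⊕-cong (D-monomial m) (D-scale _ b) ⟩
          scale N (monomial m) ⊕ scale (- 1#) (D b)
            ≈⟨ ⊕-cong (≋-trans (scale-cong N≈0 ≋-refl) (scale-0 _)) (scale-∷ _ _ []) ⟩
          [] ⊕ (- 1# * (- 1# + 0#) ∷ scale (- 1#) []) ≈⟨ []-⊕ _ ⟩
          - 1# * (- 1# + 0#) ∷ scale (- 1#) []
            ≈⟨ ∷-cong (solve 0 (:- :1 :* (:- :1 :+ :0) := :1) refl) scale-[] ⟩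
          oneₚ F ∎)
      ; b-coef₀ = λ e → 1≉0 (trans (sym (trans (coef-⊕ (monomial (suc m)) _ 0) (trans (+-congˡ (coef-scale _ b 0))
          (solve 0 (:0 :+ :- :1 :* :- :1 := :1) refl)))) e) }
      where
      b : P
      b = - 1# ∷ - 1# ∷ []
      g = monomial (suc m) ⊕ scale (- 1#) b
      coef-b : ∀ k → ν (suc (suc k)) ≈ 0# → coef b (suc k) ≈ 0#
      -- In degree two the linear coefficient of `b` is the trace itself and would be -1, but then N
      -- = 2 is nonzero.
      coef-b zero e = ⊥-elim (2≉0 (trans (+-congˡ (sym (+-identityʳ 1#))) e))
      coef-b (suc k) e = refl

    -- For N = 0 the trace t = z + 1 - μ should be nonzero. If z = 0, then t = 1 - μ is. If z is
    -- neither 0 nor 1, then μ = z gives t = 1. If z = 1 and 2 = 0, then t = - μ. In the remaining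
    -- case, over three elements, μ = 2 is forced and gives t = 0; this is left to `target-special`.
    target : ∀ z → Target m z
    target z with N ≟ 0#
    ... | no N≉0 = target-nonzero N≉0
    ... | yes N≈0 with z ≟ 0# | z ≟ 1#
    ...   | yes z≈0 | _ = let (μ , μ≉0 , μ≉1) = avoid 0# 1# in
      target-zero N≈0 μ≉0 μ≉1 λ e → μ≉1 (trans (solve 2 (λ z μ → μ := (z :+ :1) :- ((z :+ :1) :- μ)) refl z μ)
        (trans (+-cong (+-congʳ z≈0) (-‿cong e)) (solve 0 (:0 :+ :1 :- :0 := :1) refl)))
    ...   | no z≉0 | no z≉1 = target-zero N≈0 z≉0 z≉1
      λ e → 1≉0 (trans (solve 1 (λ z → :1 := (z :+ :1) :- z) refl z) e)
    ...   | no z≉0 | yes z≈1 with (1# + 1#) ≟ 0#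
    ...     | no 2≉0 = target-special N≈0 2≉0 z≈1
    ...     | yes 2≈0 = let (μ , μ≉0 , μ≉1) = avoid 0# 1# in
      target-zero N≈0 μ≉0 μ≉1 λ e → μ≉0 (trans (solve 2 (λ z μ → μ := (z :+ :1) :- ((z :+ :1) :- μ)) refl z μ)
        (trans (+-cong (trans (+-congʳ z≈1) 2≈0) (-‿cong e)) (solve 0 (:0 :- :0 := :0) refl)))

-- Every operator plus the identity is a sum of two invertible semisimple ones

module GoodOperators (F : CommutativeRing 0ℓ 0ℓ) (isField : IsField F) (_≟_ : Decidable (CommutativeRing._≈_ F))
    {order : ℕ} (hasOrder : HasOrder F order)
    (avoid : TwoAvoidable F) where

  open Polynomials F
  open PolynomialDivision F isField _≟_
  open Factorisation F isField _≟_ hasOrder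
  open RingIdentities polyRing
  open VectorSpaces F
  open SemisimpleOperators F isField _≟_ hasOrder
  open KrylovChains F isField _≟_
  open Decomposition F isField _≟_ hasOrder
  open SeparableTargets F isField _≟_ hasOrder avoid
  open CommutativeRing F using (0#; 1#; _+_; _*_; -_) renaming (Carrier to K; _≈_ to _≈ₖ_)
  private module K = CommutativeRing F

  linear : K → Poly F
  linear c = - c ∷ 1# ∷ []

  linear-monic : ∀ c → MonicOfDegree (linear c) 1
  linear-monic c = monicOfDegree K.refl (deg<-∷ (deg<-∷ deg<-[]))

  D-linear : ∀ c → D (linear c) ≋ oneₚ F
  D-linear c = ∷-cong (K.+-identityʳ 1#) ≋-refl

  -‿nonzero : ∀ {c} → ¬ (c ≈ₖ 0#) → ¬ (- c ≈ₖ 0#)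
  -‿nonzero {c} c≉0 e = c≉0 (K.trans (solve 1 (λ c → c := :- (:- c)) K.refl c)
    (K.trans (K.-‿cong e) (solve 0 (:- :0 := :0) K.refl)))

  difference-nonzero : ∀ {a b} → ¬ (a ≈ₖ b) → ¬ (a + - b ≈ₖ 0#)
  difference-nonzero {a} {b} a≉b e = a≉b (K.trans (solve 2 (λ a b → a := (a :- b) :+ b) K.refl a b)
    (K.trans (K.+-congʳ e) (K.+-identityˡ b)))

  module _ {V : Space} (T : Op V) where
    open Space V

    eval-linear : ∀ c u → eval (linear c) T u ≈ (- c) · u ⊞ app T u
    eval-linear c u = ⊞-congˡ (Linear.cong T (eval-one T u))

  scalar-semisimple : ∀ {V c} → ¬ (c ≈ₖ 0#) → SemisimpleOp {V} (scalar c)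
  scalar-semisimple {V} {c} c≉0 = separable⇒semisimpleOp {V} {T = scalar c} (linear-monic c)
    ([] , oneₚ F , ≋-trans (⊕-cong ([]-⊛ _) (⊛-identityˡ _)) (≋-trans ([]-⊕ _) (D-linear c)))
    (-‿nonzero c≉0)
    λ u → trans (eval-linear {V} (scalar c) c u) (trans (sym (·-distribʳ _ _ u))
      (trans (·-congʳ (K.-‿inverseˡ c)) (·-zeroˡ u)))
    where open Space V

  rankOne : ∀ {V} → Linear V kSpace → Space.Carrier V → Op V
  rankOne {V} ℓ y = record
    { app = λ u → app ℓ u · y
    ; cong = λ e → ·-congʳ (Linear.cong ℓ e)
    ; ⊞-homo = λ u w → trans (·-congʳ (Linear.⊞-homo ℓ u w)) (·-distribʳ _ _ y)
    ; ·-homo = λ a u → trans (·-congʳ (Linear.·-homo ℓ a u)) (·-assoc a _ y) }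
    where open Space V

  -- On the hyperplane ker ℓ this is the identity, and y is an eigenvector for μ.
  transvection-semisimple : ∀ {V} (ℓ : Linear V kSpace) y {μ} → ¬ (μ ≈ₖ 0#) → ¬ (μ ≈ₖ 1#) →
    app ℓ y ≈ₖ μ + - 1# → SemisimpleOp {V} (scalar 1# +ₗ rankOne ℓ y)
  transvection-semisimple {V} ℓ y {μ} μ≉0 μ≉1 ℓy≈ = separable⇒semisimpleOp {V} {T = A}
    (monic-⊛ (linear-monic 1#) (linear-monic μ)) sep coef₀ annihilated
    where
    open Space V
    open Reasoning
    module ℓ = Linear ℓ
    A = scalar 1# +ₗ rankOne ℓ y
    p = linear 1#
    q = linear μ
    e = μ + - 1# ∷ []
    e⁻¹ = inv (difference-nonzero μ≉1) ∷ []
    p≋q+e : p ≋ q ⊕ e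
    p≋q+e = ≋-sym (≋-trans (∷-⊕-∷ _ _ _ _) (∷-cong
      (solve 1 (λ μ → :- μ :+ (μ :- :1) := :- :1) K.refl μ) (⊕-identityʳ _)))
    e⁻¹e≋1 : e⁻¹ ⊛ e ≋ oneₚ F
    e⁻¹e≋1 = ≋-trans (const-⊛ _ e) (≋-trans (scale-∷ _ _ []) (∷-cong (inv-inverse (difference-nonzero μ≉1)) scale-[]))
    D≋ : D ((q ⊕ e) ⊛ q) ≋ q ⊕ (q ⊕ e)
    D≋ = ≋-trans (D-cong (⊛-cong (≋-sym p≋q+e) (≋-refl {q}))) (≋-trans (D-⊛ p q)
      (⊕-cong (≋-trans (⊛-cong (D-linear 1#) ≋-refl) (⊛-identityˡ q))
              (≋-trans (⊛-cong (≋-refl {p}) (D-linear μ)) (≋-trans (⊛-comm p _) (≋-trans (⊛-identityˡ p) p≋q+e)))))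
    sep : Sep (p ⊛ q)
    sep = sep-resp-≋ (⊛-cong (≋-sym p≋q+e) (≋-refl {q}))
      (_ , _ , ≋-trans (⊕-cong ≋-refl (⊛-cong ≋-refl D≋)) (sep-pair q e e⁻¹ e⁻¹e≋1))
    coef₀ : ¬ (coef (p ⊛ q) 0 ≈ₖ 0#)
    coef₀ z = *-nonzero (-‿nonzero 1≉0) (-‿nonzero μ≉0) (K.trans (K.sym (coef₀-⊛ p q)) z)
    -- A - μ maps everything into ker ℓ, and A - 1 vanishes on ker ℓ.
    ℓ-kills : ∀ u → app ℓ (eval q A u) ≈ₖ 0#
    ℓ-kills u = K.trans (ℓ.cong (eval-linear A μ u)) (K.trans (ℓ.⊞-homo _ _) (K.trans
      (K.+-cong (ℓ.·-homo _ u) (K.trans (ℓ.⊞-homo _ _) (K.+-cong (ℓ.·-homo 1# u)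
        (K.trans (ℓ.·-homo _ y) (K.*-congˡ ℓy≈)))))
      (solve 2 (λ m x → :- m :* x :+ (:1 :* x :+ x :* (m :- :1)) := :0) K.refl μ (app ℓ u))))
    annihilated : ∀ u → eval (p ⊛ q) A u ≈ 𝟎
    annihilated u = begin
      eval (p ⊛ q) A u ≈⟨ eval-⊛ A p q u ⟩
      eval p A w ≈⟨ eval-linear A 1# w ⟩
      ⊟ w ⊞ (1# · w ⊞ app ℓ w · y) ≈⟨ ⊞-assoc _ _ _ ⟨
      (⊟ w ⊞ 1# · w) ⊞ app ℓ w · y
        ≈⟨ 𝟎-⊞-𝟎 (trans (⊞-congˡ (·-identity w)) (⊞-inverseˡ w)) (trans (·-congʳ (ℓ-kills u)) (·-zeroˡ y)) ⟩
      𝟎 ∎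
      where w = eval q A u

  -- On a line `T` is a scalar z, and z + 1 is split into two scalars, both nonzero as μ avoids 0
  -- and z + 1. In higher dimension the summands are 1 + R and T - R, with `R` of rank at most one
  -- and zero on all basis vectors T^i v but the last.
  cyclic-good : ∀ {V} {T : Op V} {m} → Chain T (suc m) (coordSpace 0) → Good T
  cyclic-good {V} {T} {zero} c = record
    { left = scalar μ ; right = scalar ((z + 1#) + - μ)
    ; sum = λ u → begin
        app T u ⊞ u ≈⟨ ⊞-cong (T≈z u) (sym (·-identity u)) ⟩
        z · u ⊞ 1# · u ≈⟨ ·-distribʳ z 1# u ⟨
        (z + 1#) · u ≈⟨ ·-congʳ (solve 2 (λ a m → a := m :+ (a :- m)) K.refl (z + 1#) μ) ⟩
        (μ + ((z + 1#) + - μ)) · u ≈⟨ ·-distribʳ _ _ u ⟩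
        μ · u ⊞ ((z + 1#) + - μ) · u ∎
    ; left-semisimple = scalar-semisimple {V} (proj₁ (proj₂ choice))
    ; right-semisimple = scalar-semisimple {V} (difference-nonzero λ e → proj₂ (proj₂ choice) (K.sym e)) }
    where
    open Chain c
    open Space V
    open Reasoning
    module T = Linear T
    z = coef (poly (app T v)) 0
    choice = avoid 0# (z + 1#)
    μ = proj₁ choice
    line : ∀ u → u ≈ coef (poly u) 0 · v
    line u = trans (decompose u) (trans (⊞-congˡ (Linear.cong-𝟎 ι λ ())) (trans (⊞-identityʳ _)
      (trans (eval-cong T (deg<1⇒const (poly-deg u)) v) (eval-const T _ v))))
    T≈z : ∀ u → app T u ≈ z · u
    T≈z u = trans (T.cong (line u)) (trans (T.·-homo _ v) (trans (·-congˡ (line _)) (trans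
      (Linear.·-homo (scalar {V} (coef (poly u) 0)) z v) (·-congˡ (sym (line u))))))
  cyclic-good {V} {T} {suc k} c = record
    { left = scalar 1# +ₗ R
    ; right = B
    ; sum = λ u → begin
        app T u ⊞ u ≈⟨ ⊞-comm _ _ ⟩
        u ⊞ app T u ≈⟨ ⊞-congʳ (⊞-identityʳ u) ⟨
        (u ⊞ 𝟎) ⊞ app T u ≈⟨ ⊞-congʳ (⊞-cong (·-identity u) (⊞-inverseʳ _)) ⟨
        (1# · u ⊞ (app R u ⊞ ⊟ app R u)) ⊞ app T u ≈⟨ ⊞-congʳ (⊞-assoc _ _ _) ⟨
        ((1# · u ⊞ app R u) ⊞ ⊟ app R u) ⊞ app T u ≈⟨ trans (⊞-assoc _ _ _) (⊞-congˡ (⊞-comm _ _)) ⟩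
        (1# · u ⊞ app R u) ⊞ (app T u ⊞ ⊟ app R u) ∎
    ; left-semisimple = transvection-semisimple ℓ y μ≉0 μ≉1 ℓy≈
    ; right-semisimple = separable⇒semisimpleOp {V} {T = B} g-monic b-sep b-coef₀ annihilated }
    where
    open Chain c
    open Space V
    open Reasoning
    module T = Linear T
    m = suc k
    a = poly (tip c)
    open Target (target k (coef a m))
    g = monomial (suc m) ⊕ scale (- 1#) b
    g-monic : MonicOfDegree g (suc m)
    g-monic = monic-resp-≋ (⊕-comm _ _) (⊕-monomial-monic (deg<-scale _ b-deg))
    -- Since T^(m+1) v = a(T) v, subtracting y = (a - b)(T) v at the last basis vector replaces the
    -- last column a of the companion operator by b.
    y = eval (a ⊕ scale (- 1#) b) T v
    ℓ = coefₗ m ∘ₗ polyₗ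
    R = rankOne ℓ y
    B = T +ₗ (scalar (- 1#) ∘ₗ R)

    spanned : ∀ u → u ≈ eval (poly u) T v
    spanned u = trans (decompose u) (trans (⊞-congˡ (Linear.cong-𝟎 ι λ ())) (⊞-identityʳ _))

    poly-eval : ∀ {p} → p deg< suc m → poly (eval p T v) ≋ p
    poly-eval dp = proj₁ (coords-unique {w = λ ()} dp (sym (trans (⊞-congˡ (Linear.cong-𝟎 ι λ ())) (⊞-identityʳ _))))

    ℓy≈ : app ℓ y ≈ₖ μ + - 1#
    ℓy≈ = K.trans (at (poly-eval (deg<-⊕ (poly-deg (tip c)) (deg<-scale _ b-deg))) m)
      (K.trans (coef-⊕ a _ m) (K.trans (K.+-congˡ (K.trans (coef-scale _ b m) (K.*-congˡ b-trace)))
      (solve 2 (λ z m → z :+ :- :1 :* ((z :+ :1) :- m) := m :- :1) K.refl (coef a m) μ)))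

    -- ℓ vanishes on T^i v for i < m, so `B` and `T` generate the same vectors from v up to exponent
    -- m.
    eval-B : ∀ p → p deg< suc m → eval p B v ≈ eval p T v
    eval-B [] dp = refl
    eval-B (x ∷ p) dp = ⊞-congˡ (trans (Linear.cong B (eval-B p dp′)) (trans
      (⊞-congˡ (trans (·-congˡ (trans (·-congʳ ℓ≈0) (·-zeroˡ y))) (·-zeroʳ _))) (⊞-identityʳ _)))
      where
      dp′ = deg<-mono (ℕ.n≤1+n m) (deg<-tail dp)
      ℓ≈0 : app ℓ (eval p T v) ≈ₖ 0#
      ℓ≈0 = K.trans (at (poly-eval dp′) m) (vanish (deg<-tail dp) m ℕ.≤-refl)

    x^m = monomial m
    x^m-deg = monic-bound (monomial-monic m)

    eval-tip : eval (monomial (suc m)) B v ≈ eval b B v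
    eval-tip = begin
      eval (0# ∷ x^m) B v ≈⟨ eval-0∷ B x^m v ⟩
      app B (eval x^m B v) ≈⟨ Linear.cong B (eval-B x^m x^m-deg) ⟩
      app T (eval x^m T v) ⊞ ⊟ (app ℓ (eval x^m T v) · y)
        ≈⟨ ⊞-cong (trans (sym (eval-0∷ T x^m v)) (spanned (tip c)))
             (·-congˡ (trans (·-congʳ (K.trans (at (poly-eval x^m-deg) m) (lead≈1 (monomial-monic m)))) (·-identity y))) ⟩
      eval a T v ⊞ ⊟ y ≈⟨ trans (eval-⊕ T a _ v) (⊞-congˡ (eval-scale T (- 1#) _ v)) ⟨
      eval (a ⊕ scale (- 1#) (a ⊕ scale (- 1#) b)) T v ≈⟨ eval-cong T (x-[x-y]≈y a b) v ⟩
      eval b T v ≈⟨ eval-B b b-deg ⟨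
      eval b B v ∎

    -- It suffices that g(B) kills v, because v generates the space under `B` too.
    annihilated : ∀ u → eval g B u ≈ 𝟎
    annihilated u = begin
      eval g B u ≈⟨ eval-congʳ B g (trans (spanned u) (sym (eval-B (poly u) (poly-deg u)))) ⟩
      eval g B (eval (poly u) B v) ≈⟨ eval-comm B g (poly u) v ⟩
      eval (poly u) B (eval g B v)
        ≈⟨ eval-congʳ B (poly u) (trans (eval-⊕ B (monomial (suc m)) _ v)
             (trans (⊞-congˡ (eval-scale B (- 1#) b v)) (≈⇒⊟≈𝟎 eval-tip))) ⟩
      eval (poly u) B 𝟎 ≈⟨ Linear.𝟎-homo (evalₗ B (poly u)) ⟩
      𝟎 ∎

  -- The quotient of U by ker f. For evaluation at v it models the cyclic subspace K[T] v.
  coimage : ∀ {U V} → Linear U V → Space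
  coimage {U} {V} f = record
    { Carrier = U.Carrier ; _≈_ = λ u v → app f u V.≈ app f v ; _⊞_ = U._⊞_ ; 𝟎 = U.𝟎 ; _·_ = U._·_
    ; isEquivalence = record { refl = V.refl ; sym = V.sym ; trans = V.trans }
    ; ⊞-cong = λ e e′ → V.trans (f.⊞-homo _ _) (V.trans (V.⊞-cong e e′) (V.sym (f.⊞-homo _ _)))
    ; ⊞-assoc = λ u v w → f.cong (U.⊞-assoc u v w)
    ; ⊞-comm = λ u v → f.cong (U.⊞-comm u v)
    ; ⊞-identityˡ = λ u → f.cong (U.⊞-identityˡ u)
    ; ·-cong = λ a e → V.trans (f.·-homo _ _) (V.trans (V.·-cong a e) (V.sym (f.·-homo _ _)))
    ; ·-distribˡ = λ a u v → f.cong (U.·-distribˡ a u v)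
    ; ·-distribʳ = λ a b u → f.cong (U.·-distribʳ a b u)
    ; ·-assoc = λ a b u → f.cong (U.·-assoc a b u)
    ; ·-identity = λ u → f.cong (U.·-identity u)
    ; ·-zeroˡ = λ u → f.cong (U.·-zeroˡ u) }
    where
    module U = Space U
    module V = Space V
    module f = Linear f

  -- K[T] v becomes the polynomials modulo the annihilator of v, with multiplication by X in the
  -- role of `T`. The polynomial 1 generates it, and division by X^(d+1) - a bounds the degrees
  -- needed, so `cyclic-good` applies to this summand.
  direct-sum : ∀ {V} {T : Op V} {d W} (c : Chain T (suc d) W) (Y : Op W) → let open Space V in
    (∀ w → app T (app (Chain.ι c) w) ≈ app (Chain.ι c) (app Y w)) →
    ∃[ a ] (a deg< suc d × tip c ≈ eval a T (Chain.v c)) → Good Y → Good T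
  direct-sum {V} {T} {d} {W} c Y invariant (a , da , tip≈) good-Y =
    good-iso {S = shift ⊗ₗ Y} iso
      (λ (p , w) → trans (⊞-cong (eval-0∷ T p v) (sym (invariant w))) (sym (T.⊞-homo _ _)))
      (good-⊗ {S = shift} (cyclic-good {T = shift} chain) good-Y)
    where
    open Chain c
    open Space V
    module T = Linear T
    module ι = Linear ι
    module W = Space W
    U = coimage (evalAt T v)
    module U = Space U

    shift : Op U
    shift = record
      { app = 0# ∷_
      ; cong = λ {p} {q} e → trans (eval-0∷ T p v) (trans (T.cong e) (sym (eval-0∷ T q v)))
      ; ⊞-homo = λ p q → eval-cong T (≋-trans (∷-cong (K.sym (K.+-identityˡ 0#)) ≋-refl) (≋-sym (∷-⊕-∷ _ _ _ _))) v
      ; ·-homo = λ a p → eval-cong T (≋-trans (∷-cong (K.sym (K.zeroʳ a)) ≋-refl) (≋-sym (scale-∷ _ _ _))) v }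

    g = monomial (suc d) ⊕ scale (- 1#) a
    g-monic : MonicOfDegree g (suc d)
    g-monic = monic-resp-≋ (⊕-comm _ _) (⊕-monomial-monic (deg<-scale _ da))
    g-kills : eval g T v ≈ 𝟎
    g-kills = trans (eval-⊕ T (monomial (suc d)) _ v) (trans (⊞-congˡ (eval-scale T (- 1#) a v)) (≈⇒⊟≈𝟎 tip≈))

    remainder : ∀ p → ∃[ r ] (r deg< suc d × eval p T v ≈ eval r T v)
    remainder p with divMod g-monic p
    ... | h , r , e , dr = r , dr , trans (eval-cong T e v) (trans (eval-⊕ T (g ⊛ h) r v) (trans
      (⊞-congʳ (trans (eval-⊛ T g h v) (trans (eval-comm T g h v)
        (Linear.cong-𝟎 (evalₗ T h) g-kills)))) (⊞-identityˡ _)))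

    eval-shift : ∀ p → eval {U} p shift (oneₚ F) ≋ p
    eval-shift [] = ≋-refl
    eval-shift (a ∷ p) = ≋-trans (⊕-cong (≋-trans (scale-∷ a 1# []) (∷-cong (K.*-identityʳ a) scale-[])) (∷-cong K.refl (eval-shift p)))
      (≋-trans (∷-⊕-∷ _ _ _ _) (∷-cong (K.+-identityʳ a) ([]-⊕ p)))

    chain : Chain shift (suc d) (coordSpace 0)
    chain = record
      { v = oneₚ F
      ; ι = zeroₗ
      ; cover = λ p → let (r , dr , e) = remainder p in r , (λ ()) , dr ,
          trans e (eval-cong T (≋-sym (≋-trans (⊕-identityʳ _) (eval-shift r))) v)
      ; indep = λ p w dp e → proj₁ (indep p W.𝟎 dp (trans (⊞-congˡ ι.𝟎-homo) (trans (⊞-identityʳ _)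
          (trans (eval-cong T (≋-sym (≋-trans (⊕-identityʳ _) (eval-shift p))) v) e)))) , λ () }

    iso : Iso (U ⊗ W) V
    iso = record
      { to = record
        { app = λ (p , w) → eval p T v ⊞ app ι w
        ; cong = λ (e , f) → ⊞-cong e (ι.cong f)
        ; ⊞-homo = λ _ _ → trans (⊞-cong (eval-⊕ T _ _ v) (ι.⊞-homo _ _)) (⊞-interchange _ _ _ _)
        ; ·-homo = λ a _ → trans (⊞-cong (eval-scale T a _ v) (ι.·-homo a _)) (sym (·-distribˡ a _ _)) }
      ; from = λ u → poly u , rest u
      ; to-from = λ u → sym (decompose u)
      ; to-kernel = λ (p , w) e →
          let (r , dr , p≈r) = remainder p
              (r≋[] , w≈0) = indep r w dr (trans (⊞-congʳ (sym p≈r)) e)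
          in trans p≈r (eval-≋[] T r≋[] v) , w≈0 }

  good-trivial : (T : Op (coordSpace 0)) → Good T
  good-trivial T = record
    { left = T ; right = T ; sum = λ _ ()
    ; left-semisimple = [] , All.[] , AllPairs.[] , λ _ ()
    ; right-semisimple = [] , All.[] , AllPairs.[] , λ _ () }

  -- Each lengthening of the chain lowers the dimension `e` of the complement by one, which makes
  -- the search for an invariant complement stop. `IH` is called only once `T` splits, for its
  -- action on the complement.
  chain-good : ∀ {V} {T : Op V} e d → Chain T (suc d) (coordSpace e) →
    (∀ e′ → e′ ≤ e → (S : Op (coordSpace e′)) → Good S) → Good T
  chain-good {V} {T} zero d c IH = direct-sum c Y (λ w → trans (Linear.cong-𝟎 T (Linear.cong-𝟎 ι λ ())) (sym (Linear.cong-𝟎 ι λ ())))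
    (poly (tip c) , poly-deg (tip c) , trans (decompose (tip c)) (trans (⊞-congˡ (Linear.cong-𝟎 ι λ ())) (⊞-identityʳ _)))
    (IH 0 z≤n Y)
    where
    open Chain c
    open Space V
    Y : Op (coordSpace 0)
    Y = zeroₗ
  chain-good {V} {T} (suc e) d c IH = onTip (vector-complement e (Chain.rest c (tip c)))
    where
    open Space V
    open Reasoning
    IH′ : ∀ e′ → e′ ≤ e → (S : Op (coordSpace e′)) → Good S
    IH′ e′ le = IH e′ (ℕ.≤-trans le (ℕ.n≤1+n e))
    a = Chain.poly c (tip c)
    z = Chain.rest c (tip c)

    onFunctional : (∀ i → z i ≈ₖ 0#) → (s : Sheared c) →
      (∀ w → app (Sheared.x s) w ≈ₖ 0#) ⊎ FunctionalSplit (Sheared.x s) (coordSpace e) → Good T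
    onFunctional z≈0 s (inj₂ split) = chain-good e (suc d) (reroot sheared x Y law split) IH′
      where open Sheared s
    onFunctional z≈0 s (inj₁ x≈0) = direct-sum sheared Y
      (λ w → trans (law w) (trans (⊞-congʳ (trans (·-congʳ (x≈0 w)) (·-zeroˡ _))) (⊞-identityˡ _)))
      (a , Chain.poly-deg c (tip c) , (begin
        tip sheared ≈⟨ eval-congʳ T (monomial (suc d)) v-same ⟩
        tip c ≈⟨ Chain.decompose c (tip c) ⟩
        eval a T (Chain.v c) ⊞ app (Chain.ι c) z
          ≈⟨ trans (⊞-congˡ (Linear.cong-𝟎 (Chain.ι c) z≈0)) (⊞-identityʳ _) ⟩
        eval a T (Chain.v c) ≈⟨ eval-congʳ T a v-same ⟨
        eval a T (Chain.v sheared) ∎))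
      (IH (suc e) ℕ.≤-refl Y)
      where open Sheared s

    onTip : (∀ i → z i ≈ₖ 0#) ⊎ Complement {coordSpace (suc e)} z (coordSpace e) → Good T
    onTip (inj₂ comp) = chain-good e (suc d) (extend c comp) IH′
    onTip (inj₁ z≈0) = onFunctional z≈0 (shear c) (functional-split e (Sheared.x (shear c)))

  -- Strong induction on the dimension, bounded by `n`; the first basis vector serves as a chain of
  -- length one.
  good : ∀ n e → e ≤ n → (T : Op (coordSpace e)) → Good T
  good n zero le T = good-trivial T
  good (suc n) (suc e) (s≤s le) T = chain-good e 0 chain λ e′ le′ → good n e′ (ℕ.≤-trans le′ le)
    where
    e₀ : Fin (suc e) → K
    e₀ zero = 1#
    e₀ (suc i) = 0#

    chain : Chain T 1 (coordSpace e)
    chain = record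
      { v = e₀
      ; ι = embed e
      ; cover = λ u → (u zero ∷ []) , (λ i → u (suc i)) , deg<-∷ deg<-[] , λ
        { zero → K.sym (K.trans (K.+-identityʳ _) (K.trans (eval-const T (u zero) e₀ zero) (K.*-identityʳ _)))
        ; (suc i) → K.sym (K.trans (K.+-congʳ (K.trans (eval-const T (u zero) e₀ (suc i)) (K.zeroʳ _))) (K.+-identityˡ _)) }
      ; indep = λ p w dp e →
          let p≋c = deg<1⇒const dp
              ev = λ i → K.trans (eval-cong T p≋c e₀ i) (eval-const T (coef p 0) e₀ i)
              c≈0 = K.trans (K.sym (K.trans (K.+-identityʳ _) (K.trans (ev zero) (K.*-identityʳ _)))) (e zero)
          in ≋-trans p≋c (≋-trans (∷-cong c≈0 ≋-refl) 0∷[]≋[]) ,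
             λ i → K.trans (K.sym (K.trans (K.+-congʳ (K.trans (ev (suc i)) (K.zeroʳ _))) (K.+-identityˡ _))) (e (suc i)) }

-- Finite sums

module FiniteSums (R : CommutativeRing 0ℓ 0ℓ) where

  open CommutativeRing R renaming (Carrier to K) hiding (zero; semiring)
  open Algebra.Properties.CommutativeSemigroup +-commutativeSemigroup using (interchange)

  -- Opaque for the same reason as _⊕_.
  opaque
    ∑ : ∀ {n} → (Fin n → K) → K
    ∑ = sumFin R

    ∑-unfold : ∀ {n} (f : Fin n → K) → ∑ f ≡ sumFin R f
    ∑-unfold f = ≡.refl

    ∑-[] : (f : Fin 0 → K) → ∑ f ≈ 0#
    ∑-[] f = refl

    ∑-suc : ∀ {n} (f : Fin (suc n) → K) → ∑ f ≈ f zero + ∑ (λ i → f (suc i))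
    ∑-suc f = refl

  ∑-cong : ∀ {n} {f g : Fin n → K} → (∀ i → f i ≈ g i) → ∑ f ≈ ∑ g
  ∑-cong {zero} e = trans (∑-[] _) (sym (∑-[] _))
  ∑-cong {suc n} e = trans (∑-suc _) (trans (+-cong (e zero) (∑-cong λ i → e (suc i))) (sym (∑-suc _)))

  ∑-zero : ∀ {n} {f : Fin n → K} → (∀ i → f i ≈ 0#) → ∑ f ≈ 0#
  ∑-zero {zero} e = ∑-[] _
  ∑-zero {suc n} e = trans (∑-suc _) (trans (+-cong (e zero) (∑-zero λ i → e (suc i))) (+-identityˡ 0#))

  ∑-+ : ∀ {n} (f g : Fin n → K) → ∑ (λ i → f i + g i) ≈ ∑ f + ∑ g
  ∑-+ {zero} f g = trans (∑-[] _) (sym (trans (+-cong (∑-[] f) (∑-[] g)) (+-identityˡ 0#)))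
  ∑-+ {suc n} f g = trans (∑-suc _) (trans (+-congˡ (∑-+ (λ i → f (suc i)) (λ i → g (suc i))))
    (trans (interchange _ _ _ _)
    (sym (+-cong (∑-suc f) (∑-suc g)))))

  ∑-*ˡ : ∀ {n} c (f : Fin n → K) → ∑ (λ i → c * f i) ≈ c * ∑ f
  ∑-*ˡ {zero} c f = trans (∑-[] _) (sym (trans (*-congˡ (∑-[] f)) (zeroʳ c)))
  ∑-*ˡ {suc n} c f = trans (∑-suc _) (trans (+-congˡ (∑-*ˡ c (λ i → f (suc i))))
    (trans (sym (distribˡ c _ _)) (*-congˡ (sym (∑-suc f)))))

  ∑-*ʳ : ∀ {n} c (f : Fin n → K) → ∑ (λ i → f i * c) ≈ ∑ f * c
  ∑-*ʳ c f = trans (∑-cong λ i → *-comm (f i) c) (trans (∑-*ˡ c f) (*-comm c _))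

  ∑-swap : ∀ {m n} (f : Fin m → Fin n → K) → ∑ (λ i → ∑ (f i)) ≈ ∑ (λ j → ∑ (λ i → f i j))
  ∑-swap {zero} f = trans (∑-[] _) (sym (∑-zero λ _ → ∑-[] _))
  ∑-swap {suc m} f = trans (∑-suc _) (trans (+-congˡ (∑-swap λ i → f (suc i)))
    (trans (sym (∑-+ (f zero) _)) (∑-cong λ j → sym (∑-suc _))))

  ∑-single : ∀ {n} (k : Fin n) (f : Fin n → K) → (∀ i → i ≢ k → f i ≈ 0#) → ∑ f ≈ f k
  ∑-single zero f e = trans (∑-suc f) (trans (+-congˡ (∑-zero λ i → e (suc i) λ ())) (+-identityʳ _))
  ∑-single (suc k) f e = trans (∑-suc f) (trans (+-cong (e zero λ ())
    (∑-single k (λ i → f (suc i)) λ i i≢k → e (suc i) λ { ≡.refl → i≢k ≡.refl })) (+-identityˡ _))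

-- From operators to matrices: inverses and minimal polynomials

module MatrixOperators (F : CommutativeRing 0ℓ 0ℓ) (isField : IsField F) (_≟_ : Decidable (CommutativeRing._≈_ F))
    {order : ℕ} (hasOrder : HasOrder F order) where

  open Polynomials F
  open PolynomialDivision F isField _≟_
  open Factorisation F isField _≟_ hasOrder
  open VectorSpaces F
  open SemisimpleOperators F isField _≟_ hasOrder
  open RingIdentities polyRing
  open FiniteSums F
  open CommutativeRing F renaming (Carrier to K) hiding (zero; semiring)
  open import Relation.Binary.Reasoning.Setoid setoid

  private
    Mat = Matrix F

  ∑-δˡ : ∀ {n} (i : Fin n) f → ∑ (λ k → δ F i k * f k) ≈ f i
  ∑-δˡ zero f = trans (∑-suc _) (trans (+-cong (*-identityˡ _) (∑-zero λ k → zeroˡ _)) (+-identityʳ _))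
  ∑-δˡ (suc i) f = trans (∑-suc _) (trans (+-cong (zeroˡ _) (∑-δˡ i (λ k → f (suc k)))) (+-identityˡ _))

  *ₘ-∑ : ∀ {n} (A B : Mat n) i j → (_*ₘ_ F A B) i j ≈ ∑ (λ k → A i k * B k j)
  *ₘ-∑ A B i j = reflexive (≡.sym (∑-unfold _))

  δ-sym : ∀ {n} (i j : Fin n) → δ F i j ≡ δ F j i
  δ-sym zero zero = ≡.refl
  δ-sym zero (suc j) = ≡.refl
  δ-sym (suc i) zero = ≡.refl
  δ-sym (suc i) (suc j) = δ-sym i j

  ∑-δʳ : ∀ {n} (j : Fin n) f → ∑ (λ k → f k * δ F k j) ≈ f j
  ∑-δʳ j f = trans (∑-cong λ k → trans (*-comm _ _) (*-congʳ (reflexive (δ-sym k j)))) (∑-δˡ j f)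

  basis : ∀ {n} → Fin n → Fin n → K
  basis j k = δ F k j

  op : ∀ {n} → Mat n → Op (coordSpace n)
  op A = record
    { app = λ v i → ∑ (λ k → A i k * v k)
    ; cong = λ e i → ∑-cong λ k → *-congˡ (e k)
    ; ⊞-homo = λ u v i → trans (∑-cong λ k → distribˡ _ _ _) (∑-+ _ _)
    ; ·-homo = λ a u i → trans (∑-cong λ k →
        solve 3 (λ x a u → x :* (a :* u) := a :* (x :* u)) refl _ _ _) (∑-*ˡ a _) }

  matrix : ∀ {n} → Op (coordSpace n) → Mat n
  matrix T i j = app T (basis j) i

  op-matrix : ∀ {n} (T : Op (coordSpace n)) v i → app (op (matrix T)) v i ≈ app T v i
  op-matrix {n} T v i = begin
    ∑ (λ k → app T (basis k) i * v k) ≈⟨ linear-∑ (λ j → basis j) v ⟨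
    app T (λ k → ∑ (λ j → basis j k * v j)) i ≈⟨ Linear.cong T (λ k → ∑-δˡ k v) i ⟩
    app T v i ∎
    where
    linear-∑ : ∀ {m} (b : Fin m → Fin n → K) (c : Fin m → K) →
      app T (λ k → ∑ (λ j → b j k * c j)) i ≈ ∑ (λ j → app T (b j) i * c j)
    linear-∑ {zero} b c = trans (Linear.cong-𝟎 T (λ k → ∑-[] _) i) (sym (∑-[] _))
    linear-∑ {suc m} b c = trans (trans (Linear.cong T (λ k → ∑-suc _) i)
      (Linear.⊞-homo T (λ k → b zero k * c zero) (λ k → ∑ (λ j → b (suc j) k * c (suc j))) i))
      (trans (+-cong (trans (Linear.cong T {v = λ k → c zero * b zero k} (λ k → *-comm _ _) i)
          (trans (Linear.·-homo T (c zero) (b zero) i) (*-comm _ _)))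
              (linear-∑ (λ j → b (suc j)) (λ j → c (suc j)))) (sym (∑-suc _)))

  op-* : ∀ {n} (A B : Mat n) v i → app (op (_*ₘ_ F A B)) v i ≈ app (op A) (app (op B) v) i
  op-* A B v i = begin
    ∑ (λ k → (_*ₘ_ F A B) i k * v k) ≈⟨ ∑-cong (λ k → *-congʳ (*ₘ-∑ A B i k)) ⟩
    ∑ (λ k → ∑ (λ l → A i l * B l k) * v k) ≈⟨ ∑-cong (λ k → sym (∑-*ʳ (v k) (λ l → A i l * B l k))) ⟩
    ∑ (λ k → ∑ (λ l → A i l * B l k * v k)) ≈⟨ ∑-swap (λ k l → A i l * B l k * v k) ⟩
    ∑ (λ l → ∑ (λ k → A i l * B l k * v k))
      ≈⟨ ∑-cong (λ l → trans (∑-cong λ k → *-assoc _ _ _) (∑-*ˡ (A i l) (λ k → B l k * v k))) ⟩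
    ∑ (λ l → A i l * ∑ (λ k → B l k * v k)) ∎

  op-injective : ∀ {n} {A B : Mat n} → (∀ v i → app (op A) v i ≈ app (op B) v i) → _≈ₘ_ F A B
  op-injective {A = A} {B} e i j = trans (sym (∑-δʳ j (A i))) (trans (e (basis j) i) (∑-δʳ j (B i)))

  op-evalₘ : ∀ {n} (A : Mat n) p v i → app (op (evalₘ F p A)) v i ≈ eval p (op A) v i
  op-evalₘ A [] v i = ∑-zero λ k → zeroˡ _
  op-evalₘ A (a ∷ p) v i = begin
    ∑ (λ k → (a * δ F i k + (_*ₘ_ F A (evalₘ F p A)) i k) * v k)
      ≈⟨ trans (∑-cong λ k → distribʳ _ _ _) (∑-+ (λ k → a * δ F i k * v k) _) ⟩
    ∑ (λ k → a * δ F i k * v k) + app (op (_*ₘ_ F A (evalₘ F p A))) v i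
      ≈⟨ +-cong (trans (∑-cong λ k → *-assoc _ _ _) (trans (∑-*ˡ a (λ k → δ F i k * v k)) (*-congˡ (∑-δˡ i v))))
                (trans (op-* A (evalₘ F p A) v i) (Linear.cong (op A) (op-evalₘ A p v) i)) ⟩
    a * v i + app (op A) (eval p (op A) v) i ∎

  evalₘ⇒annihilates : ∀ {n} {A : Mat n} p → _≈ₘ_ F (evalₘ F p A) (zeroₘ F) → Annihilates p (op A)
  evalₘ⇒annihilates {A = A} p e v i = trans (sym (op-evalₘ A p v i)) (∑-zero λ k → trans (*-congʳ (e i k)) (zeroˡ _))

  annihilates⇒evalₘ : ∀ {n} {A : Mat n} p → Annihilates p (op A) → _≈ₘ_ F (evalₘ F p A) (zeroₘ F)
  annihilates⇒evalₘ {A = A} p ann = op-injective λ v i →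
    trans (op-evalₘ A p v i) (trans (ann v i) (sym (∑-zero λ k → zeroˡ _)))

  annihilates? : ∀ {n} (A : Mat n) p → Dec (Annihilates p (op A))
  annihilates? A p with Fin.all? (λ i → Fin.all? (λ j → evalₘ F p A i j ≟ 0#))
  ... | yes e = yes (evalₘ⇒annihilates p e)
  ... | no ¬e = no λ ann → ¬e (annihilates⇒evalₘ p ann)

  evalₘ-comm : ∀ {n} (A : Mat n) p → _≈ₘ_ F (_*ₘ_ F (evalₘ F p A) A) (_*ₘ_ F A (evalₘ F p A))
  evalₘ-comm A p = op-injective λ v i → begin
    app (op (_*ₘ_ F E A)) v i ≈⟨ op-* E A v i ⟩
    app (op E) (app (op A) v) i ≈⟨ op-evalₘ A p (app (op A) v) i ⟩
    eval p (op A) (app (op A) v) i ≈⟨ eval-∘ (op A) p v i ⟩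
    app (op A) (eval p (op A) v) i ≈⟨ Linear.cong (op A) (op-evalₘ A p v) i ⟨
    app (op A) (app (op E) v) i ≈⟨ op-* A E v i ⟨
    app (op (_*ₘ_ F A E)) v i ∎
    where E = evalₘ F p A

  -- If a + X p annihilates A and a is nonzero, then A p(A) = -a, and p(A) commutes with A; so -
  -- p(A) / a is the inverse.
  invertible : ∀ {n} {A : Mat n} p → Annihilates p (op A) → ¬ (coef p 0 ≈ 0#) → Invertible F A
  invertible [] ann c≉0 = ⊥-elim (c≉0 refl)
  invertible {n} {A} (a ∷ p) ann a≉0 = B , AB≈1 , BA≈1
    where
    E = evalₘ F p A
    s = - inv a≉0
    B = scaleₘ F s E
    s*AE : ∀ i j → s * (_*ₘ_ F A E) i j ≈ δ F i j
    s*AE i j = begin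
      s * (_*ₘ_ F A E) i j
        ≈⟨ solve 4 (λ y a d x → :- y :* x := (y :* a) :* d :- y :* (a :* d :+ x)) refl (inv a≉0) a (δ F i j) _ ⟩
      (inv a≉0 * a) * δ F i j - inv a≉0 * (a * δ F i j + (_*ₘ_ F A E) i j)
        ≈⟨ +-cong (*-congʳ (inv-inverse a≉0)) (-‿cong (*-congˡ (annihilates⇒evalₘ (a ∷ p) ann i j))) ⟩
      1# * δ F i j - inv a≉0 * 0#
        ≈⟨ solve 2 (λ d y → :1 :* d :- y :* :0 := d) refl _ _ ⟩
      δ F i j ∎
    AB≈1 : _≈ₘ_ F (_*ₘ_ F A B) (idₘ F)
    AB≈1 i j = trans (*ₘ-∑ A B i j) (trans (∑-cong λ k → solve 3 (λ x s y → x :* (s :* y) := s :* (x :* y)) refl _ _ _)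
      (trans (∑-*ˡ s (λ k → A i k * E k j)) (trans (*-congˡ (sym (*ₘ-∑ A E i j))) (s*AE i j))))
    BA≈1 : _≈ₘ_ F (_*ₘ_ F B A) (idₘ F)
    BA≈1 i j = trans (*ₘ-∑ B A i j) (trans (∑-cong λ k → *-assoc s (E i k) (A k j))
      (trans (∑-*ˡ s (λ k → E i k * A k j)) (trans (*-congˡ (trans (sym (*ₘ-∑ E A i j)) (evalₘ-comm A p i j))) (s*AE i j))))

  ∏-coef₀ : ∀ {fs} → All Factor fs → ¬ (coef (∏ fs) 0 ≈ 0#)
  ∏-coef₀ [] = 1≉0
  ∏-coef₀ {f ∷ fs} (o ∷ ok) e = *-nonzero (coef₀≉0 o) (∏-coef₀ ok)
    (trans (sym (trans (at (∏-∷ f fs) 0) (coef₀-⊛ f (∏ fs)))) e)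

  -- The prefix u is the product of the factors to the left, whose removal is decided later.
  minimise : ∀ {n} (A : Mat n) fs u → All Factor fs → Distinct fs → Annihilates (u ⊛ ∏ fs) (op A) →
    ∃[ fs′ ] ((∀ {Q : Poly F → Set} → All Q fs → All Q fs′) × Distinct fs′ × Annihilates (u ⊛ ∏ fs′) (op A) ×
      (∀ p → Annihilates (u ⊛ p) (op A) → ∏ fs′ ∣ p))
  minimise A [] u [] [] ann = [] , (λ a → a) , [] , ann , λ p _ → p , ≋-sym (⊛-identityˡ p)
  minimise {n} A (f ∷ fs) u (o ∷ ok) (f# ∷ distinct) ann
    with minimise A fs (u ⊛ f) ok distinct (λ v → Space.trans (coordSpace n)
      (eval-cong (op A) (≋-trans (⊛-assoc u f _) (⊛-cong (≋-refl {u}) (≋-sym (∏-∷ f fs)))) v) (ann v))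
  ... | fs′ , sub , distinct′ , ann′ , min with annihilates? A (u ⊛ ∏ fs′)
  ...   | yes ann″ = fs′ , (λ { (_ ∷ a) → sub a }) , distinct′ , ann″ , λ p e → min p (annihilates-∣ {T = op A} (f , [uf]p≈[up]f u f p) e)
  ...   | no ¬ann = f ∷ fs′ , (λ { (q ∷ a) → q ∷ sub a }) , sub f# ∷ distinct′ ,
    (λ v → Space.trans (coordSpace n) (eval-cong (op A) (≋-trans (⊛-cong (≋-refl {u}) (∏-∷ f fs′)) (≋-sym (⊛-assoc u f _))) v) (ann′ v)) ,
    λ p e → divides p e (min p (annihilates-∣ {T = op A} (f , [uf]p≈[up]f u f p) e))
    where
    divides : ∀ p → Annihilates (u ⊛ p) (op A) → ∏ fs′ ∣ p → ∏ (f ∷ fs′) ∣ p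
    divides p ann-p (s , e) with irreducible⇒∣⊎coprime (irreducible o) s
    ... | inj₁ (t , s≋ft) = t , ≋-trans e (≋-trans (⊛-cong (≋-refl {∏ fs′}) s≋ft)
      (≋-trans (≋-sym (⊛-assoc (∏ fs′) f t)) (⊛-cong (≋-trans (⊛-comm (∏ fs′) f) (≋-sym (∏-∷ f fs′))) ≋-refl)))
    -- With p = ∏ fs′ · s and a f + b s = 1, the product u ∏ fs′ is a combination of u f ∏ fs′ and u
    -- p. Both annihilate, so f would have been discarded.
    ... | inj₂ (a , b , af+bs≋1) = ⊥-elim (¬ann λ v → V.trans
      (eval-cong (op A) (≋-trans (≋-sym (⊛-identityˡ _)) (≋-trans (⊛-cong (≋-sym af+bs≋1) ≋-refl)
        (≋-trans ([af+bs][uq]≈a[[uf]q]+b[u[qs]] a f b s u (∏ fs′))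
          (⊕-cong ≋-refl (⊛-cong (≋-refl {b}) (⊛-cong (≋-refl {u}) (≋-sym e))))))) v)
      (V.trans (eval-⊕ (op A) (a ⊛ _) (b ⊛ _) v) (V.𝟎-⊞-𝟎
        (annihilates-∣ {T = op A} (∣-⊛ˡ a ∣-refl) ann′ v)
        (annihilates-∣ {T = op A} (∣-⊛ˡ b ∣-refl) ann-p v))))
      where module V = Space (coordSpace n)

  private
    ≋⇒*ₚ : ∀ {f g h} → _≈ₚ_ F f (_*ₚ_ F g h) → f ≋ g ⊛ h
    ≋⇒*ₚ {f} {g} {h} e = ≡.subst (f ≋_) (≡.sym (⊛-unfold g h)) (≈ₚ⇒≋ e)

  Irred⇒Irreducible : ∀ {f} → Irred f → Irreducible F f
  Irred⇒Irreducible {f} irr = (λ (c , e) → nonconstant irr (≈ₚ⇒≋ {f} e)) ,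
    λ g h e → Sum.map unit unit (factors irr g h (≋⇒*ₚ e))
    where
    unit : ∀ {g} → IsUnit g → IsUnitₚ F g
    unit (c , c≉0 , e) = c , c≉0 , ≋⇒≈ₚ e

  Sep⇒Separable : ∀ {f} → Sep f → Separable F f
  Sep⇒Separable {f} (a , b , e) = a , b , ≋⇒≈ₚ (≡.subst (_≋ oneₚ F)
    (≡.trans (⊕-unfold _ _) (≡.cong₂ (_+ₚ_ F) (⊛-unfold a f) (⊛-unfold b (D f)))) e)

  ∣⇒∣ₚ : ∀ {f g} → f ∣ g → _∣ₚ_ F f g
  ∣⇒∣ₚ {f} {g} (h , e) = h , ≋⇒≈ₚ (≡.subst (g ≋_) (⊛-unfold f h) e)

  semisimpleOp⇒semisimple : ∀ {n} {A : Mat n} → SemisimpleOp (op A) → Invertible F A × Semisimple F A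
  semisimpleOp⇒semisimple {n} {A} (fs , ok , distinct , ann) = invertible (∏ fs) ann (∏-coef₀ ok) , result
    where
    one⊛ : ∀ {p} → Annihilates p (op A) → Annihilates (oneₚ F ⊛ p) (op A)
    one⊛ = annihilates-∣ {T = op A} (∣-⊛ˡ (oneₚ F) ∣-refl)
    result : Semisimple F A
    result with minimise A fs (oneₚ F) ok distinct (one⊛ {∏ fs} ann)
    ... | fs′ , sub , distinct′ , ann′ , min = fs′ ,
      All.map (λ o → monic o , Irred⇒Irreducible (irreducible o) , Sep⇒Separable (separable o)) (sub ok) ,
      AllPairs.map (λ f≉g e → f≉g (≈ₚ⇒≋ e)) distinct′ ,
      ∏-Monic (All.map monic (sub ok)) ,
      annihilates⇒evalₘ (∏ fs′) (annihilates-∣ {T = op A} (oneₚ F , one⊛one) ann′) ,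
      λ p e → ∣⇒∣ₚ (min p (one⊛ {p} (evalₘ⇒annihilates p e)))
      where
      one⊛one : ∏ fs′ ≋ (oneₚ F ⊛ ∏ fs′) ⊛ oneₚ F
      one⊛one = ≋-sym (≋-trans (⊛-comm _ (oneₚ F)) (≋-trans (⊛-identityˡ _) (⊛-identityˡ _)))

-- Hessenberg matrices: determinants, cyclicity and the splitting for (a)

module HessenbergMatrices (F : CommutativeRing 0ℓ 0ℓ) (isField : IsField F) (_≟_ : Decidable (CommutativeRing._≈_ F))
    {order : ℕ} (hasOrder : HasOrder F order) where

  open Polynomials F
  open PolynomialDivision F isField _≟_
  open Factorisation F isField _≟_ hasOrder
  open VectorSpaces F
  open SemisimpleOperators F isField _≟_ hasOrder
  open MatrixOperators F isField _≟_ hasOrder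
  open RingIdentities polyRing
  open FiniteSums F
  module PΣ = FiniteSums polyRing
  open CommutativeRing F renaming (Carrier to K) hiding (zero; semiring)
  open import Relation.Binary.Reasoning.Setoid polySetoid

  private
    P = Poly F
    Mat = Matrix F

    PolyMatrix : ℕ → Set
    PolyMatrix n = Fin n → Fin n → P

    minor : ∀ {n} → PolyMatrix (suc n) → Fin (suc n) → PolyMatrix n
    minor M j i k = M (suc i) (punchIn j k)

  opaque
    det : ∀ {n} → PolyMatrix n → P
    det = detₚ F

    det-unfold : ∀ {n} (M : PolyMatrix n) → det M ≡ detₚ F M
    det-unfold M = ≡.refl

    det-0 : (M : PolyMatrix 0) → det M ≋ oneₚ F
    det-0 M = ≋-refl

    det-suc : ∀ {n} (M : PolyMatrix (suc n)) →
      det M ≋ PΣ.∑ (λ j → scale (sgn F j) (M zero j ⊛ det (minor M j)))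
    det-suc M = sumFinₚ≋ _ _ λ j → ≡.subst (_≋ scale (sgn F j) (M zero j ⊛ det (minor M j)))
      (≡.trans (scale-unfold (sgn F j) _) (≡.cong (scaleₚ F (sgn F j)) (⊛-unfold (M zero j) _))) ≋-refl
      where
      sumFinₚ≋ : ∀ {n} (f g : Fin n → P) → (∀ j → f j ≋ g j) → sumFinₚ F f ≋ PΣ.∑ g
      sumFinₚ≋ {zero} f g e = ≋-sym (PΣ.∑-[] g)
      sumFinₚ≋ {suc n} f g e = ≋-trans
        (≡.subst (_≋ g zero ⊕ PΣ.∑ (λ i → g (suc i))) (⊕-unfold (f zero) _)
          (⊕-cong (e zero) (sumFinₚ≋ (λ i → f (suc i)) (λ i → g (suc i)) λ i → e (suc i))))
        (≋-sym (PΣ.∑-suc g))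

  det-cong : ∀ {n} {M N : PolyMatrix n} → (∀ i j → M i j ≋ N i j) → det M ≋ det N
  det-cong {zero} {M} {N} e = ≋-trans (det-0 M) (≋-sym (det-0 N))
  det-cong {suc n} {M} {N} e = ≋-trans (det-suc M) (≋-trans
    (PΣ.∑-cong λ j → scale-cong refl (⊛-cong (e zero j) (det-cong λ i k → e (suc i) (punchIn j k))))
    (≋-sym (det-suc N)))

  -- The expansion is along the first row, so the column is reached by induction: every minor but
  -- the first still contains it.
  det-zeroColumn : ∀ {n} (M : PolyMatrix (suc n)) → (∀ i → M i zero ≋ []) → det M ≋ []
  det-zeroColumn {n} M e = ≋-trans (det-suc M) (PΣ.∑-zero (term n M e))
    where
    term : ∀ n (M : PolyMatrix (suc n)) → (∀ i → M i zero ≋ []) → ∀ j → scale (sgn F j) (M zero j ⊛ det (minor M j)) ≋ []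
    term n M e zero = ≋-trans (scale-cong refl (≋-trans (⊛-cong (e zero) ≋-refl) ([]-⊛ _))) scale-[]
    term (suc n) M e (suc j) = ≋-trans (scale-cong refl
      (≋-trans (⊛-cong (≋-refl {M zero (suc j)}) (det-zeroColumn (minor M (suc j)) λ i → e (suc i))) (⊛-zeroʳ _))) scale-[]

  det-singleColumn : ∀ {n} (M : PolyMatrix (suc n)) → (∀ i → M (suc i) zero ≋ []) →
    det M ≋ M zero zero ⊛ det (minor M zero)
  det-singleColumn {n} M e = ≋-trans (det-suc M) (≋-trans (PΣ.∑-suc _)
    (≋-trans (⊕-cong (scale-1 _) (PΣ.∑-zero (term n M e))) (⊕-identityʳ _)))
    where
    term : ∀ n (M : PolyMatrix (suc n)) → (∀ i → M (suc i) zero ≋ []) → ∀ j →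
      scale (sgn F (suc j)) (M zero (suc j) ⊛ det (minor M (suc j))) ≋ []
    term (suc n) M e j = ≋-trans (scale-cong refl
      (≋-trans (⊛-cong (≋-refl {M zero (suc j)}) (det-zeroColumn (minor M (suc j)) e)) (⊛-zeroʳ _))) scale-[]

  -- The subdiagonal entries are -1 because the matrices arise as X - A.
  Hessenberg : ∀ n → PolyMatrix (suc n) → Set
  Hessenberg zero M = ⊤
  Hessenberg (suc n) M = (M (suc zero) zero ≋ scale (- 1#) (oneₚ F)) × (∀ i → M (suc (suc i)) zero ≋ []) ×
    Hessenberg n (λ i j → M (suc i) (suc j))

  -- The determinant of the Hessenberg matrix with first row r and lower right block H:
  -- the row operation clearing the -1 under r₀ adds r₀ times the second row.
  hessDet : ∀ n → (Fin (suc n) → P) → PolyMatrix n → P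
  hessDet zero r H = r zero
  hessDet (suc n) r H = hessDet n (λ j → r zero ⊛ H zero j ⊕ r (suc j)) (λ i j → H (suc i) (suc j))

  hessDet-cong : ∀ n {r s} H → (∀ j → r j ≋ s j) → hessDet n r H ≋ hessDet n s H
  hessDet-cong zero H e = e zero
  hessDet-cong (suc n) H e = hessDet-cong n _ λ j → ⊕-cong (⊛-cong (e zero) ≋-refl) (e (suc j))

  -- Linearity in the first row merges the two determinants left by a cofactor expansion into the
  -- row operation of `hessDet`.
  hessDet-linear : ∀ n x r s H → x ⊛ hessDet n r H ⊕ hessDet n s H ≋ hessDet n (λ j → x ⊛ r j ⊕ s j) H
  hessDet-linear zero x r s H = ≋-refl
  hessDet-linear (suc n) x r s H = ≋-trans (hessDet-linear n x _ _ _)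
    (hessDet-cong n _ λ j → ≋-sym ([xa+b]c+[xd+e]≈x[ac+d]+[bc+e] x (r zero) (s zero) (H zero j) (r (suc j)) (s (suc j))))

  replaceRow : ∀ {n} → (Fin (suc n) → P) → PolyMatrix (suc n) → PolyMatrix (suc n)
  replaceRow r M zero = r
  replaceRow r M (suc i) = M (suc i)

  hessenberg-replaceRow : ∀ n r {M} → Hessenberg n M → Hessenberg n (replaceRow r M)
  hessenberg-replaceRow zero r h = tt
  hessenberg-replaceRow (suc n) r h = h

  -- Each minor but the first has first column (-1, 0, ..., 0). Its -1 cancels the shift of sign, so
  -- these terms add up to the determinant of the lower right block with its first row replaced by
  -- the rest of the first row of M.
  det-upper : ∀ n M → Hessenberg n M → det M ≋ hessDet n (M zero) (λ i j → M (suc i) (suc j))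
  det-upper zero M _ = ≋-trans (det-suc M) (≋-trans (PΣ.∑-suc _) (≋-trans (⊕-cong (scale-1 _) (PΣ.∑-[] _))
    (≋-trans (⊕-identityʳ _) (≋-trans (⊛-cong (≋-refl {M zero zero}) (det-0 _)) (≋-trans (⊛-comm _ _) (⊛-identityˡ _))))))
  det-upper (suc n) M (sub , zeros , hess) = begin
    det M ≈⟨ det-suc M ⟩
    PΣ.∑ (λ j → scale (sgn F j) (M zero j ⊛ det (minor M j))) ≈⟨ PΣ.∑-suc _ ⟩
    scale 1# (M zero zero ⊛ det N) ⊕ PΣ.∑ (λ j → scale (sgn F (suc j)) (M zero (suc j) ⊛ det (minor M (suc j))))
      ≈⟨ ⊕-cong (scale-1 _) (PΣ.∑-cong term) ⟩
    M zero zero ⊛ det N ⊕ PΣ.∑ (λ j → scale (sgn F j) (N′ zero j ⊛ det (minor N′ j)))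
      ≈⟨ ⊕-cong (⊛-cong (≋-refl {M zero zero}) (det-upper n N hess))
           (≋-trans (≋-sym (det-suc N′)) (det-upper n N′ (hessenberg-replaceRow n _ hess))) ⟩
    M zero zero ⊛ hessDet n (N zero) H ⊕ hessDet n (N′ zero) H ≈⟨ hessDet-linear n _ (N zero) (N′ zero) H ⟩
    hessDet (suc n) (M zero) N ∎
    where
    N : PolyMatrix (suc n)
    N i j = M (suc i) (suc j)
    N′ = replaceRow (λ j → M zero (suc j)) N
    H : PolyMatrix n
    H i j = N (suc i) (suc j)
    term : ∀ j → scale (sgn F (suc j)) (M zero (suc j) ⊛ det (minor M (suc j))) ≋ scale (sgn F j) (N′ zero j ⊛ det (minor N′ j))
    term j = begin
      scale (- sgn F j) (M zero (suc j) ⊛ det (minor M (suc j)))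
        ≈⟨ scale-cong refl (⊛-cong (≋-refl {M zero (suc j)}) (≋-trans (det-singleColumn (minor M (suc j)) zeros) (⊛-cong sub ≋-refl))) ⟩
      scale (- sgn F j) (M zero (suc j) ⊛ (scale (- 1#) (oneₚ F) ⊛ det (minor N′ j)))
        ≈⟨ ≋-trans (scale-cong (solve 1 (λ s → :- s := :- :1 :* s) refl _) ≋-refl) (≋-sym (scale-scale _ _ _)) ⟩
      scale (- 1#) (scale (sgn F j) (M zero (suc j) ⊛ (scale (- 1#) (oneₚ F) ⊛ det (minor N′ j))))
        ≈⟨ scale-cong refl (const-⊛ (sgn F j) _) ⟨
      scale (- 1#) ((sgn F j ∷ []) ⊛ (M zero (suc j) ⊛ (scale (- 1#) (oneₚ F) ⊛ det (minor N′ j))))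
        ≈⟨ -[s[r[-1d]]]≈s[rd] (sgn F j ∷ []) (M zero (suc j)) (det (minor N′ j)) ⟩
      (sgn F j ∷ []) ⊛ (M zero (suc j) ⊛ det (minor N′ j)) ≈⟨ const-⊛ (sgn F j) _ ⟩
      scale (sgn F j) (N′ zero j ⊛ det (minor N′ j)) ∎

  -- The first row has only two entries that may be nonzero, the second being -1, and the two minors
  -- differ in their first column alone. The outcome is the `hessDet` of the transpose, which gives
  -- invariance of the determinant under transposition for these matrices.
  det-lower : ∀ n M → Hessenberg n (λ i j → M j i) → det M ≋ hessDet n (λ i → M i zero) (λ i j → M (suc j) (suc i))
  det-lower zero M h = det-upper zero M h
  det-lower (suc n) M (sup , zeros , hess) = begin
    det M ≈⟨ det-suc M ⟩
    PΣ.∑ (λ j → scale (sgn F j) (M zero j ⊛ det (minor M j))) ≈⟨ ≋-trans (PΣ.∑-suc _) (⊕-cong (scale-1 _) (PΣ.∑-suc _)) ⟩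
    M zero zero ⊛ det N ⊕ (scale (- 1#) (M zero (suc zero) ⊛ det N′) ⊕
      PΣ.∑ (λ j → scale (sgn F (suc (suc j))) (M zero (suc (suc j)) ⊛ det (minor M (suc (suc j))))))
      ≈⟨ ⊕-cong ≋-refl (≋-trans (⊕-cong second (PΣ.∑-zero λ j →
           ≋-trans (scale-cong refl (≋-trans (⊛-cong (zeros j) ≋-refl) ([]-⊛ _))) scale-[])) (⊕-identityʳ _)) ⟩
    M zero zero ⊛ det N ⊕ det N′
      ≈⟨ ⊕-cong (⊛-cong (≋-refl {M zero zero}) (det-lower n N hess)) (det-lower n N′ (hess′ n {M} hess)) ⟩
    M zero zero ⊛ hessDet n (λ i → N i zero) H ⊕ hessDet n (λ i → N′ i zero) H ≈⟨ hessDet-linear n _ _ _ H ⟩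
    hessDet (suc n) (λ i → M i zero) (λ i j → M (suc j) (suc i)) ∎
    where
    N : PolyMatrix (suc n)
    N i j = M (suc i) (suc j)
    N′ : PolyMatrix (suc n)
    N′ = minor M (suc zero)
    H : PolyMatrix n
    H i j = N (suc j) (suc i)
    second : scale (- 1#) (M zero (suc zero) ⊛ det N′) ≋ det N′
    second = ≋-trans (scale-cong refl (⊛-cong sup ≋-refl)) (-[-1x]≈x (det N′))
    hess′ : ∀ n {M : PolyMatrix (suc (suc n))} → Hessenberg n (λ i j → M (suc j) (suc i)) → Hessenberg n (λ i j → minor M (suc zero) j i)
    hess′ zero h = tt
    hess′ (suc n) h = h

  module _ {N : ℕ} (T : Op (coordSpace N)) where
    private
      V = coordSpace N
      module V = Space V

      -- Each column of M, evaluated at `T`, is a linear relation among the vectors u. For X - A and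
      -- the standard basis it says that T e_j is the j-th column of A.
      Relation : ∀ {n} → PolyMatrix n → (Fin n → Fin N → K) → Set
      Relation M u = ∀ j k → ∑ (λ i → eval (M i j) T (u i) k) ≈ 0#

      -- The first column of M reads (M₀₀, -1, 0, ..., 0), so its relation solves for the second
      -- vector.
      second : ∀ n (M : PolyMatrix (suc (suc n))) u → Hessenberg (suc n) M → Relation M u →
        ∀ k → eval (M zero zero) T (u zero) k ≈ u (suc zero) k
      second n M u (sub , zeros , _) rel k = trans
        (solve 2 (λ a b → a := (a :+ (:- :1 :* b :+ :0)) :+ b) refl _ (u (suc zero) k))
        (trans (+-congʳ (trans (+-congˡ (+-cong (sym sub′) (sym (∑-zero λ i → eval-≋[] T (zeros i) (u (suc (suc i))) k))))
          (trans (+-congˡ (sym (∑-suc _))) (trans (sym (∑-suc _)) (rel zero k))))) (+-identityˡ _))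
        where
        sub′ : eval (M (suc zero) zero) T (u (suc zero)) k ≈ - 1# * u (suc zero) k
        sub′ = trans (eval-cong T sub (u (suc zero)) k) (trans (eval-scale T (- 1#) (oneₚ F) (u (suc zero)) k)
          (*-congˡ (eval-one T (u (suc zero)) k)))

      -- Substituting for the second vector eliminates it; the new first row is the one of the
      -- recursion in `hessDet`.
      step-matrix : ∀ n → PolyMatrix (suc (suc n)) → PolyMatrix (suc n)
      step-matrix n M = replaceRow (λ j → M zero zero ⊛ M (suc zero) (suc j) ⊕ M zero (suc j)) (λ i j → M (suc i) (suc j))

      step-vectors : ∀ {n} → (Fin (suc (suc n)) → Fin N → K) → Fin (suc n) → Fin N → K
      step-vectors u zero = u zero
      step-vectors u (suc i) = u (suc (suc i))

      step : ∀ n (M : PolyMatrix (suc (suc n))) u → Hessenberg (suc n) M → Relation M u →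
        Relation (step-matrix n M) (step-vectors u)
      step n M u h rel j k = trans (∑-suc _) (trans (+-congʳ first)
        (trans (+-assoc _ _ _) (trans (+-congˡ (sym (∑-suc _))) (trans (sym (∑-suc _)) (rel (suc j) k)))))
        where
        first : eval (M zero zero ⊛ M (suc zero) (suc j) ⊕ M zero (suc j)) T (u zero) k ≈
          eval (M zero (suc j)) T (u zero) k + eval (M (suc zero) (suc j)) T (u (suc zero)) k
        first = trans (eval-⊕ T (M zero zero ⊛ M (suc zero) (suc j)) _ (u zero) k) (trans (+-comm _ _)
          (+-congˡ (trans (eval-⊛ T (M zero zero) _ (u zero) k) (trans (eval-comm T (M zero zero) (M (suc zero) (suc j)) (u zero) k)
            (eval-congʳ T (M (suc zero) (suc j)) (second n M u h rel) k)))))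

    -- Eliminating all vectors but the first leaves a single relation, whose coefficient is the
    -- determinant.
    hessDet-kills : ∀ n M u → Hessenberg n M → Relation M u →
      eval (hessDet n (M zero) (λ i j → M (suc i) (suc j))) T (u zero) V.≈ V.𝟎
    hessDet-kills zero M u h rel k = trans (sym (trans (∑-suc _) (trans (+-congˡ (∑-[] _)) (+-identityʳ _)))) (rel zero k)
    hessDet-kills (suc n) M u h rel = hessDet-kills n (step-matrix n M) (step-vectors u)
      (hessenberg-replaceRow n _ (proj₂ (proj₂ h))) (step n M u h rel)

    -- By the elimination every vector is a polynomial in `T` applied to the first, and polynomials
    -- in `T` commute.
    kills-all : ∀ n M u g → Hessenberg n M → Relation M u → eval g T (u zero) V.≈ V.𝟎 → ∀ i → eval g T (u i) V.≈ V.𝟎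
    kills-all n M u g h rel e zero = e
    kills-all (suc n) M u g h rel e (suc zero) = V.trans (eval-congʳ T g (λ k → sym (second n M u h rel k)))
      (V.trans (eval-comm T g (M zero zero) (u zero)) (Linear.cong-𝟎 (evalₗ T (M zero zero)) e))
    kills-all (suc n) M u g h rel e (suc (suc i)) = kills-all n (step-matrix n M) (step-vectors u) g
      (hessenberg-replaceRow n _ (proj₂ (proj₂ h))) (step n M u h rel) e (suc i)

  characteristic : ∀ {n} → Mat n → PolyMatrix n
  characteristic A i j = - A i j + 0# ∷ δ F i j ∷ []

  charPoly≋det : ∀ {n} (A : Mat n) → charPoly F A ≋ det (characteristic A)
  charPoly≋det A = ≡.subst (_≋ det (characteristic A)) (det-unfold (characteristic A)) ≋-refl

  ∑ₚ-deg< : ∀ {n k} {f : Fin n → P} → (∀ j → f j deg< k) → PΣ.∑ f deg< k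
  ∑ₚ-deg< {zero} d = deg<-resp-≋ (≋-sym (PΣ.∑-[] _)) deg<-[]
  ∑ₚ-deg< {suc n} d = deg<-resp-≋ (≋-sym (PΣ.∑-suc _)) (deg<-⊕ (d zero) (∑ₚ-deg< λ j → d (suc j)))

  det-deg< : ∀ {n} (M : PolyMatrix n) → (∀ i j → M i j deg< 2) → det M deg< suc n
  det-deg< {zero} M d = deg<-resp-≋ (≋-sym (det-0 M)) (deg<-∷ deg<-[])
  det-deg< {suc n} M d = deg<-resp-≋ (≋-sym (det-suc M)) (∑ₚ-deg< λ j → deg<-scale _
    (deg<-⊛ (M zero j) (d zero j) (det-deg< (minor M j) λ i k → d (suc i) (punchIn j k))))

  module _ {n : ℕ} (A : Mat (suc n)) where
    private
      M = characteristic A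
      M-deg : ∀ i j → M i j deg< 2
      M-deg i j = deg<-∷ (deg<-∷ deg<-[])

    -- These terms are free of the corner entry of A, which makes the constant coefficient affine in
    -- it, and of too low degree to affect the leading coefficient.
    charPoly-tail : P
    charPoly-tail = PΣ.∑ (λ j → scale (sgn F (suc j)) (M zero (suc j) ⊛ det (minor M (suc j))))

    charPoly-expand : charPoly F A ≋
      M zero zero ⊛ charPoly F (λ i j → A (suc i) (suc j)) ⊕ charPoly-tail
    charPoly-expand = ≋-trans (charPoly≋det A) (≋-trans (det-suc M) (≋-trans (PΣ.∑-suc _)
      (⊕-cong (≋-trans (scale-1 _) (⊛-cong (≋-refl {M zero zero}) (≋-sym (charPoly≋det λ i j → A (suc i) (suc j))))) ≋-refl)))

    charPoly-tail-deg : charPoly-tail deg< suc n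
    charPoly-tail-deg = ∑ₚ-deg< λ j → deg<-scale _ (deg<-⊛ (M zero (suc j)) {m = 0}
      (deg<-∷ (≋[]⇒deg< 0∷[]≋[])) (det-deg< (minor M (suc j)) λ i k → M-deg (suc i) (punchIn (suc j) k)))

  charPoly-monic : ∀ {n} (A : Mat n) → MonicOfDegree (charPoly F A) n
  charPoly-monic {zero} A = monicOfDegree refl (deg<-∷ deg<-[])
  charPoly-monic {suc n} A = monic-resp-≋ (≋-sym (charPoly-expand A)) (monicOfDegree
    (trans (coef-⊕ p q (suc n)) (trans (+-cong (lead≈1 pm) (vanish (charPoly-tail-deg A) (suc n) ℕ.≤-refl)) (+-identityʳ 1#)))
    (deg<-⊕ (monic-bound pm) (deg<-mono (ℕ.n≤1+n _) (charPoly-tail-deg A))))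
    where
    p = characteristic A zero zero ⊛ charPoly F (λ i j → A (suc i) (suc j))
    q = charPoly-tail A
    pm : MonicOfDegree p (suc n)
    pm = monic-⊛ (monicOfDegree refl (deg<-∷ (deg<-∷ deg<-[]))) (charPoly-monic (λ i j → A (suc i) (suc j)))

  Upper : ∀ {n} → Mat n → Set
  Upper {zero} A = ⊤
  Upper {suc zero} A = ⊤
  Upper {suc (suc n)} A = (A (suc zero) zero ≈ 1#) × (∀ i → A (suc (suc i)) zero ≈ 0#) × Upper (λ i j → A (suc i) (suc j))

  infix 8 _ᵗ
  _ᵗ : ∀ {n} → Mat n → Mat n
  (A ᵗ) i j = A j i

  upper⇒hessenberg : ∀ n (A : Mat (suc n)) → Upper A → Hessenberg n (characteristic A)
  upper⇒hessenberg zero A u = tt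
  upper⇒hessenberg (suc n) A (sub , zeros , u) =
    ≋-trans (∷-cong (trans (+-identityʳ _) (-‿cong sub)) 0∷[]≋[])
      (≋-sym (≋-trans (scale-∷ _ _ []) (∷-cong (*-identityʳ _) scale-[]))) ,
    (λ i → ≋-trans (∷-cong (trans (+-identityʳ _) (trans (-‿cong (zeros i)) (solve 0 (:- :0 := :0) refl))) 0∷[]≋[]) 0∷[]≋[]) ,
    upper⇒hessenberg n (λ i j → A (suc i) (suc j)) u

  charPoly-ᵗ : ∀ n (A : Mat (suc n)) → Upper A → charPoly F (A ᵗ) ≋ charPoly F A
  charPoly-ᵗ n A u = begin
    charPoly F (A ᵗ) ≈⟨ charPoly≋det (A ᵗ) ⟩
    det (characteristic (A ᵗ)) ≈⟨ det-cong (λ i j → ∷-cong refl (∷-cong (reflexive (δ-sym i j)) ≋-refl)) ⟩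
    det (λ i j → M j i) ≈⟨ det-lower n (λ i j → M j i) h ⟩
    hessDet n (M zero) (λ i j → M (suc i) (suc j)) ≈⟨ det-upper n M h ⟨
    det M ≈⟨ charPoly≋det A ⟨
    charPoly F A ∎
    where
    M = characteristic A
    h = upper⇒hessenberg n A u

  -- Transposition reverses products, which is harmless because p(A) commutes with A.
  evalₘ-ᵗ : ∀ {n} (A : Mat n) p i j → evalₘ F p (A ᵗ) i j ≈ evalₘ F p A j i
  evalₘ-ᵗ A [] i j = refl
  evalₘ-ᵗ A (a ∷ p) i j = +-cong (*-congˡ (reflexive (δ-sym i j)))
    (trans (*ₘ-∑ (A ᵗ) (evalₘ F p (A ᵗ)) i j) (trans
      (∑-cong λ k → trans (*-congˡ (evalₘ-ᵗ A p k j)) (*-comm _ _))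
      (trans (sym (*ₘ-∑ (evalₘ F p A) A j i)) (evalₘ-comm A p j i))))

  -- Cayley-Hamilton by elimination: the columns of X - A are relations among the basis vectors, so
  -- the determinant kills the first of them and thereby all.
  charPoly-annihilates : ∀ n (A : Mat (suc n)) → Upper A → Annihilates (charPoly F A) (op A)
  charPoly-annihilates n A u v i = trans (sym (op-evalₘ A χ v i)) (∑-zero λ k → trans (*-congʳ (entry i k)) (zeroˡ _))
    where
    χ = charPoly F A
    M = characteristic A
    T = op A
    V = coordSpace (suc n)
    module V = Space V
    h = upper⇒hessenberg n A u
    rel : ∀ j k → ∑ (λ i → eval (M i j) T (basis i) k) ≈ 0#
    rel j k = trans (∑-cong λ i → term i) (trans (∑-+ _ _)
      (trans (+-cong (trans (∑-cong λ i → *-comm _ _) (∑-δˡ k (λ i → - A i j + 0#)))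
        (trans (∑-cong λ i → *-congʳ (reflexive (δ-sym i j))) (trans (∑-δˡ j (λ i → app T (basis i) k)) (∑-δʳ j (A k)))))
      (solve 1 (λ a → (:- a :+ :0) :+ a := :0) refl (A k j))))
      where
      term : ∀ i → eval (M i j) T (basis i) k ≈ (- A i j + 0#) * δ F k i + δ F i j * app T (basis i) k
      term i = +-congˡ (trans (Linear.cong T (eval-const T (δ F i j) (basis i)) k) (Linear.·-homo T (δ F i j) (basis i) k))
    χ-kills : eval χ T (basis zero) V.≈ V.𝟎
    χ-kills k = trans (eval-cong T (≋-trans (charPoly≋det A) (det-upper n M h)) (basis zero) k) (hessDet-kills T n M basis h rel k)
    entry : ∀ i k → evalₘ F χ A i k ≈ 0#
    entry i k = trans (sym (∑-δʳ k (evalₘ F χ A i))) (trans (op-evalₘ A χ (basis k) i) (kills-all T n M basis χ h rel χ-kills k i))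

  upper-zero : ∀ {n} (A : Mat n) → Upper A → ∀ i k → suc (toℕ k) < toℕ i → A i k ≈ 0#
  upper-zero {suc (suc n)} A (sub , zeros , u) (suc (suc i)) zero lt = zeros i
  upper-zero {suc (suc n)} A (sub , zeros , u) (suc i) (suc k) (s≤s lt) = upper-zero (λ i j → A (suc i) (suc j)) u i k lt
  upper-zero {suc zero} A u zero k ()
  upper-zero {suc (suc n)} A u (suc zero) zero (s≤s ())

  upper-sub : ∀ {n} (A : Mat (suc n)) → Upper A → ∀ k → A (suc k) (inject₁ k) ≈ 1#
  upper-sub {suc n} A (sub , zeros , u) zero = sub
  upper-sub {suc n} A (sub , zeros , u) (suc k) = upper-sub (λ i j → A (suc i) (suc j)) u k

  -- Applying T raises the last nonzero coordinate by one position and keeps its value.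
  module _ {n : ℕ} (A : Mat (suc n)) (u : Upper A) where
    private
      T = op A
      e₀ : Fin (suc n) → K
      e₀ = basis zero

    eval-lead : ∀ p d → p deg< suc d →
      (∀ i → d < toℕ i → eval p T e₀ i ≈ 0#) × (∀ i → toℕ i ≡ d → eval p T e₀ i ≈ coef p d)
    eval-lead [] d dp = (λ _ _ → refl) , (λ _ _ → refl)
    eval-lead (a ∷ p) zero dp = above , at-zero
      where
      small : ∀ i → app T (eval p T e₀) i ≈ 0#
      small = Linear.cong-𝟎 T (eval-≋[] T (deg<0⇒≋[] (deg<-tail dp)) e₀)
      above : ∀ i → 0 < toℕ i → eval (a ∷ p) T e₀ i ≈ 0#
      above (suc i) _ = trans (+-cong (zeroʳ a) (small (suc i))) (+-identityˡ 0#)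
      at-zero : ∀ i → toℕ i ≡ 0 → eval (a ∷ p) T e₀ i ≈ a
      at-zero zero _ = trans (+-cong (*-identityʳ a) (small zero)) (+-identityʳ a)
    eval-lead (a ∷ p) (suc d) dp = above , at-suc
      where
      w = eval p T e₀
      IH = eval-lead p d (deg<-tail dp)
      above : ∀ i → suc d < toℕ i → eval (a ∷ p) T e₀ i ≈ 0#
      above (suc i) lt = trans (+-cong (zeroʳ a) (∑-zero term)) (+-identityˡ 0#)
        where
        term : ∀ k → A (suc i) k * w k ≈ 0#
        term k with d ℕ.<? toℕ k
        ... | yes d<k = trans (*-congˡ (proj₁ IH k d<k)) (zeroʳ _)
        ... | no d≮k = trans (*-congʳ (upper-zero A u (suc i) k (ℕ.≤-<-trans (s≤s (ℕ.≮⇒≥ d≮k)) lt))) (zeroˡ _)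
      at-suc : ∀ i → toℕ i ≡ suc d → eval (a ∷ p) T e₀ i ≈ coef p d
      at-suc (suc i) eq = trans (+-cong (zeroʳ a) (trans (∑-single (inject₁ i) (λ k → A (suc i) k * w k) term)
          (trans (*-cong (upper-sub A u i) (proj₂ IH (inject₁ i) toℕ≡d)) (*-identityˡ _)))) (+-identityˡ _)
        where
        toℕ≡d : toℕ (inject₁ i) ≡ d
        toℕ≡d = ≡.trans (Fin.toℕ-inject₁ i) (ℕ.suc-injective eq)
        term : ∀ k → k ≢ inject₁ i → A (suc i) k * w k ≈ 0#
        term k k≢ with d ℕ.<? toℕ k
        ... | yes d<k = trans (*-congˡ (proj₁ IH k d<k)) (zeroʳ _)
        ... | no d≮k = trans (*-congʳ (upper-zero A u (suc i) k (ℕ.≤-trans (s≤s k<d) (ℕ.≤-reflexive (≡.sym eq))))) (zeroˡ _)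
          where
          k<d : toℕ k < d
          k<d = ℕ.≤∧≢⇒< (ℕ.≮⇒≥ d≮k) λ k≡d → k≢ (Fin.toℕ-injective (≡.trans k≡d (≡.sym toℕ≡d)))

    e₀-faithful : ∀ p → p deg< suc n → (∀ i → eval p T e₀ i ≈ 0#) → p ≋ []
    e₀-faithful p dp e with degree? p
    ... | inj₁ p≋[] = p≋[]
    ... | inj₂ (d , h) = contradiction
      (trans (sym (proj₂ (eval-lead p d (bound h)) (Fin.fromℕ< d<) (Fin.toℕ-fromℕ< d<))) (e _)) (lead≉0 h)
      where d< = degree-< h dp

    -- The remainder of p modulo the characteristic polynomial kills e₀. Its degree is too small for
    -- that, as e₀ is a cyclic vector, unless it is zero.
    charPoly-minimal : ∀ p → Annihilates p T → charPoly F A ∣ p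
    charPoly-minimal p ann with divMod (charPoly-monic A) p
    ... | h , r , e , dr = h , ≋-trans e (≋-trans (⊕-cong ≋-refl (e₀-faithful r dr r-kills)) (⊕-identityʳ _))
      where
      V = coordSpace (suc n)
      module V = Space V
      χ = charPoly F A
      r-kills : eval r T e₀ V.≈ V.𝟎
      r-kills = V.trans (V.sym (V.trans (V.⊞-congʳ (V.trans (eval-⊛ T χ h e₀) (charPoly-annihilates n A u _))) (V.⊞-identityˡ _)))
        (V.trans (V.sym (V.trans (eval-cong T e e₀) (eval-⊕ T (χ ⊛ h) r e₀))) (ann e₀))

  cyclic-intro : ∀ {n} (A : Mat n) → Annihilates (charPoly F A) (op A) →
    (∀ p → Annihilates p (op A) → charPoly F A ∣ p) → Cyclic F A
  cyclic-intro {n} A ann min = m , (truncate-Monic {χ} n (lead≈1 (charPoly-monic A)) ,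
      annihilates⇒evalₘ m (λ v i → trans (eval-cong (op A) m≋χ v i) (ann v i)) ,
      λ p e → ∣⇒∣ₚ (m∣ p (min p (evalₘ⇒annihilates p e)))) , ≋⇒≈ₚ m≋χ
    where
    χ = charPoly F A
    m = truncate (suc n) χ
    m≋χ : m ≋ χ
    m≋χ = truncate-≋ (suc n) χ (monic-bound (charPoly-monic A))
    m∣ : ∀ p → χ ∣ p → m ∣ p
    m∣ p (h , e) = h , ≋-trans e (⊛-cong (≋-sym m≋χ) ≋-refl)

  upper-cyclic : ∀ {n} (A : Mat (suc n)) → Upper A → Cyclic F A
  upper-cyclic {n} A u = cyclic-intro A (charPoly-annihilates n A u) (charPoly-minimal A u)

  annihilates-ᵗ : ∀ {n} (A : Mat n) p → Annihilates p (op (A ᵗ)) → Annihilates p (op A)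
  annihilates-ᵗ A p ann = evalₘ⇒annihilates p λ i j →
    trans (sym (evalₘ-ᵗ A p j i)) (annihilates⇒evalₘ p ann j i)

  lower-annihilates : ∀ {n} (A : Mat (suc n)) → Upper (A ᵗ) → Annihilates (charPoly F A) (op A)
  lower-annihilates {n} A u = annihilates-ᵗ A (charPoly F A) λ v i → trans
    (eval-cong (op (A ᵗ)) (charPoly-ᵗ n (A ᵗ) u) v i) (charPoly-annihilates n (A ᵗ) u v i)

  lower-cyclic : ∀ {n} (A : Mat (suc n)) → Upper (A ᵗ) → Cyclic F A
  lower-cyclic {n} A u = cyclic-intro A (lower-annihilates A u) λ p ann →
    let (h , e) = charPoly-minimal (A ᵗ) u p (annihilates-ᵗ (A ᵗ) p ann)
    in h , ≋-trans e (⊛-cong (≋-sym (charPoly-ᵗ n (A ᵗ) u)) ≋-refl)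

  private
    cons : ∀ {n} → K → (Fin n → K) → Fin (suc n) → K
    cons a u zero = a
    cons a u (suc i) = u i

    block : ∀ {n} → K → (Fin n → K) → (Fin n → K) → Mat n → Mat (suc n)
    block d r c A zero = cons d r
    block d r c A (suc i) = cons (c i) (A i)

    unit : ∀ {n} → Fin n → K
    unit zero = 1#
    unit (suc i) = 0#

    block-upper : ∀ {n} d r (A : Mat n) → Upper A → Upper (block d r unit A)
    block-upper {zero} d r A u = tt
    block-upper {suc n} d r A u = refl , (λ _ → refl) , u

    block-lower : ∀ {n} d c (A : Mat n) → Upper (A ᵗ) → Upper (block d unit c A ᵗ)
    block-lower {zero} d c A u = tt
    block-lower {suc n} d c A u = refl , (λ _ → refl) , u

  -- The constant coefficient is affine in the corner entry d, with slope -χ₀.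
  corner : ∀ {n} r c (A : Mat n) → ¬ (coef (charPoly F A) 0 ≈ 0#) →
    ∃[ d₀ ] (∀ d → ¬ (d ≈ d₀) → ¬ (coef (charPoly F (block d r c A)) 0 ≈ 0#))
  corner r c A χ₀≉0 = d₀ , λ d d≉d₀ e → d≉d₀ (root d e)
    where
    χ₀ = coef (charPoly F A) 0
    -- The corner 0# is arbitrary, the tail being independent of it.
    ρ = coef (charPoly-tail (block 0# r c A)) 0
    d₀ = inv χ₀≉0 * ρ
    expand : ∀ d → coef (charPoly F (block d r c A)) 0 ≈ (- d + 0#) * χ₀ + ρ
    expand d = trans (at (charPoly-expand (block d r c A)) 0) (trans (coef-⊕ _ (charPoly-tail (block d r c A)) 0)
      (+-congʳ (coef₀-⊛ (- d + 0# ∷ 1# ∷ []) (charPoly F A))))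
    root : ∀ d → coef (charPoly F (block d r c A)) 0 ≈ 0# → d ≈ d₀
    root d e = trans (solve 1 (λ d → d := :1 :* d) refl d) (trans (*-congʳ (sym (inv-inverse χ₀≉0)))
      (trans (solve 4 (λ i x d r → (i :* x) :* d := i :* r :- i :* ((:- d :+ :0) :* x :+ r)) refl (inv χ₀≉0) χ₀ d ρ)
      (trans (+-congˡ (-‿cong (*-congˡ (trans (sym (expand d)) e)))) (solve 2 (λ a i → a :- i :* :0 := a) refl _ _))))

  module _ (avoid : TwoAvoidable F) where

    hessenberg-split : ∀ n (M : Mat n) → ∃[ A ] ∃[ B ] (_≈ₘ_ F M (_+ₘ_ F A B) × Upper (A ᵗ) × Upper B ×
      ¬ (coef (charPoly F A) 0 ≈ 0#) × ¬ (coef (charPoly F B) 0 ≈ 0#))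
    hessenberg-split zero M = M , M , (λ ()) , tt , tt , 1≉0 , 1≉0
    hessenberg-split (suc n) M with hessenberg-split n (λ i j → M (suc i) (suc j))
    ... | A , B , sum , lower , upper , α , β = block d unit c A , block (M zero zero - d) r unit B , sum′ ,
      block-lower d c A lower , block-upper (M zero zero - d) r B upper ,
      proj₂ cornerA d (proj₁ (proj₂ choice)) ,
      proj₂ cornerB (M zero zero - d) λ e → proj₂ (proj₂ choice)
        (trans (solve 2 (λ m d → d := m :- (m :- d)) refl (M zero zero) d) (+-congˡ (-‿cong e)))
      where
      -- The first column of A and the first row of B absorb the ones that Hessenberg form imposes
      -- on the other summand.
      c r : Fin n → K
      c i = M (suc i) zero - unit i
      r j = M zero (suc j) - unit j
      cornerA = corner unit c A α
      cornerB = corner r unit B β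
      -- The corner d of A fixes the corner M₀₀ - d of B, so the bad value for B becomes a second
      -- value that d must avoid.
      choice = avoid (proj₁ cornerA) (M zero zero - proj₁ cornerB)
      d = proj₁ choice
      sum′ : _≈ₘ_ F M (_+ₘ_ F (block d unit c A) (block (M zero zero - d) r unit B))
      sum′ zero zero = solve 2 (λ m d → m := d :+ (m :- d)) refl _ _
      sum′ zero (suc j) = solve 2 (λ m d → m := d :+ (m :- d)) refl _ _
      sum′ (suc i) zero = solve 2 (λ m d → m := (m :- d) :+ d) refl _ _
      sum′ (suc i) (suc j) = sum i j

-- Consequences of the order of the field, and the two decompositions of a matrix

module _ (F : CommutativeRing 0ℓ 0ℓ) where
  open CommutativeRing F hiding (zero)

  hasOrder⇒decidable : ∀ {q} → HasOrder F q → Decidable _≈_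
  hasOrder⇒decidable (e , e-inj , e-surj) x y with e-surj x | e-surj y
  ... | i , ei≈x | j , ej≈y with i Fin.≟ j
  ...   | yes ≡.refl = yes (trans (sym ei≈x) ej≈y)
  ...   | no i≢j = no λ x≈y → i≢j (e-inj i j (trans ei≈x (trans x≈y (sym ej≈y))))

  avoid-two : ∀ {q} → 3 ≤ q → HasOrder F q → TwoAvoidable F
  avoid-two {suc (suc (suc q))} (s≤s (s≤s (s≤s z≤n))) order@(e , e-inj , _) a b =
    pick (e zero ≟ a) (e zero ≟ b) (e (suc zero) ≟ a) (e (suc zero) ≟ b)
    where
    _≟_ = hasOrder⇒decidable order
    distinct : ∀ i j → ¬ (i ≡ j) → ∀ {c} → e i ≈ c → ¬ (e j ≈ c)
    distinct i j i≢j p q = i≢j (e-inj i j (trans p (sym q)))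
    pick : Dec (e zero ≈ a) → Dec (e zero ≈ b) → Dec (e (suc zero) ≈ a) → Dec (e (suc zero) ≈ b) →
      ∃[ c ] (¬ (c ≈ a) × ¬ (c ≈ b))
    pick (no p) (no q) _ _ = e zero , p , q
    pick (yes p) _ _ (no q) = e (suc zero) , distinct zero (suc zero) (λ ()) p , q
    pick (yes p) _ _ (yes q) = e (suc (suc zero)) ,
      distinct zero (suc (suc zero)) (λ ()) p , distinct (suc zero) (suc (suc zero)) (λ ()) q
    pick (no _) (yes p) (no q) _ = e (suc zero) , q , distinct zero (suc zero) (λ ()) p
    pick (no _) (yes p) (yes q) _ = e (suc (suc zero)) ,
      distinct (suc zero) (suc (suc zero)) (λ ()) q , distinct zero (suc (suc zero)) (λ ()) p

module Assembly (F : CommutativeRing 0ℓ 0ℓ) (isField : IsField F) (_≟_ : Decidable (CommutativeRing._≈_ F))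
  {q : ℕ} (hasOrder : HasOrder F q)
  (avoid : TwoAvoidable F) where
  open CommutativeRing F hiding (zero)
  open VectorSpaces F
  open SemisimpleOperators F isField _≟_ hasOrder
  open GoodOperators F isField _≟_ hasOrder avoid
  open MatrixOperators F isField _≟_ hasOrder
  open HessenbergMatrices F isField _≟_ hasOrder
  open PolynomialDivision F isField _≟_

  cyclic-sum : ∀ n (M : Matrix F (suc n)) → ∃[ A ] ∃[ B ] (Invertible F A × Invertible F B × Cyclic F A × Cyclic F B ×
    _≈ₘ_ F M (_+ₘ_ F A B))
  cyclic-sum n M =
    let (A , B , sum , lower , upper , α , β) = hessenberg-split avoid (suc n) M in A , B ,
    invertible (charPoly F A) (lower-annihilates A lower) α ,
    invertible (charPoly F B) (charPoly-annihilates n B upper) β ,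
    lower-cyclic A lower , upper-cyclic B upper , sum

  semisimple-sum : ∀ n (M : Matrix F n) → ∃[ A ] ∃[ B ] (Invertible F A × Invertible F B × Semisimple F A × Semisimple F B ×
    _≈ₘ_ F M (_+ₘ_ F A B))
  semisimple-sum n M = A , B , proj₁ ssA , proj₁ ssB , proj₂ ssA , proj₂ ssB , sum
    where
    -- `Good` decomposes T + 1, so the identity is subtracted beforehand.
    T = op M +ₗ scalar (- 1#)
    module G = Good (good n n ℕ.≤-refl T)
    A = matrix G.left
    B = matrix G.right

    op-semisimple : ∀ {S : Op (coordSpace n)} → SemisimpleOp S → SemisimpleOp (op (matrix S))
    op-semisimple {S} (fs , ok , distinct , ann) = fs , ok , distinct , λ v i →
      trans (eval-congˡ (op (matrix S)) S (op-matrix S) (productₚ F fs) v i) (ann v i)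

    ssA = semisimpleOp⇒semisimple (op-semisimple {G.left} G.left-semisimple)
    ssB = semisimpleOp⇒semisimple (op-semisimple {G.right} G.right-semisimple)
    sum : _≈ₘ_ F M (_+ₘ_ F A B)
    sum i j = trans (sym (∑-δʳ j (M i))) (trans
      (solve 2 (λ x y → x := (x :+ :- :1 :* y) :+ y) refl _ (basis j i)) (G.sum (basis j) i))

theorem1p6 : (q : ℕ) → IsPrimePower q → 3 ≤ q →
    (F : CommutativeRing 0ℓ 0ℓ) → IsField F → HasOrder F q →
    (n : ℕ) → 2 ≤ n → (M : Matrix F n) →
    (∃[ A ] ∃[ B ] (Invertible F A × Invertible F B × Cyclic F A × Cyclic F B ×
    _≈ₘ_ F M (_+ₘ_ F A B)))
    × (∃[ A ] ∃[ B ] (Invertible F A × Invertible F B × Semisimple F A × Semisimple F B ×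
    _≈ₘ_ F M (_+ₘ_ F A B)))
theorem1p6 q _ 3≤q F isField hasOrder (suc n) _ M = cyclic-sum n M , semisimple-sum (suc n) M
  where open Assembly F isField (hasOrder⇒decidable F hasOrder) hasOrder (avoid-two F 3≤q hasOrder)
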